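{- Let $k$ be a positive even integer, let $m\in\mathbb{N}$, $m\ge 1$, and put $i=\frac{m}{2}$. Let $q$ be a complex number with $0<|q|<1$, and define $$U_n(q) := q^{\frac{2i-1}{4}}\,\frac{\left(q^{\frac{k-(4i-2)}{4}},\,q^{\frac{3k+(4i-2)}{4}};\,q^{k}\right)_\infty}{\left(q^{\frac{k+(4i-2)}{4}},\,q^{\frac{3k-(4i-2)}{4}};\,q^{k}\right)_\infty}=q^{\frac{2i-1}{4}}\,\frac{f\left(-q^{\frac{k-(4i-2)}{4}},-q^{\frac{3k+(4i-2)}{4}}\right)}{f\left(-q^{\frac{k+(4i-2)}{4}},-q^{\frac{3k-(4i-2)}{4}}\right)},$$ where it is assumed that the numerator and the denominator of this quotient are nonzero. Then $$\frac{1}{U_n(q)}-U_n(q)=\frac{\phi\left(q^{\frac{k}{4}}\right) f\left(-q^{\frac{2i-1}{2}},-q^{\frac{k-(2i-1)}{2}}\right)}{q^{\frac{2i-1}{4}}\,\psi\left(q^{\frac{k}{2}}\right) f\left(-q^{\frac{k-(4i-2)}{4}},-q^{\frac{k+(4i-2)}{4}}\right)}$$ and $$\frac{1}{U_n(q)}+U_n(q)=\frac{\phi\left(-q^{\frac{k}{4}}\right) f\left(q^{\frac{2i-1}{2}},q^{\frac{k-(2i-1)}{2}}\right)}{q^{\frac{2i-1}{4}}\,\psi\left(q^{\frac{k}{2}}\right) f\left(-q^{\frac{k-(4i-2)}{4}},-q^{\frac{k+(4i-2)}{4}}\right)}.$$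
   Context: For complex $\lambda$ and $|q|<1$, $(\lambda;q)_\infty=\prod_{n\ge 0}(1-\lambda q^n)$ and $(\lambda_1,\dots,\lambda_r;q)_\infty=\prod_{j=1}^r(\lambda_j;q)_\infty$. Ramanujan's general theta function is $f(a,b)=\sum_{n=-\infty}^{\infty}a^{n(n+1)/2}b^{n(n-1)/2}$ for $|ab|<1$; by Jacobi's triple product identity $f(a,b)=(-a;ab)_\infty(-b;ab)_\infty(ab;ab)_\infty$. Special cases: $\phi(q)=f(q,q)=\sum_{n=-\infty}^\infty q^{n^2}$ and $\psi(q)=f(q,q^3)=\sum_{n=0}^\infty q^{n(n+1)/2}$. A fourth root $q^{1/4}$ of $q$ is fixed once and for all, and every power $q^{r/4}$ with $r\in\mathbb{Z}$ means $(q^{1/4})^r$. The subscript $n$ in $U_n$ is only a label; the function depends on $k$ and $i$. -}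

module Defs where

open import Data.Nat as ℕ using (ℕ; zero; suc; z≤n; s≤s)
import Data.Nat.Properties as ℕₚ
import Data.Nat.DivMod as ℕ/
open import Data.Integer as ℤ using (ℤ; +_; -[1+_])
import Data.Integer.Properties as ℤₚ
import Data.Integer.Solver
open import Data.Rational as ℚ using (ℚ; 0ℚ; 1ℚ; ½)
import Data.Rational.Properties as ℚₚ
import Data.Rational.Solver
import Data.Rational.Unnormalised as ℚᵘ
import Data.Rational.Unnormalised.Properties as ℚᵘₚ
open import Data.Product using (Σ; _×_; _,_; proj₁; proj₂)
open import Data.Sum using (inj₁; inj₂)
open import Data.Empty using (⊥-elim)
open import Relation.Nullary using (yes; no)
open import Relation.Binary.PropositionalEquality
  using (_≡_; _≢_; refl; sym; trans; cong; cong₂; subst)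

module ℤS = Data.Integer.Solver.+-*-Solver
open Data.Rational.Solver.+-*-Solver
  using (solve; _:=_; con) renaming (_:+_ to _⊕_; _:*_ to _⊗_; _:-_ to _⊖_; :-_ to ⊝_)

≤ˡ : ∀ {p p′ q} → p ≡ p′ → p ℚ.≤ q → p′ ℚ.≤ q
≤ˡ refl h = h

≤ʳ : ∀ {p q q′} → q ≡ q′ → p ℚ.≤ q → p ℚ.≤ q′
≤ʳ refl h = h

≤-by : ∀ {p q} d → 0ℚ ℚ.≤ d → q ≡ p ℚ.+ d → p ℚ.≤ q
≤-by {p} d 0≤d refl =
  subst (ℚ._≤ p ℚ.+ d) (ℚₚ.+-identityʳ p) (ℚₚ.+-monoʳ-≤ p 0≤d)

p≤q⇒0≤q-p : ∀ {p q} → p ℚ.≤ q → 0ℚ ℚ.≤ q ℚ.- p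
p≤q⇒0≤q-p {p} {q} h =
  subst (ℚ._≤ q ℚ.- p) (ℚₚ.+-inverseʳ p) (ℚₚ.+-monoˡ-≤ (ℚ.- p) h)

p<q⇒0<q-p : ∀ {p q} → p ℚ.< q → 0ℚ ℚ.< q ℚ.- p
p<q⇒0<q-p {p} {q} h =
  subst (ℚ._< q ℚ.- p) (ℚₚ.+-inverseʳ p) (ℚₚ.+-monoˡ-< (ℚ.- p) h)

<-by : ∀ {p q} d → 0ℚ ℚ.< d → q ≡ p ℚ.+ d → p ℚ.< q
<-by {p} d 0<d refl =
  subst (ℚ._< p ℚ.+ d) (ℚₚ.+-identityʳ p) (ℚₚ.+-monoʳ-< p 0<d)

*-monoʳ : ∀ {p q r} → 0ℚ ℚ.≤ r → p ℚ.≤ q → p ℚ.* r ℚ.≤ q ℚ.* r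
*-monoʳ {r = r} 0≤r h = ℚₚ.*-monoʳ-≤-nonNeg r {{ℚ.nonNegative 0≤r}} h

*-monoˡ : ∀ {p q r} → 0ℚ ℚ.≤ r → p ℚ.≤ q → r ℚ.* p ℚ.≤ r ℚ.* q
*-monoˡ {r = r} 0≤r h = ℚₚ.*-monoˡ-≤-nonNeg r {{ℚ.nonNegative 0≤r}} h

*-mono : ∀ {p p′ q q′} → 0ℚ ℚ.≤ p → p ℚ.≤ p′ → 0ℚ ℚ.≤ q → q ℚ.≤ q′ →
         p ℚ.* q ℚ.≤ p′ ℚ.* q′
*-mono 0≤p p≤ 0≤q q≤ =
  ℚₚ.≤-trans (*-monoʳ 0≤q p≤) (*-monoˡ (ℚₚ.≤-trans 0≤p p≤) q≤)

0≤* : ∀ {p q} → 0ℚ ℚ.≤ p → 0ℚ ℚ.≤ q → 0ℚ ℚ.≤ p ℚ.* q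
0≤* {p} {q} 0≤p 0≤q = subst (ℚ._≤ p ℚ.* q) (ℚₚ.*-zeroˡ q) (*-monoʳ 0≤q 0≤p)

0<* : ∀ {p q} → 0ℚ ℚ.< p → 0ℚ ℚ.< q → 0ℚ ℚ.< p ℚ.* q
0<* {p} {q} 0<p 0<q =
  subst (ℚ._< p ℚ.* q) (ℚₚ.*-zeroˡ q) (ℚₚ.*-monoˡ-<-pos q {{ℚ.positive 0<q}} 0<p)

0≤+ : ∀ {p q} → 0ℚ ℚ.≤ p → 0ℚ ℚ.≤ q → 0ℚ ℚ.≤ p ℚ.+ q
0≤+ 0≤p 0≤q = ℚₚ.+-mono-≤ 0≤p 0≤q

0≤sq : ∀ p → 0ℚ ℚ.≤ p ℚ.* p
0≤sq p with ℚₚ.≤-total 0ℚ p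
... | inj₁ h = 0≤* h h
... | inj₂ h = subst (0ℚ ℚ.≤_) (solve 1 (λ p → (⊝ p) ⊗ (⊝ p) := p ⊗ p) refl p)
                 (0≤* (ℚₚ.neg-antimono-≤ h) (ℚₚ.neg-antimono-≤ h))

sq-cancel : ∀ {p q} → 0ℚ ℚ.≤ q → p ℚ.* p ℚ.≤ q ℚ.* q → p ℚ.≤ q
sq-cancel {p} {q} 0≤q h with p ℚₚ.≤? q
... | yes p≤q = p≤q
... | no p≰q = ⊥-elim (ℚₚ.<-irrefl refl (ℚₚ.<-≤-trans
  (ℚₚ.≤-<-trans (*-monoˡ 0≤q (ℚₚ.<⇒≤ q<p))
                (ℚₚ.*-monoˡ-<-pos p {{ℚ.positive (ℚₚ.≤-<-trans 0≤q q<p)}} q<p)) h))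
  where q<p = ℚₚ.≰⇒> p≰q

neg-sq : ∀ p → (ℚ.- p) ℚ.* (ℚ.- p) ≡ p ℚ.* p
neg-sq = solve 1 (λ p → (⊝ p) ⊗ (⊝ p) := p ⊗ p) refl

∣∣≤ : ∀ {p q} → p ℚ.≤ q → ℚ.- p ℚ.≤ q → ℚ.∣ p ∣ ℚ.≤ q
∣∣≤ {p} h h′ with ℚₚ.∣p∣≡p∨∣p∣≡-p p
... | inj₁ e = ≤ˡ (sym e) h
... | inj₂ e = ≤ˡ (sym e) h′

p≤∣p∣ : ∀ p → p ℚ.≤ ℚ.∣ p ∣
p≤∣p∣ p with ℚₚ.≤-total 0ℚ p
... | inj₁ h = ℚₚ.≤-reflexive (sym (ℚₚ.0≤p⇒∣p∣≡p h))
... | inj₂ h = ℚₚ.≤-trans h (ℚₚ.0≤∣p∣ p)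

sq⇒∣∣≤ : ∀ {p q} → 0ℚ ℚ.≤ q → p ℚ.* p ℚ.≤ q ℚ.* q → ℚ.∣ p ∣ ℚ.≤ q
sq⇒∣∣≤ {p} 0≤q h =
  ∣∣≤ (sq-cancel 0≤q h) (sq-cancel 0≤q (≤ˡ (sym (neg-sq p)) h))

∣∣²≡ : ∀ p → ℚ.∣ p ∣ ℚ.* ℚ.∣ p ∣ ≡ p ℚ.* p
∣∣²≡ p = trans (sym (ℚₚ.∣p*q∣≡∣p∣*∣q∣ p p)) (ℚₚ.0≤p⇒∣p∣≡p (0≤sq p))

∣∣≤⇒sq : ∀ {p q} → ℚ.∣ p ∣ ℚ.≤ q → p ℚ.* p ℚ.≤ q ℚ.* q
∣∣≤⇒sq {p} {q} h = subst (ℚ._≤ q ℚ.* q) (∣∣²≡ p) (*-mono (ℚₚ.0≤∣p∣ p) h (ℚₚ.0≤∣p∣ p) h)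

0<1 : 0ℚ ℚ.< 1ℚ
0<1 = ℚₚ.positive⁻¹ 1ℚ

0≤1 : 0ℚ ℚ.≤ 1ℚ
0≤1 = ℚₚ.<⇒≤ 0<1

0<½ : 0ℚ ℚ.< ½
0<½ = ℚₚ.positive⁻¹ ½

half-pos : ∀ {ε} → 0ℚ ℚ.< ε → 0ℚ ℚ.< ½ ℚ.* ε
half-pos = 0<* 0<½

half+half : ∀ ε → ½ ℚ.* ε ℚ.+ ½ ℚ.* ε ≡ ε
half+half = solve 1 (λ ε → con ½ ⊗ ε ⊕ con ½ ⊗ ε := ε) refl

half< : ∀ {ε} → 0ℚ ℚ.< ε → ½ ℚ.* ε ℚ.< ε
half< {ε} h = <-by (½ ℚ.* ε) (half-pos h) (sym (half+half ε))

recip : ℚ → ℚ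
recip p with p ℚₚ.≟ 0ℚ
... | yes _   = 0ℚ
... | no p≢0 = ℚ.1/_ p {{ℚ.≢-nonZero p≢0}}

*-recip : ∀ p → p ≢ 0ℚ → p ℚ.* recip p ≡ 1ℚ
*-recip p p≢0 with p ℚₚ.≟ 0ℚ
... | yes e   = ⊥-elim (p≢0 e)
... | no p≢0′ = ℚₚ.*-inverseʳ p {{ℚ.≢-nonZero p≢0′}}

0<⇒≢0 : ∀ {p} → 0ℚ ℚ.< p → p ≢ 0ℚ
0<⇒≢0 h refl = ℚₚ.<-irrefl refl h

recip-inv : ∀ {p} → 0ℚ ℚ.< p → p ℚ.* recip p ≡ 1ℚ
recip-inv 0<p = *-recip _ (0<⇒≢0 0<p)

0<recip : ∀ {p} → 0ℚ ℚ.< p → 0ℚ ℚ.< recip p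
0<recip {p} 0<p with recip p ℚₚ.≤? 0ℚ
... | no h  = ℚₚ.≰⇒> h
... | yes h = ⊥-elim (ℚₚ.<-irrefl refl (ℚₚ.<-≤-trans 0<1
  (subst (ℚ._≤ 0ℚ) (recip-inv 0<p)
    (subst (p ℚ.* recip p ℚ.≤_) (ℚₚ.*-zeroʳ p) (*-monoˡ (ℚₚ.<⇒≤ 0<p) h)))))

recip-anti : ∀ {p q} → 0ℚ ℚ.< p → p ℚ.≤ q → recip q ℚ.≤ recip p
recip-anti {p} {q} 0<p p≤q = ℚₚ.≤-trans
  (ℚₚ.≤-reflexive (trans (sym (ℚₚ.*-identityʳ r)) (cong (r ℚ.*_) (sym (recip-inv 0<p)))))
  (ℚₚ.≤-trans
    (*-monoˡ (ℚₚ.<⇒≤ (0<recip 0<q)) (*-monoʳ (ℚₚ.<⇒≤ (0<recip 0<p)) p≤q))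
    (ℚₚ.≤-reflexive (trans
      (solve 3 (λ r q s → r ⊗ (q ⊗ s) := (q ⊗ r) ⊗ s) refl r q (recip p))
      (trans (cong (ℚ._* recip p) (recip-inv 0<q)) (ℚₚ.*-identityˡ _)))))
  where 0<q = ℚₚ.<-≤-trans 0<p p≤q
        r = recip q

shrink : ∀ {K ε} → 0ℚ ℚ.< K → 0ℚ ℚ.< ε → Σ ℚ λ δ → 0ℚ ℚ.< δ × K ℚ.* δ ℚ.< ε
shrink {K} {ε} 0<K 0<ε =
  recip K ℚ.* (½ ℚ.* ε) , 0<* (0<recip 0<K) (half-pos 0<ε) ,
  subst (ℚ._< ε)
    (trans (sym (ℚₚ.*-identityˡ _)) (trans (cong (ℚ._* (½ ℚ.* ε)) (sym (recip-inv 0<K)))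
      (ℚₚ.*-assoc K (recip K) (½ ℚ.* ε))))
    (half< 0<ε)

∣-∣-sym : ∀ p q → ℚ.∣ p ℚ.- q ∣ ≡ ℚ.∣ q ℚ.- p ∣
∣-∣-sym p q = trans (cong ℚ.∣_∣ (solve 2 (λ p q → p ⊖ q := ⊝ (q ⊖ p)) refl p q))
                    (ℚₚ.∣-p∣≡∣p∣ (q ℚ.- p))

∣-∣-tri : ∀ p q r → ℚ.∣ p ℚ.- r ∣ ℚ.≤ ℚ.∣ p ℚ.- q ∣ ℚ.+ ℚ.∣ q ℚ.- r ∣
∣-∣-tri p q r = ≤ˡ (cong ℚ.∣_∣
  (solve 3 (λ p q r → (p ⊖ q) ⊕ (q ⊖ r) := p ⊖ r) refl p q r))
  (ℚₚ.∣p+q∣≤∣p∣+∣q∣ (p ℚ.- q) (q ℚ.- r))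

∣+-+∣ : ∀ a b c d →
        ℚ.∣ (a ℚ.+ b) ℚ.- (c ℚ.+ d) ∣ ℚ.≤ ℚ.∣ a ℚ.- c ∣ ℚ.+ ℚ.∣ b ℚ.- d ∣
∣+-+∣ a b c d = ≤ˡ (cong ℚ.∣_∣
  (solve 4 (λ a b c d → (a ⊖ c) ⊕ (b ⊖ d) := (a ⊕ b) ⊖ (c ⊕ d)) refl a b c d))
  (ℚₚ.∣p+q∣≤∣p∣+∣q∣ (a ℚ.- c) (b ℚ.- d))

∣*-*∣ : ∀ a b c d {A B δ} → ℚ.∣ a ∣ ℚ.≤ A → ℚ.∣ d ∣ ℚ.≤ B →
        ℚ.∣ a ℚ.- c ∣ ℚ.≤ δ → ℚ.∣ b ℚ.- d ∣ ℚ.≤ δ →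
        ℚ.∣ a ℚ.* b ℚ.- c ℚ.* d ∣ ℚ.≤ (A ℚ.+ B) ℚ.* δ
∣*-*∣ a b c d {A} {B} {δ} ha hd hac hbd = ℚₚ.≤-trans
  (≤ˡ (cong ℚ.∣_∣
    (solve 4 (λ a b c d → a ⊗ (b ⊖ d) ⊕ d ⊗ (a ⊖ c) := a ⊗ b ⊖ c ⊗ d) refl a b c d))
    (ℚₚ.∣p+q∣≤∣p∣+∣q∣ (a ℚ.* (b ℚ.- d)) (d ℚ.* (a ℚ.- c))))
  (subst (ℚ._≤ (A ℚ.+ B) ℚ.* δ)
    (cong₂ ℚ._+_ (sym (ℚₚ.∣p*q∣≡∣p∣*∣q∣ a (b ℚ.- d))) (sym (ℚₚ.∣p*q∣≡∣p∣*∣q∣ d (a ℚ.- c))))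
    (≤ʳ (sym (ℚₚ.*-distribʳ-+ δ A B))
      (ℚₚ.+-mono-≤ (*-mono (ℚₚ.0≤∣p∣ a) ha (ℚₚ.0≤∣p∣ _) hbd)
                   (*-mono (ℚₚ.0≤∣p∣ d) hd (ℚₚ.0≤∣p∣ _) hac))))

infixr 8 _^ʳ_
_^ʳ_ : ℚ → ℕ → ℚ
p ^ʳ zero  = 1ℚ
p ^ʳ suc n = p ℚ.* p ^ʳ n

0≤^ : ∀ {p} → 0ℚ ℚ.≤ p → ∀ n → 0ℚ ℚ.≤ p ^ʳ n
0≤^ h zero    = 0≤1
0≤^ h (suc n) = 0≤* h (0≤^ h n)

0<^ : ∀ {p} → 0ℚ ℚ.< p → ∀ n → 0ℚ ℚ.< p ^ʳ n
0<^ h zero    = 0<1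
0<^ h (suc n) = 0<* h (0<^ h n)

^-mono : ∀ {p q} → 0ℚ ℚ.≤ p → p ℚ.≤ q → ∀ n → p ^ʳ n ℚ.≤ q ^ʳ n
^-mono h h′ zero    = ℚₚ.≤-refl
^-mono h h′ (suc n) = *-mono h h′ (0≤^ h n) (^-mono h h′ n)

^≤1 : ∀ {p} → 0ℚ ℚ.≤ p → p ℚ.≤ 1ℚ → ∀ n → p ^ʳ n ℚ.≤ 1ℚ
^≤1 h h′ zero    = ℚₚ.≤-refl
^≤1 h h′ (suc n) = ≤ʳ (ℚₚ.*-identityˡ 1ℚ) (*-mono h h′ (0≤^ h n) (^≤1 h h′ n))

^suc≤ : ∀ {p} → 0ℚ ℚ.≤ p → p ℚ.≤ 1ℚ → ∀ n → p ^ʳ suc n ℚ.≤ p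
^suc≤ {p} h h′ n = ≤ʳ (ℚₚ.*-identityʳ p) (*-monoˡ h (^≤1 h h′ n))

^-+ : ∀ p m n → p ^ʳ (m ℕ.+ n) ≡ p ^ʳ m ℚ.* p ^ʳ n
^-+ p zero    n = sym (ℚₚ.*-identityˡ _)
^-+ p (suc m) n = trans (cong (p ℚ.*_) (^-+ p m n)) (sym (ℚₚ.*-assoc p _ _))

*-^ : ∀ p q n → (p ℚ.* q) ^ʳ n ≡ p ^ʳ n ℚ.* q ^ʳ n
*-^ p q zero    = refl
*-^ p q (suc n) = trans (cong ((p ℚ.* q) ℚ.*_) (*-^ p q n))
  (solve 4 (λ p q r s → (p ⊗ q) ⊗ (r ⊗ s) := (p ⊗ r) ⊗ (q ⊗ s)) refl p q _ _)

^-cancel : ∀ {p q} → p ℚ.* q ≡ 1ℚ → ∀ m n → p ^ʳ (m ℕ.+ n) ℚ.* q ^ʳ n ≡ p ^ʳ m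
^-cancel {p} {q} e m n = trans (cong (ℚ._* q ^ʳ n) (^-+ p m n))
  (trans (ℚₚ.*-assoc (p ^ʳ m) _ _)
  (trans (cong (p ^ʳ m ℚ.*_) (trans (sym (*-^ p q n)) (trans (cong (_^ʳ n) e) (1^ n))))
         (ℚₚ.*-identityʳ _)))
  where
  1^ : ∀ n → 1ℚ ^ʳ n ≡ 1ℚ
  1^ zero    = refl
  1^ (suc n) = trans (ℚₚ.*-identityˡ _) (1^ n)

∀∞ : (ℕ → Set) → Set
∀∞ P = Σ ℕ λ N → ∀ n → N ℕ.≤ n → P n

∀∞-map : {P Q : ℕ → Set} → (∀ n → P n → Q n) → ∀∞ P → ∀∞ Q
∀∞-map f (N , h) = N , λ n le → f n (h n le)

∀∞-zip : {P Q R : ℕ → Set} → (∀ n → P n → Q n → R n) → ∀∞ P → ∀∞ Q → ∀∞ R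
∀∞-zip f (M , h) (N , g) = M ℕ.⊔ N , λ n le →
  f n (h n (ℕₚ.≤-trans (ℕₚ.m≤m⊔n M N) le)) (g n (ℕₚ.≤-trans (ℕₚ.m≤n⊔m M N) le))

⊔ˡ : ∀ {m n o} → m ℕ.⊔ n ℕ.≤ o → m ℕ.≤ o
⊔ˡ = ℕₚ.m⊔n≤o⇒m≤o _ _

⊔ʳ : ∀ {m n o} → m ℕ.⊔ n ℕ.≤ o → n ℕ.≤ o
⊔ʳ = ℕₚ.m⊔n≤o⇒n≤o _ _

∀∞-some : {P : ℕ → Set} → ∀∞ P → Σ ℕ P
∀∞-some (N , h) = N , h N ℕₚ.≤-refl

IsCauchy : (ℕ → ℚ) → Set
IsCauchy x = ∀ ε → 0ℚ ℚ.< ε →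
  Σ ℕ λ N → ∀ m n → N ℕ.≤ m → N ℕ.≤ n → ℚ.∣ x m ℚ.- x n ∣ ℚ.< ε

record ℝ : Set where
  constructor mkℝ
  field
    seq    : ℕ → ℚ
    cauchy : IsCauchy seq
open ℝ public

infix 4 _≈ᴿ_ _<ᴿ_

_≈ᴿ_ : ℝ → ℝ → Set
x ≈ᴿ y = ∀ ε → 0ℚ ℚ.< ε → ∀∞ λ n → ℚ.∣ seq x n ℚ.- seq y n ∣ ℚ.< ε

_<ᴿ_ : ℝ → ℝ → Set
x <ᴿ y = Σ ℚ λ ε → 0ℚ ℚ.< ε × ∀∞ λ n → seq x n ℚ.+ ε ℚ.≤ seq y n

Cauchy-bounded : ∀ x → IsCauchy x → Σ ℚ λ B → 0ℚ ℚ.< B × ∀∞ λ n → ℚ.∣ x n ∣ ℚ.≤ B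
Cauchy-bounded x c with c 1ℚ 0<1
... | N , h = 1ℚ ℚ.+ ℚ.∣ x N ∣ ,
  ℚₚ.<-≤-trans 0<1 (≤-by ℚ.∣ x N ∣ (ℚₚ.0≤∣p∣ (x N)) refl) ,
  N , λ n le → ℚₚ.≤-trans
    (≤ˡ (cong ℚ.∣_∣ (solve 2 (λ p q → (p ⊖ q) ⊕ q := p) refl (x n) (x N)))
        (ℚₚ.∣p+q∣≤∣p∣+∣q∣ (x n ℚ.- x N) (x N)))
    (ℚₚ.+-monoˡ-≤ ℚ.∣ x N ∣ (ℚₚ.<⇒≤ (h n N le ℕₚ.≤-refl)))

∣recip-recip∣ : ∀ {p q ε δ} → 0ℚ ℚ.< ε → ε ℚ.≤ p → ε ℚ.≤ q → ℚ.∣ p ℚ.- q ∣ ℚ.≤ δ →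
                ℚ.∣ recip p ℚ.- recip q ∣ ℚ.≤ (recip ε ℚ.* recip ε) ℚ.* δ
∣recip-recip∣ {p} {q} {ε} {δ} 0<ε ε≤p ε≤q h =
  ≤ˡ (trans (sym (ℚₚ.∣p*q∣≡∣p∣*∣q∣ (r ℚ.* s) (q ℚ.- p))) (cong ℚ.∣_∣ (sym e)))
    (*-mono (ℚₚ.0≤∣p∣ _)
      (≤ˡ (sym (ℚₚ.0≤p⇒∣p∣≡p (0≤* 0≤r 0≤s)))
        (*-mono 0≤r (recip-anti 0<ε ε≤p) 0≤s (recip-anti 0<ε ε≤q)))
      (ℚₚ.0≤∣p∣ _) (≤ˡ (∣-∣-sym p q) h))
  where
  r = recip p
  s = recip q
  0<p = ℚₚ.<-≤-trans 0<ε ε≤p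
  0<q = ℚₚ.<-≤-trans 0<ε ε≤q
  0≤r = ℚₚ.<⇒≤ (0<recip 0<p)
  0≤s = ℚₚ.<⇒≤ (0<recip 0<q)
  e : r ℚ.- s ≡ (r ℚ.* s) ℚ.* (q ℚ.- p)
  e = trans (cong₂ ℚ._-_
        (trans (sym (ℚₚ.*-identityʳ r)) (cong (r ℚ.*_) (sym (recip-inv 0<q))))
        (trans (sym (ℚₚ.*-identityʳ s)) (cong (s ℚ.*_) (sym (recip-inv 0<p)))))
      (solve 4 (λ p q r s → r ⊗ (q ⊗ s) ⊖ s ⊗ (p ⊗ r) := (r ⊗ s) ⊗ (q ⊖ p)) refl p q r s)

-- The moduli of convergence are abstract: only the rationals seq x n compute.
abstract
  const-Cauchy : ∀ p → IsCauchy (λ _ → p)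
  const-Cauchy p ε 0<ε = 0 , λ _ _ _ _ →
    subst (ℚ._< ε) (sym (cong ℚ.∣_∣ (ℚₚ.+-inverseʳ p))) 0<ε

  +-Cauchy : ∀ x y → IsCauchy (λ n → seq x n ℚ.+ seq y n)
  +-Cauchy (mkℝ x cx) (mkℝ y cy) ε 0<ε =
    let M , h = cx (½ ℚ.* ε) (half-pos 0<ε)
        N , g = cy (½ ℚ.* ε) (half-pos 0<ε)
    in M ℕ.⊔ N , λ m n le le′ → ℚₚ.≤-<-trans (∣+-+∣ (x m) (y m) (x n) (y n))
         (subst (_ ℚ.<_) (half+half ε) (ℚₚ.+-mono-<
           (h m n (⊔ˡ {M} {N} le) (⊔ˡ {M} {N} le′))
           (g m n (⊔ʳ {M} {N} le) (⊔ʳ {M} {N} le′))))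

  neg-Cauchy : ∀ x → IsCauchy (λ n → ℚ.- seq x n)
  neg-Cauchy (mkℝ x cx) ε 0<ε =
    let N , h = cx ε 0<ε
    in N , λ m n le le′ → subst (ℚ._< ε)
         (trans (∣-∣-sym (x m) (x n)) (cong ℚ.∣_∣
           (solve 2 (λ p q → q ⊖ p := (⊝ p) ⊖ (⊝ q)) refl (x m) (x n))))
         (h m n le le′)

  *-Cauchy : ∀ x y → IsCauchy (λ n → seq x n ℚ.* seq y n)
  *-Cauchy (mkℝ x cx) (mkℝ y cy) ε 0<ε =
    let A , 0<A , K , hA = Cauchy-bounded x cx
        B , 0<B , L , hB = Cauchy-bounded y cy
        δ , 0<δ , lt = shrink (ℚₚ.+-mono-< 0<A 0<B) 0<ε
        M , h = cx δ 0<δ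
        N , g = cy δ 0<δ
    in (K ℕ.⊔ L) ℕ.⊔ (M ℕ.⊔ N) , λ m n le le′ → ℚₚ.≤-<-trans
         (∣*-*∣ (x m) (y m) (x n) (y n)
           (hA m (⊔ˡ {K} {L} (⊔ˡ le))) (hB n (⊔ʳ {K} {L} (⊔ˡ le′)))
           (ℚₚ.<⇒≤ (h m n (⊔ˡ {M} {N} (⊔ʳ {K ℕ.⊔ L} le)) (⊔ˡ {M} {N} (⊔ʳ {K ℕ.⊔ L} le′))))
           (ℚₚ.<⇒≤ (g m n (⊔ʳ {M} {N} (⊔ʳ {K ℕ.⊔ L} le)) (⊔ʳ {M} {N} (⊔ʳ {K ℕ.⊔ L} le′)))))
         lt

  recip-Cauchy : ∀ x {ε} → 0ℚ ℚ.< ε → (∀∞ λ n → ε ℚ.≤ seq x n) →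
                 IsCauchy (λ n → recip (seq x n))
  recip-Cauchy (mkℝ x cx) 0<ε (K , low) η 0<η =
    let 0<r = 0<recip 0<ε
        δ , 0<δ , lt = shrink (0<* 0<r 0<r) 0<η
        M , h = cx δ 0<δ
    in K ℕ.⊔ M , λ m n le le′ → ℚₚ.≤-<-trans
         (∣recip-recip∣ 0<ε (low m (⊔ˡ {K} {M} le)) (low n (⊔ˡ {K} {M} le′))
           (ℚₚ.<⇒≤ (h m n (⊔ʳ {K} {M} le) (⊔ʳ {K} {M} le′))))
         lt

infixl 6 _+ᴿ_
infixl 7 _*ᴿ_
infix  8 -ᴿ_

fromℚ : ℚ → ℝ
fromℚ p = mkℝ (λ _ → p) (const-Cauchy p)

_+ᴿ_ : ℝ → ℝ → ℝ
x +ᴿ y = mkℝ (λ n → seq x n ℚ.+ seq y n) (+-Cauchy x y)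

-ᴿ_ : ℝ → ℝ
-ᴿ x = mkℝ (λ n → ℚ.- seq x n) (neg-Cauchy x)

_*ᴿ_ : ℝ → ℝ → ℝ
x *ᴿ y = mkℝ (λ n → seq x n ℚ.* seq y n) (*-Cauchy x y)

recipᴿ : (x : ℝ) → fromℚ 0ℚ <ᴿ x → ℝ
recipᴿ x (ε , 0<ε , h) = mkℝ (λ n → recip (seq x n))
  (recip-Cauchy x 0<ε (∀∞-map (λ n → ≤ˡ (ℚₚ.+-identityˡ ε)) h))

record ℂ : Set where
  constructor _+i_
  field
    re im : ℝ
open ℂ public

infix 4 _≈_
infixl 6 _+_ _-_
infixl 7 _*_
infixr 8 _^_
infix  9 -_

record _≈_ (z w : ℂ) : Set where
  constructor mk≈
  field
    re≈ : re z ≈ᴿ re w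
    im≈ : im z ≈ᴿ im w
open _≈_ public

0ℂ 1ℂ : ℂ
0ℂ = fromℚ 0ℚ +i fromℚ 0ℚ
1ℂ = fromℚ 1ℚ +i fromℚ 0ℚ

-_ : ℂ → ℂ
- z = (-ᴿ re z) +i (-ᴿ im z)

_+_ : ℂ → ℂ → ℂ
z + w = (re z +ᴿ re w) +i (im z +ᴿ im w)

_-_ : ℂ → ℂ → ℂ
z - w = z + - w

_*_ : ℂ → ℂ → ℂ
z * w = (re z *ᴿ re w +ᴿ -ᴿ (im z *ᴿ im w)) +i (re z *ᴿ im w +ᴿ im z *ᴿ re w)

_^_ : ℂ → ℕ → ℂ
z ^ zero  = 1ℂ
z ^ suc n = z * z ^ n

∣_∣² : ℂ → ℝ
∣ z ∣² = re z *ᴿ re z +ᴿ im z *ᴿ im z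

-- The modulus is only ever compared with a rational r ≥ 0, so the comparison
-- ∣z∣ < r is made between squares and no square root is needed.
∣_∣<_ : ℂ → ℚ → Set
∣ z ∣< r = ∣ z ∣² <ᴿ fromℚ (r ℚ.* r)

-- Constructive "nonzero": the modulus is bounded away from 0.
_#0 : ℂ → Set
z #0 = fromℚ 0ℚ <ᴿ ∣ z ∣²

inv : (z : ℂ) → z #0 → ℂ
inv z z# = (re z *ᴿ r) +i (-ᴿ (im z *ᴿ r))
  where r = recipᴿ ∣ z ∣² z#

infixl 7 _÷_[_]
_÷_[_] : ℂ → (w : ℂ) → w #0 → ℂ
z ÷ w [ w# ] = z * inv w w#

zpow : (z : ℂ) → z #0 → ℤ → ℂ
zpow z z# (+ n)    = z ^ n
zpow z z# -[1+ n ] = inv z z# ^ suc n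

infix 4 _⟶_
_⟶_ : (ℕ → ℂ) → ℂ → Set
s ⟶ L = ∀ ε → 0ℚ ℚ.< ε → ∀∞ λ n → ∣ s n - L ∣< ε

Cauchy : (ℕ → ℂ) → Set
Cauchy s = ∀ ε → 0ℚ ℚ.< ε →
  Σ ℕ λ N → ∀ m n → N ℕ.≤ m → N ℕ.≤ n → ∣ s m - s n ∣< ε

Cauchyᴿ : (ℕ → ℝ) → Set
Cauchyᴿ s = ∀ ε → 0ℚ ℚ.< ε → Σ ℕ λ N → ∀ m n → N ℕ.≤ m → N ℕ.≤ n →
  ∀∞ λ j → ℚ.∣ seq (s m) j ℚ.- seq (s n) j ∣ ℚ.≤ ε

_⟶ᴿ_ : (ℕ → ℝ) → ℝ → Set
s ⟶ᴿ L = ∀ ε → 0ℚ ℚ.< ε → ∀∞ λ n → ∀∞ λ j → ℚ.∣ seq (s n) j ℚ.- seq L j ∣ ℚ.≤ ε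

nat : ℕ → ℚ
nat zero    = 0ℚ
nat (suc n) = 1ℚ ℚ.+ nat n

toℚᵘ-nat : ∀ n → ℚ.toℚᵘ (nat n) ℚᵘ.≃ ℚᵘ.mkℚᵘ (+ n) 0
toℚᵘ-nat zero    = ℚᵘ.*≡* refl
toℚᵘ-nat (suc n) = ℚᵘₚ.≃-trans (ℚₚ.toℚᵘ-homo-+ 1ℚ (nat n))
  (ℚᵘₚ.≃-trans (ℚᵘₚ.+-congʳ (ℚ.toℚᵘ 1ℚ) (toℚᵘ-nat n))
    (ℚᵘ.*≡* (cong (ℤ._* + 1) (cong (λ t → + 1 ℤ.+ t) (ℤₚ.*-identityʳ (+ n))))))

i≤∣i∣ : ∀ i → i ℤ.≤ + ℤ.∣ i ∣
i≤∣i∣ (+ n)    = ℤₚ.≤-refl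
i≤∣i∣ -[1+ n ] = ℤ.-≤+

archimedean : ∀ p → Σ ℕ λ n → p ℚ.≤ nat n
archimedean p@(ℚ.mkℚ i d _) = ℤ.∣ i ∣ ,
  ℚₚ.toℚᵘ-cancel-≤ (ℚᵘₚ.≤-respʳ-≃ (ℚᵘₚ.≃-sym (toℚᵘ-nat ℤ.∣ i ∣))
    (ℚᵘ.*≤* (ℤₚ.≤-trans (ℤₚ.≤-reflexive (ℤₚ.*-identityʳ i))
      (ℤₚ.≤-trans (i≤∣i∣ i)
        (subst (+ ℤ.∣ i ∣ ℤ.≤_) (ℤₚ.pos-* ℤ.∣ i ∣ (suc d))
          (ℤ.+≤+ (ℕₚ.m≤m*n ℤ.∣ i ∣ (suc d))))))))

0≤nat : ∀ n → 0ℚ ℚ.≤ nat n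
0≤nat zero    = ℚₚ.≤-refl
0≤nat (suc n) = 0≤+ 0≤1 (0≤nat n)

bernoulli : ∀ {δ} → 0ℚ ℚ.≤ δ → δ ℚ.≤ 1ℚ → ∀ n →
            (1ℚ ℚ.- δ) ^ʳ n ℚ.* (1ℚ ℚ.+ nat n ℚ.* δ) ℚ.≤ 1ℚ
bernoulli {δ} h h′ zero = ℚₚ.≤-reflexive
  (solve 1 (λ d → con 1ℚ ⊗ (con 1ℚ ⊕ con 0ℚ ⊗ d) := con 1ℚ) refl δ)
bernoulli {δ} h h′ (suc n) = ℚₚ.≤-trans
  (≤-by (u ℚ.* (δ ℚ.* δ ℚ.* (1ℚ ℚ.+ nat n)))
    (0≤* (0≤^ (p≤q⇒0≤q-p h′) n) (0≤* (0≤sq δ) (0≤+ 0≤1 (0≤nat n))))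
    (solve 3 (λ u n d → u ⊗ (con 1ℚ ⊕ n ⊗ d) :=
       ((con 1ℚ ⊖ d) ⊗ u) ⊗ (con 1ℚ ⊕ (con 1ℚ ⊕ n) ⊗ d) ⊕ u ⊗ (d ⊗ d ⊗ (con 1ℚ ⊕ n)))
      refl u (nat n) δ))
  (bernoulli h h′ n)
  where u = (1ℚ ℚ.- δ) ^ʳ n

^→0 : ∀ {ρ} → 0ℚ ℚ.≤ ρ → ρ ℚ.< 1ℚ → ∀ ε → 0ℚ ℚ.< ε → ∀∞ λ n → ρ ^ʳ n ℚ.< ε
^→0 {ρ} 0≤ρ ρ<1 ε 0<ε = N , λ n le → ℚₚ.≤-<-trans (mono n le) small
  where
  δ = 1ℚ ℚ.- ρ
  0<δ = p<q⇒0<q-p ρ<1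
  δ≤1 : δ ℚ.≤ 1ℚ
  δ≤1 = ≤-by ρ 0≤ρ (solve 1 (λ r → con 1ℚ := (con 1ℚ ⊖ r) ⊕ r) refl ρ)
  1-δ≡ρ : 1ℚ ℚ.- δ ≡ ρ
  1-δ≡ρ = solve 1 (λ r → con 1ℚ ⊖ (con 1ℚ ⊖ r) := r) refl ρ
  N = proj₁ (archimedean (recip (δ ℚ.* ε)))
  u = ρ ^ʳ N
  0≤u = 0≤^ 0≤ρ N
  big : 1ℚ ℚ.≤ nat N ℚ.* δ ℚ.* ε
  big = ≤ˡ (trans (ℚₚ.*-comm _ (δ ℚ.* ε)) (recip-inv (0<* 0<δ 0<ε)))
          (≤ʳ (sym (ℚₚ.*-assoc (nat N) δ ε))
            (*-monoʳ (ℚₚ.<⇒≤ (0<* 0<δ 0<ε)) (proj₂ (archimedean (recip (δ ℚ.* ε))))))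
  bern : u ℚ.* (1ℚ ℚ.+ nat N ℚ.* δ) ℚ.≤ 1ℚ
  bern = subst (λ t → t ^ʳ N ℚ.* (1ℚ ℚ.+ nat N ℚ.* δ) ℚ.≤ 1ℚ) 1-δ≡ρ
           (bernoulli (ℚₚ.<⇒≤ 0<δ) δ≤1 N)
  u+uε≤ε : u ℚ.* ε ℚ.+ u ℚ.≤ ε
  u+uε≤ε = ℚₚ.≤-trans
    (≤ʳ (solve 4 (λ u e n d → u ⊗ e ⊕ u ⊗ (n ⊗ d ⊗ e) := (u ⊗ (con 1ℚ ⊕ n ⊗ d)) ⊗ e)
          refl u ε (nat N) δ)
      (ℚₚ.+-monoʳ-≤ (u ℚ.* ε) (≤ˡ (ℚₚ.*-identityʳ u) (*-monoˡ 0≤u big))))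
    (≤ʳ (ℚₚ.*-identityˡ ε) (*-monoʳ (ℚₚ.<⇒≤ 0<ε) bern))
  small : u ℚ.< ε
  small with u ℚₚ.≤? 0ℚ
  ... | yes h = ℚₚ.≤-<-trans h 0<ε
  ... | no h  = ℚₚ.<-≤-trans
    (<-by (u ℚ.* ε) (0<* (ℚₚ.≰⇒> h) 0<ε) (ℚₚ.+-comm (u ℚ.* ε) u)) u+uε≤ε
  mono : ∀ n → N ℕ.≤ n → ρ ^ʳ n ℚ.≤ u
  mono n le = ≤ˡ (trans (sym (^-+ ρ N (n ℕ.∸ N))) (cong (ρ ^ʳ_) (ℕₚ.m+[n∸m]≡n le)))
    (≤ʳ (ℚₚ.*-identityʳ u) (*-monoˡ 0≤u (^≤1 0≤ρ (ℚₚ.<⇒≤ ρ<1) (n ℕ.∸ N))))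

½<1 : ½ ℚ.< 1ℚ
½<1 = subst (½ ℚ.<_) refl (half< 0<1)

-- Diagonal argument: the n-th rational of the limit approximates s n to within 2⁻ⁿ.
completeᴿ : ∀ s → Cauchyᴿ s → Σ ℝ (s ⟶ᴿ_)
completeᴿ s cs = mkℝ L L-cauchy , lim
  where
  tol : ℕ → ℚ
  tol n = ½ ^ʳ n
  0<tol : ∀ n → 0ℚ ℚ.< tol n
  0<tol = 0<^ 0<½
  p : ℕ → ℕ
  p n = proj₁ (cauchy (s n) (tol n) (0<tol n))
  L : ℕ → ℚ
  L n = seq (s n) (p n)
  near : ∀ n → ∀∞ λ j → ℚ.∣ seq (s n) j ℚ.- L n ∣ ℚ.< tol n
  near n = p n , λ j le → proj₂ (cauchy (s n) (tol n) (0<tol n)) j (p n) le ℕₚ.≤-refl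
  quarter : ∀ {ε} → 0ℚ ℚ.< ε → 0ℚ ℚ.< ½ ℚ.* (½ ℚ.* ε)
  quarter h = half-pos (half-pos h)
  ¾ : ∀ ε → let q = ½ ℚ.* (½ ℚ.* ε) in (q ℚ.+ q) ℚ.+ q ℚ.+ q ≡ ε
  ¾ = solve 1 (λ e → let q = con ½ ⊗ (con ½ ⊗ e) in (q ⊕ q) ⊕ q ⊕ q := e) refl
  ¾< : ∀ {ε} → 0ℚ ℚ.< ε → let q = ½ ℚ.* (½ ℚ.* ε) in (q ℚ.+ q) ℚ.+ q ℚ.< ε
  ¾< {ε} h = <-by (½ ℚ.* (½ ℚ.* ε)) (quarter h) (sym (¾ ε))
  tri₃ : ∀ a b c d {q} → ℚ.∣ a ℚ.- b ∣ ℚ.≤ q → ℚ.∣ b ℚ.- c ∣ ℚ.≤ q → ℚ.∣ c ℚ.- d ∣ ℚ.≤ q →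
         ℚ.∣ a ℚ.- d ∣ ℚ.≤ (q ℚ.+ q) ℚ.+ q
  tri₃ a b c d h₁ h₂ h₃ = ℚₚ.≤-trans (∣-∣-tri a c d)
    (ℚₚ.+-mono-≤ (ℚₚ.≤-trans (∣-∣-tri a b c) (ℚₚ.+-mono-≤ h₁ h₂)) h₃)
  L-cauchy : IsCauchy L
  L-cauchy ε 0<ε =
    let q = ½ ℚ.* (½ ℚ.* ε)
        M , h = cs q (quarter 0<ε)
        N , g = ^→0 (ℚₚ.<⇒≤ 0<½) ½<1 q (quarter 0<ε)
    in M ℕ.⊔ N , λ m n le le′ →
      let j , (a , b) , c = ∀∞-some
            (∀∞-zip (λ _ → _,_) (∀∞-zip (λ _ → _,_) (near m) (near n))
              (h m n (⊔ˡ {M} {N} le) (⊔ˡ {M} {N} le′)))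
      in ℚₚ.≤-<-trans
        (tri₃ (L m) (seq (s m) j) (seq (s n) j) (L n)
          (≤ˡ (∣-∣-sym (seq (s m) j) (L m))
            (ℚₚ.<⇒≤ (ℚₚ.<-trans a (g m (⊔ʳ {M} {N} le)))))
          c
          (ℚₚ.<⇒≤ (ℚₚ.<-trans b (g n (⊔ʳ {M} {N} le′)))))
        (¾< 0<ε)
  lim : s ⟶ᴿ mkℝ L L-cauchy
  lim ε 0<ε =
    let q = ½ ℚ.* (½ ℚ.* ε)
        M , h = cs q (quarter 0<ε)
        N , g = ^→0 (ℚₚ.<⇒≤ 0<½) ½<1 q (quarter 0<ε)
    in M , λ n M≤n →
      let K , e = cauchy (s n) q (quarter 0<ε)
      in (M ℕ.⊔ N) ℕ.⊔ K , λ j le →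
        let l , (a , b) , c = ∀∞-some
              (∀∞-zip (λ _ → _,_)
                (∀∞-zip (λ _ → _,_) (near j) (h n j M≤n (⊔ˡ {M} {N} (⊔ˡ le))))
                (K , λ l K≤l → K≤l))
        in ℚₚ.<⇒≤ (ℚₚ.≤-<-trans
          (tri₃ (seq (s n) j) (seq (s n) l) (seq (s j) l) (L j)
            (ℚₚ.<⇒≤ (e j l (⊔ʳ {M ℕ.⊔ N} le) c))
            b
            (ℚₚ.<⇒≤ (ℚₚ.<-trans a (g j (⊔ʳ {M} {N} (⊔ˡ le))))))
          (¾< 0<ε))

∣∣<⇒re : ∀ z {r} → 0ℚ ℚ.≤ r → ∣ z ∣< r → ∀∞ λ j → ℚ.∣ seq (re z) j ∣ ℚ.≤ r
∣∣<⇒re z 0≤r (e , 0<e , h) = ∀∞-map (λ j le → sq⇒∣∣≤ 0≤r (ℚₚ.≤-trans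
  (≤-by (seq (im z) j ℚ.* seq (im z) j ℚ.+ e) (0≤+ (0≤sq (seq (im z) j)) (ℚₚ.<⇒≤ 0<e))
        (ℚₚ.+-assoc (seq (re z) j ℚ.* seq (re z) j) _ e)) le)) h

∣∣<⇒im : ∀ z {r} → 0ℚ ℚ.≤ r → ∣ z ∣< r → ∀∞ λ j → ℚ.∣ seq (im z) j ∣ ℚ.≤ r
∣∣<⇒im z 0≤r (e , 0<e , h) = ∀∞-map (λ j le → sq⇒∣∣≤ 0≤r (ℚₚ.≤-trans
  (≤-by (seq (re z) j ℚ.* seq (re z) j ℚ.+ e) (0≤+ (0≤sq (seq (re z) j)) (ℚₚ.<⇒≤ 0<e))
        (solve 3 (λ a b e → a ⊕ b ⊕ e := b ⊕ (a ⊕ e)) refl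
          (seq (re z) j ℚ.* seq (re z) j) (seq (im z) j ℚ.* seq (im z) j) e)) le)) h

re,im⇒∣∣< : ∀ z {r} → 0ℚ ℚ.< r →
            (∀∞ λ j → ℚ.∣ seq (re z) j ∣ ℚ.≤ ½ ℚ.* r) →
            (∀∞ λ j → ℚ.∣ seq (im z) j ∣ ℚ.≤ ½ ℚ.* r) → ∣ z ∣< r
re,im⇒∣∣< z {r} 0<r h g = ½ ℚ.* (r ℚ.* r) , half-pos (0<* 0<r 0<r) ,
  ∀∞-zip (λ j a b → ≤ʳ
    (solve 1 (λ r → (con ½ ⊗ r) ⊗ (con ½ ⊗ r) ⊕ (con ½ ⊗ r) ⊗ (con ½ ⊗ r) ⊕ con ½ ⊗ (r ⊗ r)
                    := r ⊗ r) refl r)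
    (ℚₚ.+-monoˡ-≤ (½ ℚ.* (r ℚ.* r)) (ℚₚ.+-mono-≤ (∣∣≤⇒sq a) (∣∣≤⇒sq b)))) h g

complete : ∀ s → Cauchy s → Σ ℂ (s ⟶_)
complete s cs = (a +i b) , λ ε 0<ε →
  ∀∞-zip (λ n → re,im⇒∣∣< (s n - (a +i b)) 0<ε)
    (proj₂ A (½ ℚ.* ε) (half-pos 0<ε)) (proj₂ B (½ ℚ.* ε) (half-pos 0<ε))
  where
  A : Σ ℝ ((λ n → re (s n)) ⟶ᴿ_)
  A = completeᴿ (λ n → re (s n)) λ ε 0<ε → let N , h = cs ε 0<ε in
        N , λ m n le le′ → ∣∣<⇒re (s m - s n) (ℚₚ.<⇒≤ 0<ε) (h m n le le′)
  B : Σ ℝ ((λ n → im (s n)) ⟶ᴿ_)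
  B = completeᴿ (λ n → im (s n)) λ ε 0<ε → let N , h = cs ε 0<ε in
        N , λ m n le le′ → ∣∣<⇒im (s m - s n) (ℚₚ.<⇒≤ 0<ε) (h m n le le′)
  a = proj₁ A
  b = proj₁ B

lim : ∀ s → Cauchy s → ℂ
lim s cs = proj₁ (complete s cs)

lim-converges : ∀ s cs → s ⟶ lim s cs
lim-converges s cs = proj₂ (complete s cs)

normℚ : ℂ → ℕ → ℚ
normℚ z = seq ∣ z ∣²

0≤normℚ : ∀ z j → 0ℚ ℚ.≤ normℚ z j
0≤normℚ z j = 0≤+ (0≤sq (seq (re z) j)) (0≤sq (seq (im z) j))

normℚ-* : ∀ z w j → normℚ (z * w) j ≡ normℚ z j ℚ.* normℚ w j
normℚ-* z w j = solve 4
  (λ a b c d → (a ⊗ c ⊕ ⊝ (b ⊗ d)) ⊗ (a ⊗ c ⊕ ⊝ (b ⊗ d)) ⊕ (a ⊗ d ⊕ b ⊗ c) ⊗ (a ⊗ d ⊕ b ⊗ c)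
     := (a ⊗ a ⊕ b ⊗ b) ⊗ (c ⊗ c ⊕ d ⊗ d))
  refl (seq (re z) j) (seq (im z) j) (seq (re w) j) (seq (im w) j)

normℚ-^ : ∀ z n j → normℚ (z ^ n) j ≡ normℚ z j ^ʳ n
normℚ-^ z zero    j = refl
normℚ-^ z (suc n) j = trans (normℚ-* z (z ^ n) j) (cong (normℚ z j ℚ.*_) (normℚ-^ z n j))

normℚ-neg : ∀ z j → normℚ (- z) j ≡ normℚ z j
normℚ-neg z j = cong₂ ℚ._+_ (neg-sq (seq (re z) j)) (neg-sq (seq (im z) j))

record Bd (z : ℂ) (c : ℚ) : Set where
  constructor bd
  field
    eventually : ∀∞ λ j → normℚ z j ℚ.≤ c ℚ.* c
open Bd public

Bd-resp : ∀ z w {c} → (∀ j → normℚ z j ≡ normℚ w j) → Bd z c → Bd w c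
Bd-resp z w e (bd h) = bd (∀∞-map (λ j le → ≤ˡ (e j) le) h)

Bd-≡ : ∀ z {c d} → c ≡ d → Bd z c → Bd z d
Bd-≡ z refl h = h

Bd-mono : ∀ z {c d} → 0ℚ ℚ.≤ c → c ℚ.≤ d → Bd z c → Bd z d
Bd-mono z 0≤c c≤d (bd h) = bd (∀∞-map (λ j le → ℚₚ.≤-trans le (*-mono 0≤c c≤d 0≤c c≤d)) h)

Bd-* : ∀ z w {c d} → Bd z c → Bd w d → Bd (z * w) (c ℚ.* d)
Bd-* z w {c} {d} (bd p) (bd q) = bd (∀∞-zip (λ j h g → ≤ˡ (sym (normℚ-* z w j))
  (≤ʳ (solve 2 (λ c d → (c ⊗ c) ⊗ (d ⊗ d) := (c ⊗ d) ⊗ (c ⊗ d)) refl c d)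
    (*-mono (0≤normℚ z j) h (0≤normℚ w j) g))) p q)

Bd-1 : Bd 1ℂ 1ℚ
Bd-1 = bd (0 , λ _ _ → ℚₚ.≤-refl)

Bd-^ : ∀ z {c} → Bd z c → ∀ n → Bd (z ^ n) (c ^ʳ n)
Bd-^ z h zero    = Bd-1
Bd-^ z h (suc n) = Bd-* z (z ^ n) h (Bd-^ z h n)

triangle : ∀ a b x y {c d} → 0ℚ ℚ.≤ c → 0ℚ ℚ.≤ d →
           a ℚ.* a ℚ.+ b ℚ.* b ℚ.≤ c ℚ.* c → x ℚ.* x ℚ.+ y ℚ.* y ℚ.≤ d ℚ.* d →
           (a ℚ.+ x) ℚ.* (a ℚ.+ x) ℚ.+ (b ℚ.+ y) ℚ.* (b ℚ.+ y) ℚ.≤ (c ℚ.+ d) ℚ.* (c ℚ.+ d)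
triangle a b x y {c} {d} 0≤c 0≤d h g =
  ≤ˡ (solve 4 (λ a b x y → (a ⊗ a ⊕ b ⊗ b) ⊕ (x ⊗ x ⊕ y ⊗ y) ⊕ ((a ⊗ x ⊕ b ⊗ y) ⊕ (a ⊗ x ⊕ b ⊗ y))
         := (a ⊕ x) ⊗ (a ⊕ x) ⊕ (b ⊕ y) ⊗ (b ⊕ y)) refl a b x y)
    (≤ʳ (solve 2 (λ c d → c ⊗ c ⊕ d ⊗ d ⊕ (c ⊗ d ⊕ c ⊗ d) := (c ⊕ d) ⊗ (c ⊕ d)) refl c d)
      (ℚₚ.+-mono-≤ (ℚₚ.+-mono-≤ h g) (ℚₚ.+-mono-≤ cs cs)))
  where
  cs : a ℚ.* x ℚ.+ b ℚ.* y ℚ.≤ c ℚ.* d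
  cs = sq-cancel (0≤* 0≤c 0≤d) (ℚₚ.≤-trans
    (≤-by ((a ℚ.* y ℚ.- b ℚ.* x) ℚ.* (a ℚ.* y ℚ.- b ℚ.* x)) (0≤sq (a ℚ.* y ℚ.- b ℚ.* x))
      (solve 4 (λ a b x y → (a ⊗ a ⊕ b ⊗ b) ⊗ (x ⊗ x ⊕ y ⊗ y)
         := (a ⊗ x ⊕ b ⊗ y) ⊗ (a ⊗ x ⊕ b ⊗ y) ⊕ (a ⊗ y ⊖ b ⊗ x) ⊗ (a ⊗ y ⊖ b ⊗ x))
       refl a b x y))
    (≤ʳ (solve 2 (λ c d → (c ⊗ c) ⊗ (d ⊗ d) := (c ⊗ d) ⊗ (c ⊗ d)) refl c d)
      (*-mono (0≤+ (0≤sq a) (0≤sq b)) h (0≤+ (0≤sq x) (0≤sq y)) g)))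

Bd-+ : ∀ z w {c d} → 0ℚ ℚ.≤ c → 0ℚ ℚ.≤ d → Bd z c → Bd w d → Bd (z + w) (c ℚ.+ d)
Bd-+ z w 0≤c 0≤d (bd p) (bd q) = bd (∀∞-zip (λ j →
  triangle (seq (re z) j) (seq (im z) j) (seq (re w) j) (seq (im w) j) 0≤c 0≤d) p q)

Bd-neg : ∀ z {c} → Bd z c → Bd (- z) c
Bd-neg z = Bd-resp z (- z) λ j → sym (normℚ-neg z j)

Bd⇒∣∣< : ∀ z {c r} → 0ℚ ℚ.≤ c → c ℚ.< r → Bd z c → ∣ z ∣< r
Bd⇒∣∣< z {c} {r} 0≤c c<r (bd h) = r ℚ.* r ℚ.- c ℚ.* c ,
  p<q⇒0<q-p (ℚₚ.≤-<-trans (*-monoˡ 0≤c (ℚₚ.<⇒≤ c<r))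
    (ℚₚ.*-monoˡ-<-pos r {{ℚ.positive (ℚₚ.≤-<-trans 0≤c c<r)}} c<r)) ,
  ∀∞-map (λ j le → ≤ʳ (solve 2 (λ c r → c ⊕ (r ⊖ c) := r) refl (c ℚ.* c) (r ℚ.* r))
    (ℚₚ.+-monoˡ-≤ (r ℚ.* r ℚ.- c ℚ.* c) le)) h

-- From x + ε ≤ 1 the rational ρ = 1 − ε/2 satisfies x ≤ ρ² and ρ < 1.
∣∣<1⇒Bd : ∀ z → ∣ z ∣< 1ℚ → Σ ℚ λ ρ → 0ℚ ℚ.≤ ρ × ρ ℚ.< 1ℚ × Bd z ρ
∣∣<1⇒Bd z (ε , 0<ε , N , h) = ρ ,
  0≤ρ , <-by (½ ℚ.* ε) (half-pos 0<ε)
    (solve 1 (λ e → con 1ℚ := (con 1ℚ ⊖ con ½ ⊗ e) ⊕ con ½ ⊗ e) refl ε) ,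
  bd (N , λ j le → ≤-by ((1ℚ ℚ.- (normℚ z j ℚ.+ ε)) ℚ.+ (½ ℚ.* ε) ℚ.* (½ ℚ.* ε))
    (0≤+ (p≤q⇒0≤q-p (h j le)) (0≤sq (½ ℚ.* ε)))
    (solve 2 (λ n e → (con 1ℚ ⊖ con ½ ⊗ e) ⊗ (con 1ℚ ⊖ con ½ ⊗ e)
      := n ⊕ ((con 1ℚ ⊖ (n ⊕ e)) ⊕ (con ½ ⊗ e) ⊗ (con ½ ⊗ e))) refl (normℚ z j) ε))
  where
  ρ = 1ℚ ℚ.- ½ ℚ.* ε
  ε≤1 : ε ℚ.≤ 1ℚ
  ε≤1 = ℚₚ.≤-trans (≤-by (normℚ z N) (0≤normℚ z N) (ℚₚ.+-comm (normℚ z N) ε))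
          (h N ℕₚ.≤-refl)
  0≤ρ : 0ℚ ℚ.≤ ρ
  0≤ρ = p≤q⇒0≤q-p (ℚₚ.≤-trans (ℚₚ.<⇒≤ (half< 0<ε)) ε≤1)

sum-of-squares≤ : ∀ {a b A B} → 0ℚ ℚ.≤ A → 0ℚ ℚ.≤ B → ℚ.∣ a ∣ ℚ.≤ A → ℚ.∣ b ∣ ℚ.≤ B →
                  a ℚ.* a ℚ.+ b ℚ.* b ℚ.≤ (A ℚ.+ B) ℚ.* (A ℚ.+ B)
sum-of-squares≤ {A = A} {B} 0≤A 0≤B h g =
  ℚₚ.≤-trans (ℚₚ.+-mono-≤ (∣∣≤⇒sq h) (∣∣≤⇒sq g))
    (≤-by (A ℚ.* B ℚ.+ A ℚ.* B) (0≤+ (0≤* 0≤A 0≤B) (0≤* 0≤A 0≤B))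
      (solve 2 (λ a b → (a ⊕ b) ⊗ (a ⊕ b) := a ⊗ a ⊕ b ⊗ b ⊕ (a ⊗ b ⊕ a ⊗ b)) refl A B))

bounded : ∀ z → Σ ℚ λ B → 0ℚ ℚ.≤ B × Bd z B
bounded z =
  let A , 0<A , hA = Cauchy-bounded (seq (re z)) (cauchy (re z))
      B , 0<B , hB = Cauchy-bounded (seq (im z)) (cauchy (im z))
  in A ℚ.+ B , 0≤+ (ℚₚ.<⇒≤ 0<A) (ℚₚ.<⇒≤ 0<B) ,
     bd (∀∞-zip (λ j → sum-of-squares≤ (ℚₚ.<⇒≤ 0<A) (ℚₚ.<⇒≤ 0<B)) hA hB)

sumsq : ℚ → ℚ → ℚ
sumsq a b = a ℚ.* a ℚ.+ b ℚ.* b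

glue : ∀ a b c → (a ℚ.- b) ℚ.+ (b ℚ.- c) ≡ a ℚ.- c
glue = solve 3 (λ a b c → (a ⊖ b) ⊕ (b ⊖ c) := a ⊖ c) refl

cut : ∀ a b c → (a ℚ.- c) ℚ.- (b ℚ.- c) ≡ a ℚ.- b
cut = solve 3 (λ a b c → (a ⊖ c) ⊖ (b ⊖ c) := a ⊖ b) refl

telescope : ∀ (s : ℕ → ℂ) (v : ℕ → ℚ) N →
  (∀ n → N ℕ.≤ n → v (suc n) ℚ.≤ v n) →
  (∀ n → N ℕ.≤ n → Bd (s (suc n) - s n) (v n ℚ.- v (suc n))) →
  ∀ d → v (d ℕ.+ N) ℚ.≤ v N × Bd (s (d ℕ.+ N) - s N) (v N ℚ.- v (d ℕ.+ N))
telescope s v N dec h zero = ℚₚ.≤-refl , bd (0 , λ j _ → ℚₚ.≤-reflexive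
  (trans (cong₂ sumsq (ℚₚ.+-inverseʳ (seq (re (s N)) j)) (ℚₚ.+-inverseʳ (seq (im (s N)) j)))
         (cong (λ t → t ℚ.* t) (sym (ℚₚ.+-inverseʳ (v N))))))
telescope s v N dec h (suc d) = ℚₚ.≤-trans dec′ (proj₁ IH) ,
  Bd-≡ (s (suc d ℕ.+ N) - s N)
    (trans (ℚₚ.+-comm (v (d ℕ.+ N) ℚ.- v (suc d ℕ.+ N)) _) (glue (v N) (v (d ℕ.+ N)) (v (suc d ℕ.+ N))))
    (Bd-resp ((s (suc d ℕ.+ N) - s (d ℕ.+ N)) + (s (d ℕ.+ N) - s N)) (s (suc d ℕ.+ N) - s N)
      (λ j → cong₂ sumsq
        (glue (seq (re (s (suc d ℕ.+ N))) j) (seq (re (s (d ℕ.+ N))) j) (seq (re (s N)) j))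
        (glue (seq (im (s (suc d ℕ.+ N))) j) (seq (im (s (d ℕ.+ N))) j) (seq (im (s N)) j)))
      (Bd-+ (s (suc d ℕ.+ N) - s (d ℕ.+ N)) (s (d ℕ.+ N) - s N)
        (p≤q⇒0≤q-p dec′) (p≤q⇒0≤q-p (proj₁ IH)) (h (d ℕ.+ N) (ℕₚ.m≤n+m N d)) (proj₂ IH)))
  where IH = telescope s v N dec h d
        dec′ = dec (d ℕ.+ N) (ℕₚ.m≤n+m N d)

telescope-Cauchy : ∀ (s : ℕ → ℂ) (v : ℕ → ℚ) N → (∀ n → 0ℚ ℚ.≤ v n) →
  (∀ n → N ℕ.≤ n → v (suc n) ℚ.≤ v n) →
  (∀ n → N ℕ.≤ n → Bd (s (suc n) - s n) (v n ℚ.- v (suc n))) →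
  ∀ ε → v N ℚ.+ v N ℚ.< ε → ∀ m n → N ℕ.≤ m → N ℕ.≤ n → ∣ s m - s n ∣< ε
telescope-Cauchy s v N 0≤v dec h ε lt m n le le′ =
  Bd⇒∣∣< (s m - s n) (0≤+ (0≤v N) (0≤v N)) lt
    (Bd-resp ((s m - s N) + - (s n - s N)) (s m - s n)
      (λ j → cong₂ sumsq
        (cut (seq (re (s m)) j) (seq (re (s n)) j) (seq (re (s N)) j))
        (cut (seq (im (s m)) j) (seq (im (s n)) j) (seq (im (s N)) j)))
      (Bd-+ (s m - s N) (- (s n - s N)) (0≤v N) (0≤v N) (from-N m le)
        (Bd-neg (s n - s N) (from-N n le′))))
  where
  from-N : ∀ n → N ℕ.≤ n → Bd (s n - s N) (v N)
  from-N n le = subst (λ n → Bd (s n - s N) (v N)) (ℕₚ.m∸n+n≡m le)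
    (Bd-mono (s (n ℕ.∸ N ℕ.+ N) - s N) (p≤q⇒0≤q-p (proj₁ T))
      (≤-by (v (n ℕ.∸ N ℕ.+ N)) (0≤v (n ℕ.∸ N ℕ.+ N))
        (solve 2 (λ p q → p := (p ⊖ q) ⊕ q) refl (v N) (v (n ℕ.∸ N ℕ.+ N))))
      (proj₂ T))
    where T = telescope s v N dec h (n ℕ.∸ N)

geometric-majorant : ∀ {K τ u u′} → 0ℚ ℚ.≤ K → (1ℚ ℚ.- τ) ℚ.* K ≡ 1ℚ → u′ ℚ.≤ τ ℚ.* u →
                     u ℚ.≤ K ℚ.* u ℚ.- K ℚ.* u′
geometric-majorant {K} {τ} {u} {u′} 0≤K e h = ℚₚ.≤-trans
  (ℚₚ.≤-reflexive (trans (sym (ℚₚ.*-identityˡ u)) (trans (cong (ℚ._* u) (sym e))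
    (solve 3 (λ t k u → ((con 1ℚ ⊖ t) ⊗ k) ⊗ u := k ⊗ u ⊖ k ⊗ (t ⊗ u)) refl τ K u))))
  (ℚₚ.+-monoʳ-≤ (K ℚ.* u) (ℚₚ.neg-antimono-≤ (*-monoˡ 0≤K h)))

decay : ∀ (u : ℕ → ℚ) {τ} M → 0ℚ ℚ.≤ τ →
  (∀ n → M ℕ.≤ n → u (suc n) ℚ.≤ τ ℚ.* u n) → ∀ d → u (d ℕ.+ M) ℚ.≤ τ ^ʳ d ℚ.* u M
decay u {τ} M 0≤τ step zero    = ℚₚ.≤-reflexive (sym (ℚₚ.*-identityˡ (u M)))
decay u {τ} M 0≤τ step (suc d) = ℚₚ.≤-trans (step (d ℕ.+ M) (ℕₚ.m≤n+m M d))
  (≤ʳ (sym (ℚₚ.*-assoc τ (τ ^ʳ d) (u M))) (*-monoˡ 0≤τ (decay u M 0≤τ step d)))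

double-bound : ∀ {K u U t δ ε} → 0ℚ ℚ.≤ K → 0ℚ ℚ.≤ U → u ℚ.≤ t ℚ.* U → 0ℚ ℚ.≤ t → t ℚ.≤ δ →
  (1ℚ ℚ.+ (K ℚ.* U ℚ.+ K ℚ.* U)) ℚ.* δ ℚ.< ε → K ℚ.* u ℚ.+ K ℚ.* u ℚ.< ε
double-bound {K} {u} {U} {t} 0≤K 0≤U u≤ 0≤t t≤δ lt = ℚₚ.≤-<-trans (ℚₚ.≤-trans
  (≤ʳ (solve 3 (λ k t u → k ⊗ (t ⊗ u) ⊕ k ⊗ (t ⊗ u) := (k ⊗ u ⊕ k ⊗ u) ⊗ t) refl K t U)
    (ℚₚ.+-mono-≤ (*-monoˡ 0≤K u≤) (*-monoˡ 0≤K u≤)))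
  (*-mono (0≤+ (0≤* 0≤K 0≤U) (0≤* 0≤K 0≤U))
    (≤-by 1ℚ 0≤1 (ℚₚ.+-comm 1ℚ (K ℚ.* U ℚ.+ K ℚ.* U))) 0≤t t≤δ)) lt

ratio-test : ∀ (s : ℕ → ℂ) (u : ℕ → ℚ) τ M →
  (∀ n → 0ℚ ℚ.≤ u n) → 0ℚ ℚ.≤ τ → τ ℚ.< 1ℚ →
  (∀ n → M ℕ.≤ n → u (suc n) ℚ.≤ τ ℚ.* u n) →
  (∀ n → Bd (s (suc n) - s n) (u n)) → Cauchy s
ratio-test s u τ M 0≤u 0≤τ τ<1 step h =
  go (recip (1ℚ ℚ.- τ)) (ℚₚ.<⇒≤ (0<recip (p<q⇒0<q-p τ<1))) (recip-inv (p<q⇒0<q-p τ<1))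
  where
  go : ∀ K → 0ℚ ℚ.≤ K → (1ℚ ℚ.- τ) ℚ.* K ≡ 1ℚ → Cauchy s
  go K 0≤K e ε 0<ε = go′ (shrink 0<C 0<ε)
    where
    v : ℕ → ℚ
    v n = K ℚ.* u n
    0≤v : ∀ n → 0ℚ ℚ.≤ v n
    0≤v n = 0≤* 0≤K (0≤u n)
    C = 1ℚ ℚ.+ (v M ℚ.+ v M)
    0<C : 0ℚ ℚ.< C
    0<C = ℚₚ.<-≤-trans 0<1 (≤-by (v M ℚ.+ v M) (0≤+ (0≤v M) (0≤v M)) refl)
    u≤Δv : ∀ n → M ℕ.≤ n → u n ℚ.≤ v n ℚ.- v (suc n)
    u≤Δv n le = geometric-majorant {τ = τ} 0≤K e (step n le)
    v-dec : ∀ n → M ℕ.≤ n → v (suc n) ℚ.≤ v n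
    v-dec n le = ≤-by (v n ℚ.- v (suc n)) (ℚₚ.≤-trans (0≤u n) (u≤Δv n le))
      (solve 2 (λ p q → p := q ⊕ (p ⊖ q)) refl (v n) (v (suc n)))
    go′ : (Σ ℚ λ δ → 0ℚ ℚ.< δ × C ℚ.* δ ℚ.< ε) →
          Σ ℕ λ N → ∀ m n → N ℕ.≤ m → N ℕ.≤ n → ∣ s m - s n ∣< ε
    go′ (δ , 0<δ , lt) = go″ (^→0 0≤τ τ<1 δ 0<δ)
      where
      go″ : ∀∞ (λ n → τ ^ʳ n ℚ.< δ) → Σ ℕ λ N → ∀ m n → N ℕ.≤ m → N ℕ.≤ n → ∣ s m - s n ∣< ε
      go″ (D , small) = D ℕ.+ M , telescope-Cauchy s v (D ℕ.+ M) 0≤v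
        (λ n le → v-dec n (ℕₚ.≤-trans (ℕₚ.m≤n+m M D) le))
        (λ n le → let M≤n = ℕₚ.≤-trans (ℕₚ.m≤n+m M D) le in
          Bd-mono (s (suc n) - s n) (0≤u n) (u≤Δv n M≤n) (h n))
        ε
        (double-bound 0≤K (0≤u M) (decay u M 0≤τ step D) (0≤^ 0≤τ D)
          (ℚₚ.<⇒≤ (small D ℕₚ.≤-refl)) lt)

partialSum : (ℕ → ℂ) → ℕ → ℂ
partialSum t zero    = 0ℂ
partialSum t (suc n) = partialSum t n + t n

Summable : (ℕ → ℂ) → Set
Summable t = Cauchy (partialSum t)

∑ : (t : ℕ → ℂ) → Summable t → ℂ
∑ t h = lim (partialSum t) h

-- The two halves of the bilateral series must converge separately.
∑ℤ : (t : ℤ → ℂ) → Summable (λ n → t (+ n)) → Summable (λ n → t -[1+ n ]) → ℂ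
∑ℤ t h⁺ h⁻ = ∑ (λ n → t (+ n)) h⁺ + ∑ (λ n → t -[1+ n ]) h⁻

partialProduct : (ℕ → ℂ) → ℕ → ℂ
partialProduct t zero    = 1ℂ
partialProduct t (suc n) = partialProduct t n * t n

Multipliable : (ℕ → ℂ) → Set
Multipliable t = Cauchy (partialProduct t)

∏ : (t : ℕ → ℂ) → Multipliable t → ℂ
∏ t h = lim (partialProduct t) h

summable : ∀ (t : ℕ → ℂ) (u : ℕ → ℚ) τ M →
  (∀ n → 0ℚ ℚ.≤ u n) → 0ℚ ℚ.≤ τ → τ ℚ.< 1ℚ →
  (∀ n → M ℕ.≤ n → u (suc n) ℚ.≤ τ ℚ.* u n) →
  (∀ n → Bd (t n) (u n)) → Summable t
summable t u τ M 0≤u 0≤τ τ<1 step h = ratio-test (partialSum t) u τ M 0≤u 0≤τ τ<1 step λ n →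
  Bd-resp (t n) (partialSum t (suc n) - partialSum t n)
    (λ j → sym (cong₂ sumsq
      (drop (seq (re (partialSum t n)) j) (seq (re (t n)) j))
      (drop (seq (im (partialSum t n)) j) (seq (im (t n)) j))))
    (h n)
  where
  drop : ∀ a b → (a ℚ.+ b) ℚ.- a ≡ b
  drop = solve 2 (λ a b → (a ⊕ b) ⊖ a := b) refl

eventually-small : ∀ {C ρ η} → 0ℚ ℚ.≤ C → 0ℚ ℚ.≤ ρ → ρ ℚ.< 1ℚ → 0ℚ ℚ.< η →
                   ∀∞ λ n → C ℚ.* ρ ^ʳ n ℚ.≤ η
eventually-small {C} {ρ} {η} 0≤C 0≤ρ ρ<1 0<η =
  let 0<1+C = ℚₚ.<-≤-trans 0<1 (≤-by C 0≤C refl)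
      δ , 0<δ , lt = shrink {1ℚ ℚ.+ C} 0<1+C 0<η
  in ∀∞-map (λ n small → ℚₚ.≤-trans
       (*-mono 0≤C (≤-by 1ℚ 0≤1 (ℚₚ.+-comm 1ℚ C)) (0≤^ 0≤ρ n) (ℚₚ.<⇒≤ small))
       (ℚₚ.<⇒≤ lt))
     (^→0 0≤ρ ρ<1 δ 0<δ)

qFactor : ℂ → ℂ → ℕ → ℂ
qFactor l q n = 1ℂ - l * q ^ n

qFactor-step : ∀ {p x Λ r ρ} → 0ℚ ℚ.≤ p → 0ℚ ℚ.≤ Λ → 0ℚ ℚ.≤ r → 0ℚ ℚ.≤ ρ →
  x ≡ Λ ℚ.* r → x ℚ.≤ 1ℚ ℚ.- ρ →
  (p ℚ.* (1ℚ ℚ.+ x)) ℚ.* (Λ ℚ.* (ρ ℚ.* r)) ℚ.≤ (1ℚ ℚ.- (1ℚ ℚ.- ρ) ℚ.* (1ℚ ℚ.- ρ)) ℚ.* (p ℚ.* x)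
qFactor-step {p} {x} {Λ} {r} {ρ} 0≤p 0≤Λ 0≤r 0≤ρ refl h =
  ≤-by ((p ℚ.* x ℚ.* ρ) ℚ.* ((1ℚ ℚ.- ρ) ℚ.- x))
    (0≤* (0≤* (0≤* 0≤p (0≤* 0≤Λ 0≤r)) 0≤ρ) (p≤q⇒0≤q-p h))
    (solve 4 (λ p l r t →
      (con 1ℚ ⊖ (con 1ℚ ⊖ t) ⊗ (con 1ℚ ⊖ t)) ⊗ (p ⊗ (l ⊗ r)) :=
      (p ⊗ (con 1ℚ ⊕ l ⊗ r)) ⊗ (l ⊗ (t ⊗ r)) ⊕ (p ⊗ (l ⊗ r) ⊗ t) ⊗ ((con 1ℚ ⊖ t) ⊖ l ⊗ r))
      refl p Λ r ρ)

qPoch-multipliable : ∀ l q → ∣ q ∣< 1ℚ → Multipliable (qFactor l q)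
qPoch-multipliable l q q<1 = go (bounded l) (∣∣<1⇒Bd q q<1)
  where
  P : ℕ → ℂ
  P = partialProduct (qFactor l q)
  Δ : ∀ n j → normℚ (P n * (l * q ^ n)) j ≡ normℚ (P (suc n) - P n) j
  Δ n j = trans
    (sym (cong₂ ℚ._+_ (neg-sq (a ℚ.* c ℚ.+ ℚ.- (b ℚ.* d))) (neg-sq (a ℚ.* d ℚ.+ b ℚ.* c))))
    (cong₂ sumsq
      (solve 4 (λ a b c d → ⊝ (a ⊗ c ⊕ ⊝ (b ⊗ d)) :=
         (a ⊗ (con 1ℚ ⊕ ⊝ c) ⊕ ⊝ (b ⊗ (con 0ℚ ⊕ ⊝ d))) ⊕ ⊝ a) refl a b c d)
      (solve 4 (λ a b c d → ⊝ (a ⊗ d ⊕ b ⊗ c) :=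
         (a ⊗ (con 0ℚ ⊕ ⊝ d) ⊕ b ⊗ (con 1ℚ ⊕ ⊝ c)) ⊕ ⊝ b) refl a b c d))
    where a = seq (re (P n)) j
          b = seq (im (P n)) j
          c = seq (re (l * q ^ n)) j
          d = seq (im (l * q ^ n)) j
  go : (Σ ℚ λ Λ → 0ℚ ℚ.≤ Λ × Bd l Λ) → (Σ ℚ λ ρ → 0ℚ ℚ.≤ ρ × ρ ℚ.< 1ℚ × Bd q ρ) →
       Multipliable (qFactor l q)
  go (Λ , 0≤Λ , hl) (ρ , 0≤ρ , ρ<1 , hq) = go′ (eventually-small 0≤Λ 0≤ρ ρ<1 0<1-ρ)
    where
    0<1-ρ = p<q⇒0<q-p ρ<1
    x : ℕ → ℚ
    x n = Λ ℚ.* ρ ^ʳ n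
    0≤x : ∀ n → 0ℚ ℚ.≤ x n
    0≤x n = 0≤* 0≤Λ (0≤^ 0≤ρ n)
    p : ℕ → ℚ
    p zero    = 1ℚ
    p (suc n) = p n ℚ.* (1ℚ ℚ.+ x n)
    0≤p : ∀ n → 0ℚ ℚ.≤ p n
    0≤p zero    = 0≤1
    0≤p (suc n) = 0≤* (0≤p n) (0≤+ 0≤1 (0≤x n))
    Bd-x : ∀ n → Bd (l * q ^ n) (x n)
    Bd-x n = Bd-* l (q ^ n) hl (Bd-^ q hq n)
    Bd-P : ∀ n → Bd (P n) (p n)
    Bd-P zero    = Bd-1
    Bd-P (suc n) = Bd-* (P n) (qFactor l q n) (Bd-P n)
      (Bd-+ 1ℂ (- (l * q ^ n)) 0≤1 (0≤x n) Bd-1 (Bd-neg (l * q ^ n) (Bd-x n)))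
    τ = 1ℚ ℚ.- (1ℚ ℚ.- ρ) ℚ.* (1ℚ ℚ.- ρ)
    0≤τ : 0ℚ ℚ.≤ τ
    0≤τ = ≤ʳ (solve 1 (λ r → r ⊗ ((con 1ℚ ⊖ r) ⊕ con 1ℚ)
                := con 1ℚ ⊖ (con 1ℚ ⊖ r) ⊗ (con 1ℚ ⊖ r)) refl ρ)
            (0≤* 0≤ρ (0≤+ (ℚₚ.<⇒≤ 0<1-ρ) 0≤1))
    τ<1 : τ ℚ.< 1ℚ
    τ<1 = <-by ((1ℚ ℚ.- ρ) ℚ.* (1ℚ ℚ.- ρ)) (0<* 0<1-ρ 0<1-ρ)
      (solve 1 (λ s → con 1ℚ := (con 1ℚ ⊖ s) ⊕ s) refl ((1ℚ ℚ.- ρ) ℚ.* (1ℚ ℚ.- ρ)))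
    go′ : ∀∞ (λ n → x n ℚ.≤ 1ℚ ℚ.- ρ) → Multipliable (qFactor l q)
    go′ (M , small) = ratio-test P (λ n → p n ℚ.* x n) τ M
      (λ n → 0≤* (0≤p n) (0≤x n)) 0≤τ τ<1
      (λ n le → qFactor-step (0≤p n) 0≤Λ (0≤^ 0≤ρ n) 0≤ρ refl (small n le))
      (λ n → Bd-resp (P n * (l * q ^ n)) (P (suc n) - P n) (Δ n)
        (Bd-* (P n) (l * q ^ n) (Bd-P n) (Bd-x n)))

qPoch : (l q : ℂ) → ∣ q ∣< 1ℚ → ℂ
qPoch l q q<1 = ∏ (qFactor l q) (qPoch-multipliable l q q<1)

qPoch₂ : (l₁ l₂ q : ℂ) → ∣ q ∣< 1ℚ → ℂ
qPoch₂ l₁ l₂ q q<1 = qPoch l₁ q q<1 * qPoch l₂ q q<1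

-- n(n+1) and n(n−1) are nonnegative and even for every integer n, so the absolute
-- value and the natural-number division are exact.
tri⁺ tri⁻ : ℤ → ℕ
tri⁺ n = ℤ.∣ n ℤ.* (n ℤ.+ + 1) ∣ ℕ./ 2
tri⁻ n = ℤ.∣ n ℤ.* (n ℤ.- + 1) ∣ ℕ./ 2

θ-term : ℂ → ℂ → ℤ → ℂ
θ-term a b n = a ^ tri⁺ n * b ^ tri⁻ n

T : ℕ → ℕ
T zero    = 0
T (suc n) = n ℕ.+ T n

T-double : ∀ n → T (suc n) ℕ.* 2 ≡ n ℕ.* suc n
T-double zero    = refl
T-double (suc n) = trans (ℕₚ.*-distribʳ-+ 2 (suc n) (T (suc n)))
  (trans (cong (suc n ℕ.* 2 ℕ.+_) (trans (T-double n) (ℕₚ.*-comm n (suc n))))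
  (trans (sym (ℕₚ.*-distribˡ-+ (suc n) 2 n)) refl))

half-T : ∀ n → n ℕ.* suc n ℕ./ 2 ≡ T (suc n)
half-T n = trans (cong (ℕ._/ 2) (sym (T-double n))) (ℕ/.m*n/n≡m (T (suc n)) 2)

tri⁺-pos : ∀ n → tri⁺ (+ n) ≡ T (suc n)
tri⁺-pos n = trans (cong (ℕ._/ 2) (trans (ℤₚ.abs-* (+ n) (+ n ℤ.+ + 1))
  (cong (n ℕ.*_) (ℕₚ.+-comm n 1)))) (half-T n)

tri⁻-pos : ∀ n → tri⁻ (+ n) ≡ T n
tri⁻-pos zero    = refl
tri⁻-pos (suc n) = trans (cong (ℕ._/ 2) (trans (ℤₚ.abs-* (+ suc n) (+ suc n ℤ.- + 1))
  (ℕₚ.*-comm (suc n) n))) (half-T n)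

tri⁺-neg : ∀ n → tri⁺ -[1+ n ] ≡ T (suc n)
tri⁺-neg n = trans (cong (ℕ._/ 2) (trans (ℤₚ.abs-* -[1+ n ] (-[1+ n ] ℤ.+ + 1))
  (trans (cong (suc n ℕ.*_) (lem n)) (ℕₚ.*-comm (suc n) n)))) (half-T n)
  where
  lem : ∀ n → ℤ.∣ -[1+ n ] ℤ.+ + 1 ∣ ≡ n
  lem zero    = refl
  lem (suc n) = refl

tri⁻-neg : ∀ n → tri⁻ -[1+ n ] ≡ T (suc (suc n))
tri⁻-neg n = trans (cong (ℕ._/ 2) (trans (ℤₚ.abs-* -[1+ n ] (-[1+ n ] ℤ.- + 1))
  (cong (λ t → suc n ℕ.* suc (suc t)) (ℕₚ.+-identityʳ n)))) (half-T (suc n))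

θ-half : ℂ → ℂ → ℕ → ℂ
θ-half a b n = a ^ T (suc n) * b ^ T n

θ-half-norm : ∀ a b n j → normℚ (a ^ n * (a * b) ^ T n) j ≡ normℚ (θ-half a b n) j
θ-half-norm a b n j = trans
  (trans (normℚ-* (a ^ n) ((a * b) ^ T n) j) (cong₂ ℚ._*_ (normℚ-^ a n j)
    (trans (normℚ-^ (a * b) (T n) j) (trans (cong (_^ʳ T n) (normℚ-* a b j))
      (*-^ (normℚ a j) (normℚ b j) (T n))))))
  (trans (sym (ℚₚ.*-assoc (normℚ a j ^ʳ n) (normℚ a j ^ʳ T n) (normℚ b j ^ʳ T n)))
  (sym (trans (normℚ-* (a ^ T (suc n)) (b ^ T n) j) (cong₂ ℚ._*_
    (trans (normℚ-^ a (T (suc n)) j) (^-+ (normℚ a j) n (T n)))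
    (normℚ-^ b (T n) j)))))

record θ-Majorant (a b : ℂ) : Set where
  field
    u     : ℕ → ℚ
    M     : ℕ
    0≤u   : ∀ n → 0ℚ ℚ.≤ u n
    step  : ∀ n → M ℕ.≤ n → u (suc n) ℚ.≤ ½ ℚ.* u n
    bound : ∀ n → Bd (θ-half a b n) (u n)

θ-majorant : ∀ a b → ∣ a * b ∣< 1ℚ → θ-Majorant a b
θ-majorant a b ab<1 = go (bounded a) (∣∣<1⇒Bd (a * b) ab<1)
  where
  go : (Σ ℚ λ A → 0ℚ ℚ.≤ A × Bd a A) → (Σ ℚ λ ρ → 0ℚ ℚ.≤ ρ × ρ ℚ.< 1ℚ × Bd (a * b) ρ) →
       θ-Majorant a b
  go (A , 0≤A , hA) (ρ , 0≤ρ , ρ<1 , hρ) = record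
    { u     = u
    ; M     = proj₁ small
    ; 0≤u   = 0≤u
    ; step  = λ n le → ≤ˡ
        (trans
          (solve 4 (λ A r B s → (A ⊗ r) ⊗ (B ⊗ s) := (A ⊗ B) ⊗ (r ⊗ s)) refl
            A (ρ ^ʳ n) (A ^ʳ n) (ρ ^ʳ T n))
          (cong ((A ℚ.* A ^ʳ n) ℚ.*_) (sym (^-+ ρ n (T n)))))
        (*-monoʳ (0≤u n) (proj₂ small n le))
    ; bound = λ n → Bd-resp (a ^ n * (a * b) ^ T n) (θ-half a b n) (θ-half-norm a b n)
        (Bd-* (a ^ n) ((a * b) ^ T n) (Bd-^ a hA n) (Bd-^ (a * b) hρ (T n)))
    }
    where
    small : ∀∞ λ n → A ℚ.* ρ ^ʳ n ℚ.≤ ½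
    small = eventually-small 0≤A 0≤ρ ρ<1 0<½
    u : ℕ → ℚ
    u n = A ^ʳ n ℚ.* ρ ^ʳ T n
    0≤u : ∀ n → 0ℚ ℚ.≤ u n
    0≤u n = 0≤* (0≤^ 0≤A n) (0≤^ 0≤ρ (T n))

θ-summable⁺ : ∀ a b → ∣ a * b ∣< 1ℚ → Summable (λ n → θ-term a b (+ n))
θ-summable⁺ a b ab<1 =
  summable (λ n → θ-term a b (+ n)) u ½ M 0≤u (ℚₚ.<⇒≤ 0<½) ½<1 step λ n →
    Bd-resp (θ-half a b n) (θ-term a b (+ n))
      (λ j → cong (λ z → normℚ z j)
        (sym (cong₂ (λ x y → a ^ x * b ^ y) (tri⁺-pos n) (tri⁻-pos n))))
      (bound n)
  where open θ-Majorant (θ-majorant a b ab<1)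

θ-summable⁻ : ∀ a b → ∣ a * b ∣< 1ℚ → Summable (λ n → θ-term a b -[1+ n ])
θ-summable⁻ a b ab<1 =
  summable (λ n → θ-term a b -[1+ n ]) (λ n → u (suc n)) ½ M
    (λ n → 0≤u (suc n)) (ℚₚ.<⇒≤ 0<½) ½<1
    (λ n le → step (suc n) (ℕₚ.m≤n⇒m≤1+n le)) λ n →
    Bd-resp (θ-half b a (suc n)) (θ-term a b -[1+ n ])
      (λ j → trans (*-swap (b ^ T (suc (suc n))) (a ^ T (suc n)) j) (cong (λ z → normℚ z j)
        (sym (cong₂ (λ x y → a ^ x * b ^ y) (tri⁺-neg n) (tri⁻-neg n)))))
      (bound (suc n))
  where
  *-swap : ∀ z w j → normℚ (z * w) j ≡ normℚ (w * z) j
  *-swap z w j = trans (normℚ-* z w j)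
    (trans (ℚₚ.*-comm (normℚ z j) (normℚ w j)) (sym (normℚ-* w z j)))
  ba<1 : ∣ b * a ∣< 1ℚ
  ba<1 = proj₁ ab<1 , proj₁ (proj₂ ab<1) ,
    ∀∞-map (λ j → ≤ˡ (cong (ℚ._+ proj₁ ab<1) (*-swap a b j))) (proj₂ (proj₂ ab<1))
  open θ-Majorant (θ-majorant b a ba<1)

f : (a b : ℂ) → ∣ a * b ∣< 1ℚ → ℂ
f a b ab<1 = ∑ℤ (θ-term a b) (θ-summable⁺ a b ab<1) (θ-summable⁻ a b ab<1)

∣∣<1-power : ∀ {N ε} n → 0ℚ ℚ.≤ N → 0ℚ ℚ.< ε → N ℚ.+ ε ℚ.≤ 1ℚ → N ^ʳ suc n ℚ.+ ε ℚ.≤ 1ℚ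
∣∣<1-power {N} {ε} n 0≤N 0<ε h = ℚₚ.≤-trans
  (ℚₚ.+-monoˡ-≤ ε (^suc≤ 0≤N (ℚₚ.≤-trans (≤-by ε (ℚₚ.<⇒≤ 0<ε) refl) h) n)) h

^-∣∣<1 : ∀ z n → ∣ z ∣< 1ℚ → ∣ z ^ suc n ∣< 1ℚ
^-∣∣<1 z n (ε , 0<ε , h) = ε , 0<ε , ∀∞-map (λ j le →
  ≤ˡ (cong (ℚ._+ ε) (sym (normℚ-^ z (suc n) j))) (∣∣<1-power n (0≤normℚ z j) 0<ε le)) h

^-∣∣<1′ : ∀ z {k} → 0 ℕ.< k → ∣ z ∣< 1ℚ → ∣ z ^ k ∣< 1ℚ
^-∣∣<1′ z {suc n} _ = ^-∣∣<1 z n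

∣∣<1-resp : ∀ z w → (∀ j → normℚ z j ≡ normℚ w j) → ∣ z ∣< 1ℚ → ∣ w ∣< 1ℚ
∣∣<1-resp z w e (ε , 0<ε , h) = ε , 0<ε , ∀∞-map (λ j → ≤ˡ (cong (ℚ._+ ε) (e j))) h

neg-∣∣<1 : ∀ z → ∣ z ∣< 1ℚ → ∣ - z ∣< 1ℚ
neg-∣∣<1 z = ∣∣<1-resp z (- z) λ j → sym (normℚ-neg z j)

neg*neg-∣∣<1 : ∀ a b → ∣ a * b ∣< 1ℚ → ∣ (- a) * (- b) ∣< 1ℚ
neg*neg-∣∣<1 a b = ∣∣<1-resp (a * b) ((- a) * (- b)) λ j →
  trans (normℚ-* a b j) (trans (sym (cong₂ ℚ._*_ (normℚ-neg a j) (normℚ-neg b j)))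
    (sym (normℚ-* (- a) (- b) j)))

φ : (q : ℂ) → ∣ q ∣< 1ℚ → ℂ
φ q q<1 = f q q (∣∣<1-resp (q ^ 2) (q * q)
  (λ j → trans (normℚ-^ q 2 j) (trans (cong (normℚ q j ℚ.*_) (ℚₚ.*-identityʳ (normℚ q j)))
    (sym (normℚ-* q q j))))
  (^-∣∣<1 q 1 q<1))

ψ : (q : ℂ) → ∣ q ∣< 1ℚ → ℂ
ψ q q<1 = f q (q ^ 3) (^-∣∣<1 q 3 q<1)

low : ∀ {x} → fromℚ 0ℚ <ᴿ x → Σ ℚ λ ε → 0ℚ ℚ.< ε × ∀∞ λ j → ε ℚ.≤ seq x j
low (ε , 0<ε , h) = ε , 0<ε , ∀∞-map (λ j → ≤ˡ (ℚₚ.+-identityˡ ε)) h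

mk#0 : ∀ z {ε} → 0ℚ ℚ.< ε → (∀∞ λ j → ε ℚ.≤ normℚ z j) → z #0
mk#0 z {ε} 0<ε h = ε , 0<ε , ∀∞-map (λ j → ≤ˡ (sym (ℚₚ.+-identityˡ ε))) h

*-#0 : ∀ z w → z #0 → w #0 → (z * w) #0
*-#0 z w z# w# =
  let ε , 0<ε , h = low {∣ z ∣²} z#
      η , 0<η , g = low {∣ w ∣²} w#
  in mk#0 (z * w) (0<* 0<ε 0<η) (∀∞-zip (λ j a b →
       ≤ʳ (sym (normℚ-* z w j)) (*-mono (ℚₚ.<⇒≤ 0<ε) a (ℚₚ.<⇒≤ 0<η) b)) h g)

^-#0 : ∀ z n → z #0 → (z ^ n) #0
^-#0 z zero    z# = mk#0 1ℂ 0<1 (0 , λ _ _ → ℚₚ.≤-refl)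
^-#0 z (suc n) z# = *-#0 z (z ^ n) z# (^-#0 z n z#)

normℚ-inv : ∀ z (z# : z #0) → ∀∞ λ j → normℚ (inv z z#) j ≡ recip (normℚ z j)
normℚ-inv z z# = ∀∞-map (λ j le → lem (seq (re z) j) (seq (im z) j) (recip (normℚ z j))
    (recip-inv (ℚₚ.<-≤-trans (proj₁ (proj₂ (low {∣ z ∣²} z#))) le)))
  (proj₂ (proj₂ (low {∣ z ∣²} z#)))
  where
  lem : ∀ a b r → (a ℚ.* a ℚ.+ b ℚ.* b) ℚ.* r ≡ 1ℚ →
        (a ℚ.* r) ℚ.* (a ℚ.* r) ℚ.+ (ℚ.- (b ℚ.* r)) ℚ.* (ℚ.- (b ℚ.* r)) ≡ r
  lem a b r e = trans
    (solve 3 (λ a b r → (a ⊗ r) ⊗ (a ⊗ r) ⊕ (⊝ (b ⊗ r)) ⊗ (⊝ (b ⊗ r))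
                := ((a ⊗ a ⊕ b ⊗ b) ⊗ r) ⊗ r) refl a b r)
    (trans (cong (ℚ._* r) e) (ℚₚ.*-identityˡ r))

inv-#0 : ∀ z (z# : z #0) → inv z z# #0
inv-#0 z z# =
  let B , 0≤B , bd h = bounded z
      ε , 0<ε , g = low {∣ z ∣²} z#
      C = 1ℚ ℚ.+ B ℚ.* B
      0<C = ℚₚ.<-≤-trans 0<1 (≤-by (B ℚ.* B) (0≤sq B) refl)
  in mk#0 (inv z z#) {recip C} (0<recip 0<C) (∀∞-zip (λ j e p → ≤ʳ (sym e) p)
       (normℚ-inv z z#)
       (∀∞-zip (λ j a b → recip-anti (ℚₚ.<-≤-trans 0<ε b)
         (ℚₚ.≤-trans a (≤-by 1ℚ 0≤1 (ℚₚ.+-comm 1ℚ (B ℚ.* B))))) h g))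

÷-#0 : ∀ z w (w# : w #0) → z #0 → (z ÷ w [ w# ]) #0
÷-#0 z w w# z# = *-#0 z (inv w w#) z# (inv-#0 w w#)

zpow-#0 : ∀ z (z# : z #0) r → zpow z z# r #0
zpow-#0 z z# (+ n)    = ^-#0 z n z#
zpow-#0 z z# -[1+ n ] = ^-#0 (inv z z#) (suc n) (inv-#0 z z#)

zpowℚ : ℚ → ℤ → ℚ
zpowℚ c (+ n)    = c ^ʳ n
zpowℚ c -[1+ n ] = recip c ^ʳ suc n

normℚ-zpow : ∀ z (z# : z #0) r → ∀∞ λ j → normℚ (zpow z z# r) j ≡ zpowℚ (normℚ z j) r
normℚ-zpow z z# (+ n)    = 0 , λ j _ → normℚ-^ z n j
normℚ-zpow z z# -[1+ n ] = ∀∞-map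
  (λ j e → trans (normℚ-^ (inv z z#) (suc n) j) (cong (_^ʳ suc n) e)) (normℚ-inv z z#)

⊖-solve : ∀ a b n → + a ℤ.+ -[1+ b ] ≡ + n → a ≡ n ℕ.+ suc b
⊖-solve a b n e = ℤₚ.+-injective (trans (sym (trans (ℤₚ.+-assoc (+ a) -[1+ b ] (+ suc b))
  (trans (cong (λ t → + a ℤ.+ t) (ℤₚ.+-inverseˡ (+ suc b))) (ℤₚ.+-identityʳ (+ a)))))
  (cong (ℤ._+ + suc b) e))

zpowℚ-+ : ∀ {c} r t n → 0ℚ ℚ.< c → r ℤ.+ t ≡ + n → zpowℚ c r ℚ.* zpowℚ c t ≡ c ^ʳ n
zpowℚ-+ {c} (+ a) (+ b) n 0<c refl = sym (^-+ c a b)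
zpowℚ-+ {c} (+ a) -[1+ b ] n 0<c e with ⊖-solve a b n e
... | refl = ^-cancel {c} {recip c} (recip-inv 0<c) n (suc b)
zpowℚ-+ {c} -[1+ b ] (+ a) n 0<c e with ⊖-solve a b n (trans (ℤₚ.+-comm (+ a) -[1+ b ]) e)
... | refl = trans (ℚₚ.*-comm (recip c ^ʳ suc b) (c ^ʳ a))
                   (^-cancel {c} {recip c} (recip-inv 0<c) n (suc b))

zpow-∣∣<1 : ∀ z (z# : z #0) → ∣ z ∣< 1ℚ → ∀ r → ℤ.0ℤ ℤ.< r → ∣ zpow z z# r ∣< 1ℚ
zpow-∣∣<1 z z# z<1 (+ suc n) _ = ^-∣∣<1 z n z<1
zpow-∣∣<1 z z# z<1 (+ zero) (ℤ.+<+ ())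

zpow*zpow-∣∣<1 : ∀ z (z# : z #0) → ∣ z ∣< 1ℚ → ∀ r t → ℤ.0ℤ ℤ.< r ℤ.+ t →
                 ∣ zpow z z# r * zpow z z# t ∣< 1ℚ
zpow*zpow-∣∣<1 z z# (ε , 0<ε , h) r t pos = go (r ℤ.+ t) refl pos
  where
  go : ∀ s → r ℤ.+ t ≡ s → ℤ.0ℤ ℤ.< s → ∣ zpow z z# r * zpow z z# t ∣< 1ℚ
  go (+ zero) e (ℤ.+<+ ())
  go (+ suc n) e _ = ε , 0<ε ,
    ∀∞-zip (λ j le e′ → ≤ˡ (cong (ℚ._+ ε) (sym e′)) (∣∣<1-power n (0≤normℚ z j) 0<ε le)) h
      (∀∞-zip (λ j 0<c (er , et) → trans (normℚ-* (zpow z z# r) (zpow z z# t) j)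
          (trans (cong₂ ℚ._*_ er et) (zpowℚ-+ r t (suc n) 0<c e)))
        (∀∞-map (λ j → ℚₚ.<-≤-trans (proj₁ (proj₂ (low {∣ z ∣²} z#))))
          (proj₂ (proj₂ (low {∣ z ∣²} z#))))
        (∀∞-zip (λ j → _,_) (normℚ-zpow z z# r) (normℚ-zpow z z# t)))

+ᴿ-cong : ∀ x x′ y y′ → x ≈ᴿ x′ → y ≈ᴿ y′ → x +ᴿ y ≈ᴿ x′ +ᴿ y′
+ᴿ-cong x x′ y y′ h g ε 0<ε = ∀∞-zip (λ j a b →
    ℚₚ.≤-<-trans (∣+-+∣ (seq x j) (seq y j) (seq x′ j) (seq y′ j))
      (subst (_ ℚ.<_) (half+half ε) (ℚₚ.+-mono-< a b)))
  (h (½ ℚ.* ε) (half-pos 0<ε)) (g (½ ℚ.* ε) (half-pos 0<ε))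

*ᴿ-cong : ∀ x x′ y y′ → x ≈ᴿ x′ → y ≈ᴿ y′ → x *ᴿ y ≈ᴿ x′ *ᴿ y′
*ᴿ-cong x x′ y y′ h g ε 0<ε =
  let A , 0<A , hA = Cauchy-bounded (seq x) (cauchy x)
      B , 0<B , hB = Cauchy-bounded (seq y′) (cauchy y′)
      δ , 0<δ , lt = shrink (ℚₚ.+-mono-< 0<A 0<B) 0<ε
  in ∀∞-zip (λ j (a , b) (c , d) → ℚₚ.≤-<-trans
       (∣*-*∣ (seq x j) (seq y j) (seq x′ j) (seq y′ j) a b (ℚₚ.<⇒≤ c) (ℚₚ.<⇒≤ d)) lt)
     (∀∞-zip (λ _ → _,_) hA hB) (∀∞-zip (λ _ → _,_) (h δ 0<δ) (g δ 0<δ))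

∣∣²-cong : ∀ z w → z ≈ w → ∣ z ∣² ≈ᴿ ∣ w ∣²
∣∣²-cong z w (mk≈ h g) = +ᴿ-cong (re z *ᴿ re z) (re w *ᴿ re w) (im z *ᴿ im z) (im w *ᴿ im w)
  (*ᴿ-cong (re z) (re w) (re z) (re w) h h) (*ᴿ-cong (im z) (im w) (im z) (im w) g g)

<ᴿ-close : ∀ a x y ε → a ℚ.+ ε ℚ.≤ x → ℚ.∣ y ℚ.- x ∣ ℚ.≤ ½ ℚ.* ε → a ℚ.+ ½ ℚ.* ε ℚ.≤ y
<ᴿ-close a x y ε h g = ≤-by ((x ℚ.- (a ℚ.+ ε)) ℚ.+ (½ ℚ.* ε ℚ.- (x ℚ.- y)))
  (0≤+ (p≤q⇒0≤q-p h) (p≤q⇒0≤q-p (ℚₚ.≤-trans (p≤∣p∣ (x ℚ.- y)) (≤ˡ (∣-∣-sym y x) g))))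
  (solve 4 (λ a x y e → y := (a ⊕ con ½ ⊗ e) ⊕ ((x ⊖ (a ⊕ e)) ⊕ (con ½ ⊗ e ⊖ (x ⊖ y))))
    refl a x y ε)

<ᴿ-close′ : ∀ a x y ε → x ℚ.+ ε ℚ.≤ a → ℚ.∣ y ℚ.- x ∣ ℚ.≤ ½ ℚ.* ε → y ℚ.+ ½ ℚ.* ε ℚ.≤ a
<ᴿ-close′ a x y ε h g = ≤-by ((a ℚ.- (x ℚ.+ ε)) ℚ.+ (½ ℚ.* ε ℚ.- (y ℚ.- x)))
  (0≤+ (p≤q⇒0≤q-p h) (p≤q⇒0≤q-p (ℚₚ.≤-trans (p≤∣p∣ (y ℚ.- x)) g)))
  (solve 4 (λ a x y e → a := (y ⊕ con ½ ⊗ e) ⊕ ((a ⊖ (x ⊕ e)) ⊕ (con ½ ⊗ e ⊖ (y ⊖ x))))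
    refl a x y ε)

#0-resp : ∀ z w → w ≈ z → z #0 → w #0
#0-resp z w e (ε , 0<ε , h) = ½ ℚ.* ε , half-pos 0<ε ,
  ∀∞-zip (λ j le lt → <ᴿ-close 0ℚ (normℚ z j) (normℚ w j) ε le (ℚₚ.<⇒≤ lt)) h
    (∣∣²-cong w z e (½ ℚ.* ε) (half-pos 0<ε))

∣∣<1-cong : ∀ z w → w ≈ z → ∣ z ∣< 1ℚ → ∣ w ∣< 1ℚ
∣∣<1-cong z w e (ε , 0<ε , h) = ½ ℚ.* ε , half-pos 0<ε ,
  ∀∞-zip (λ j le lt → <ᴿ-close′ 1ℚ (normℚ z j) (normℚ w j) ε le (ℚₚ.<⇒≤ lt)) h
    (∣∣²-cong w z e (½ ℚ.* ε) (half-pos 0<ε))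

root-#0 : ∀ {r q} → r ^ 4 ≈ q → q #0 → r #0
root-#0 {r} {q} e q# =
  let δ , 0<δ , h = low {∣ r ^ 4 ∣²} (#0-resp q (r ^ 4) e q#)
      η , 0<η , η≤δ , η≤1 = clip 0<δ
  in mk#0 r 0<η (∀∞-map (λ j le → bound j η≤δ η≤1 (≤ʳ (normℚ-^ r 4 j) le)) h)
  where
  clip : ∀ {δ} → 0ℚ ℚ.< δ → Σ ℚ λ η → 0ℚ ℚ.< η × η ℚ.≤ δ × η ℚ.≤ 1ℚ
  clip {δ} 0<δ with δ ℚₚ.≤? 1ℚ
  ... | yes δ≤1 = δ , 0<δ , ℚₚ.≤-refl , δ≤1
  ... | no δ≰1  = 1ℚ , 0<1 , ℚₚ.<⇒≤ (ℚₚ.≰⇒> δ≰1) , ℚₚ.≤-refl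
  bound : ∀ j {η δ} → η ℚ.≤ δ → η ℚ.≤ 1ℚ → δ ℚ.≤ normℚ r j ^ʳ 4 → η ℚ.≤ normℚ r j
  bound j η≤δ η≤1 le with normℚ r j ℚₚ.≤? 1ℚ
  ... | yes N≤1 = ℚₚ.≤-trans η≤δ (ℚₚ.≤-trans le (^suc≤ (0≤normℚ r j) N≤1 3))
  ... | no N≰1  = ℚₚ.≤-trans η≤1 (ℚₚ.<⇒≤ (ℚₚ.≰⇒> N≰1))

root-bound : ∀ {N δ} → 0ℚ ℚ.≤ N → 0ℚ ℚ.< δ → N ^ʳ 4 ℚ.+ δ ℚ.≤ 1ℚ →
             N ℚ.+ ½ ℚ.* (½ ℚ.* δ) ℚ.≤ 1ℚ
root-bound {N} {δ} 0≤N 0<δ h with N ℚₚ.≤? 1ℚ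
... | no N≰1 = ⊥-elim (ℚₚ.<-irrefl refl (ℚₚ.<-≤-trans
  (ℚₚ.≤-<-trans (^-mono 0≤1 (ℚₚ.<⇒≤ (ℚₚ.≰⇒> N≰1)) 4) (<-by δ 0<δ refl)) h))
... | yes N≤1 = ≤-by (½ ℚ.* (½ ℚ.* ((1ℚ ℚ.- N) ℚ.* S ℚ.+ (1ℚ ℚ.- (N ^ʳ 4 ℚ.+ δ)))))
  (0≤* 0≤½ (0≤* 0≤½ (0≤+ (0≤* (p≤q⇒0≤q-p N≤1)
    (0≤+ (0≤+ (slack 1) (slack 2)) (slack 3))) (p≤q⇒0≤q-p h))))
  (solve 2 (λ n d → con 1ℚ := (n ⊕ con ½ ⊗ (con ½ ⊗ d)) ⊕
    con ½ ⊗ (con ½ ⊗ ((con 1ℚ ⊖ n) ⊗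
      (((con 1ℚ ⊖ n ⊗ con 1ℚ) ⊕ (con 1ℚ ⊖ n ⊗ (n ⊗ con 1ℚ))) ⊕
       (con 1ℚ ⊖ n ⊗ (n ⊗ (n ⊗ con 1ℚ))))
      ⊕ (con 1ℚ ⊖ (n ⊗ (n ⊗ (n ⊗ (n ⊗ con 1ℚ))) ⊕ d))))) refl N δ)
  where
  S = ((1ℚ ℚ.- N ^ʳ 1) ℚ.+ (1ℚ ℚ.- N ^ʳ 2)) ℚ.+ (1ℚ ℚ.- N ^ʳ 3)
  0≤½ = ℚₚ.<⇒≤ 0<½
  slack : ∀ n → 0ℚ ℚ.≤ 1ℚ ℚ.- N ^ʳ n
  slack n = p≤q⇒0≤q-p (^≤1 0≤N N≤1 n)

root-∣∣<1 : ∀ {r q} → r ^ 4 ≈ q → ∣ q ∣< 1ℚ → ∣ r ∣< 1ℚ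
root-∣∣<1 {r} {q} e q<1 = go (∣∣<1-cong q (r ^ 4) e q<1)
  where
  go : ∣ r ^ 4 ∣< 1ℚ → ∣ r ∣< 1ℚ
  go (δ , 0<δ , h) = ½ ℚ.* (½ ℚ.* δ) , half-pos (half-pos 0<δ) , ∀∞-map (λ j le →
    root-bound (0≤normℚ r j) 0<δ (≤ˡ (cong (ℚ._+ δ) (normℚ-^ r 4 j)) le)) h

0<multiple : ∀ n {k s} → 0 ℕ.< k → s ≡ + suc n ℤ.* + k → ℤ.0ℤ ℤ.< s
0<multiple n {suc k} _ refl = ℤ.+<+ (s≤s z≤n)

0<[k-d]+[3k+d] : ∀ k d → 0 ℕ.< k → ℤ.0ℤ ℤ.< (+ k ℤ.- d) ℤ.+ (+ 3 ℤ.* + k ℤ.+ d)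
0<[k-d]+[3k+d] k d 0<k = 0<multiple 3 0<k
  (ℤS.solve 2 (λ k d → (k ℤS.:- d) ℤS.:+ (ℤS.con (+ 3) ℤS.:* k ℤS.:+ d)
     ℤS.:= ℤS.con (+ 4) ℤS.:* k) refl (+ k) d)

0<[k+d]+[3k-d] : ∀ k d → 0 ℕ.< k → ℤ.0ℤ ℤ.< (+ k ℤ.+ d) ℤ.+ (+ 3 ℤ.* + k ℤ.- d)
0<[k+d]+[3k-d] k d 0<k = 0<multiple 3 0<k
  (ℤS.solve 2 (λ k d → (k ℤS.:+ d) ℤS.:+ (ℤS.con (+ 3) ℤS.:* k ℤS.:- d)
     ℤS.:= ℤS.con (+ 4) ℤS.:* k) refl (+ k) d)

0<[k-d]+[k+d] : ∀ k d → 0 ℕ.< k → ℤ.0ℤ ℤ.< (+ k ℤ.- d) ℤ.+ (+ k ℤ.+ d)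
0<[k-d]+[k+d] k d 0<k = 0<multiple 1 0<k
  (ℤS.solve 2 (λ k d → (k ℤS.:- d) ℤS.:+ (k ℤS.:+ d)
     ℤS.:= ℤS.con (+ 2) ℤS.:* k) refl (+ k) d)

0<2c+2[k-c] : ∀ k c → 0 ℕ.< k → ℤ.0ℤ ℤ.< + 2 ℤ.* c ℤ.+ + 2 ℤ.* (+ k ℤ.- c)
0<2c+2[k-c] k c 0<k = 0<multiple 1 0<k
  (ℤS.solve 2 (λ k c → ℤS.con (+ 2) ℤS.:* c ℤS.:+ ℤS.con (+ 2) ℤS.:* (k ℤS.:- c)
     ℤS.:= ℤS.con (+ 2) ℤS.:* k) refl (+ k) c)

0<k⇒0<nk : ∀ n k → 0 ℕ.< k → ℤ.0ℤ ℤ.< + suc n ℤ.* + k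
0<k⇒0<nk n k 0<k = 0<multiple n 0<k refl

module Submission where

-- Put x = q^((2i−1)/2), Q = q^(k/4) and E = (Q⁴; Q⁴)_∞.  By the triple product, the denominator and the
-- numerator of U are A/E and B/E with A = f(−Qx, −Q³/x) and B = f(−Q/x, −Q³x), and f(−Q/x, −Qx) is their
-- product times (Q²; Q²)_∞.  Since ψ(Q²) (Q²; Q²)_∞ = E², clearing denominators turns the two claims into
--   A² + σ x B² = φ(−σQ) f(σx, σQ²/x)   for σ = −1 and σ = 1.
-- The (s, t) term of A² is the (s + t, s − t) term of the double series f(σx, σQ²/x) φ(−σQ), and (after a
-- reflection) that of σ x B² is the (s + t + 1, s − t) term, so the two squares are the parts of the right side
-- in which the indices have equal and different parity.  The triple product is the limit, by Tannery's
-- theorem, of the finite identity whose coefficients are Gaussian binomials.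

open import Level using (0ℓ)
open import Algebra.Bundles using (CommutativeRing)
import Algebra.Solver.Ring
open import Algebra.Solver.Ring.AlmostCommutativeRing using (fromCommutativeRing; _-Raw-AlmostCommutative⟶_)
open import Data.Nat as ℕ using (ℕ; zero; suc; z≤n; s≤s)
import Data.Nat.Properties as ℕₚ
open import Data.Nat.Divisibility using (_∣_)
open import Data.Integer as ℤ using (ℤ; +_; -[1+_])
import Data.Integer.Properties as ℤₚ
import Data.Integer.Solver
open import Data.Rational as ℚ using (ℚ; 0ℚ; 1ℚ; ½)
import Data.Rational.Properties as ℚₚ
import Data.Rational.Solver
open import Data.Maybe using (Maybe; just; nothing)
open import Data.Product using (Σ; _×_; _,_; proj₁; proj₂)
open import Data.Sum using (_⊎_; inj₁; inj₂)
import Relation.Binary.Reasoning.Setoid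
open import Relation.Binary.PropositionalEquality as ≡ using (_≡_)
open import Relation.Nullary using (yes; no)
open import Defs using (≤ˡ; ≤ʳ; ≤-by; p≤q⇒0≤q-p; p<q⇒0<q-p; *-monoʳ; *-monoˡ; *-mono; 0≤*; 0≤+; 0<1; 0≤1; 0<½;
  half-pos; half+half; recip; recip-inv; recip-anti; 0<recip; shrink; _^ʳ_; 0≤^; ^≤1; ½<1; eventually-small;
  ∀∞; ∀∞-map; ∀∞-zip; ∀∞-some; T)

open Data.Rational.Solver.+-*-Solver using ()
  renaming (solve to solveℚ; con to conℚ; _:=_ to _⊜_; _:+_ to _⊕_; _:*_ to _⊗_; _:-_ to _⊖_; :-_ to ⊝_)
open Data.Integer.Solver.+-*-Solver using ()
  renaming (solve to solveℤ; con to conℤ; _:=_ to _≜_; _:+_ to _⊞_; _:*_ to _⊠_; _:-_ to _⊟_; :-_ to ⊟′_)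

-- Two obstacles shape the proof. The first is division: E is not known to be nonzero beforehand.
-- The products 1/(q; q)_m stay bounded, since 1/(1 - ρᵐ) = 1 + O(ρᵐ), and therefore E/(q; q)_m → 1.
-- This cancels E from an equation without dividing by it, and it also bounds E away from 0. The
-- second is that a complex number is a Cauchy sequence of rationals. The arguments are therefore
-- made in an abstract commutative algebra with rational norm bounds, and ℂ enters through two
-- interfaces, one for the algebra and one for the q-series. All exponents are integers over the
-- fixed root q^(1/4), and a theta term is a sign times that root raised to a quadratic polynomial
-- in the index. The comparison of terms in the square identity is thus a polynomial identity over ℤ
-- together with a rule for signs.

-- Algebras with rational norm bounds

record NormedAlgebra : Set₁ where
  field
    commutativeRing : CommutativeRing 0ℓ 0ℓ
  open CommutativeRing commutativeRing public
  field
    scalars : ℚₚ.+-*-rawRing -Raw-AlmostCommutative⟶ fromCommutativeRing commutativeRing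

  infix 4 _≼_
  field
    -- z ≼ c means ∥z∥ ≤ c
    _≼_      : Carrier → ℚ → Set
    ≼-resp   : ∀ {z w c} → z ≈ w → z ≼ c → w ≼ c
    ≼-mono   : ∀ {z c d} → c ℚ.≤ d → z ≼ c → z ≼ d
    ≼⇒0≤     : ∀ {z c} → z ≼ c → 0ℚ ℚ.≤ c
    0≼0      : 0# ≼ 0ℚ
    1≼1      : 1# ≼ 1ℚ
    ≼-+      : ∀ {z w c d} → z ≼ c → w ≼ d → z + w ≼ c ℚ.+ d
    ≼-*      : ∀ {z w c d} → z ≼ c → w ≼ d → z * w ≼ c ℚ.* d
    ≼-neg    : ∀ {z c} → z ≼ c → - z ≼ c
    ≼-small  : ∀ {z} → (∀ ε → 0ℚ ℚ.< ε → z ≼ ε) → z ≈ 0#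
    bounded  : ∀ z → Σ ℚ λ B → z ≼ B
    -- Replaces the geometric series: it inverts the factors of (q; q)_m, with a bound, although
    -- completeness of the algebra is not assumed.
    1-z-inverse : ∀ {z ρ} → z ≼ ρ → ρ ℚ.< 1ℚ →
                  Σ Carrier λ w → ((1# - z) * w ≈ 1#) × w ≼ recip (1ℚ ℚ.- ρ)

-- Elementary algebra, limits and bilateral sums

module NormedAlgebraProperties (A : NormedAlgebra) where
  open NormedAlgebra A
  open Relation.Binary.Reasoning.Setoid setoid
  open _-Raw-AlmostCommutative⟶_ scalars using (⟦_⟧)

  private
    scalar≟ : ∀ p q → Maybe (⟦ p ⟧ ≈ ⟦ q ⟧)
    scalar≟ p q with p ℚₚ.≟ q
    ... | yes p≡q = just (reflexive (≡.cong ⟦_⟧ p≡q))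
    ... | no _    = nothing

  open Algebra.Solver.Ring ℚₚ.+-*-rawRing (fromCommutativeRing commutativeRing) scalars scalar≟
    using (solve; con; _:=_; _:+_; _:*_; _:-_; :-_; _:^_; Polynomial) public

  -- con 1ℚ denotes the image of the scalar 1ℚ, which need not be 1# definitionally.
  one : ∀ {n} → Polynomial n
  one = con 0ℚ :^ 0

  x-0≈x : ∀ x → x - 0# ≈ x
  x-0≈x x = trans (+-congˡ -0≈0) (+-identityʳ x)
    where
    -0≈0 : - 0# ≈ 0#
    -0≈0 = trans (sym (+-identityˡ (- 0#))) (-‿inverseʳ 0#)

  1+[x-1]≈x : ∀ x → x ≈ 1# - - (x - 1#)
  1+[x-1]≈x = solve 1 (λ x → x := one :- (:- (x :- one))) refl

  +-interchange : ∀ a b c d → (a + b) + (c + d) ≈ (a + c) + (b + d)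
  +-interchange = solve 4 (λ a b c d → (a :+ b) :+ (c :+ d) := (a :+ c) :+ (b :+ d)) refl

  -x≈-1*x : ∀ x → - x ≈ - 1# * x
  -x≈-1*x = solve 1 (λ x → :- x := (:- one) :* x) refl

  x≈-[-1]*x : ∀ x → x ≈ - - 1# * x
  x≈-[-1]*x = solve 1 (λ x → x := (:- (:- one)) :* x) refl

  -‿involutive : ∀ x → - - x ≈ x
  -‿involutive = solve 1 (λ x → :- (:- x) := x) refl

  -x*-y≈x*y : ∀ x y → - x * - y ≈ x * y
  -x*-y≈x*y = solve 2 (λ x y → (:- x) :* (:- y) := x :* y) refl

  *-interchange : ∀ a b c d → a * b * (c * d) ≈ a * c * (b * d)
  *-interchange = solve 4 (λ a b c d → a :* b :* (c :* d) := a :* c :* (b :* d)) refl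

  1*x-y≈x+-1*y : ∀ x y → 1# * x - y ≈ x + - 1# * y
  1*x-y≈x+-1*y = solve 2 (λ x y → one :* x :- y := x :+ (:- one) :* y) refl

  1*x+y≈x+1*y : ∀ x y → 1# * x + y ≈ x + 1# * y
  1*x+y≈x+1*y = solve 2 (λ x y → one :* x :+ y := x :+ one :* y) refl

  x-y≈0⇒x≈y : ∀ {x y} → x - y ≈ 0# → x ≈ y
  x-y≈0⇒x≈y {x} {y} e = begin
    x            ≈⟨ solve 2 (λ x y → x := (x :- y) :+ y) refl x y ⟩
    (x - y) + y  ≈⟨ +-congʳ e ⟩
    0# + y       ≈⟨ +-identityˡ y ⟩
    y            ∎

  ≼-pos : ∀ {z c} → 0ℚ ℚ.≤ c → z ≈ 0# → z ≼ c
  ≼-pos 0≤c e = ≼-mono 0≤c (≼-resp (sym e) 0≼0)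

  ≼-- : ∀ {z w c d} → z ≼ c → w ≼ d → z - w ≼ c ℚ.+ d
  ≼-- h g = ≼-+ h (≼-neg g)

  infix 4 _⟶_
  _⟶_ : (ℕ → Carrier) → Carrier → Set
  s ⟶ L = ∀ ε → 0ℚ ℚ.< ε → ∀∞ λ n → s n - L ≼ ε

  lim-cong : ∀ {s s′ L L′} → (∀ n → s n ≈ s′ n) → L ≈ L′ → s ⟶ L → s′ ⟶ L′
  lim-cong e e′ h ε 0<ε = ∀∞-map (λ n → ≼-resp (+-cong (e n) (-‿cong e′))) (h ε 0<ε)

  lim-unique : ∀ {s L M} → s ⟶ L → s ⟶ M → L ≈ M
  lim-unique {s} {L} {M} h g = x-y≈0⇒x≈y (≼-small λ ε 0<ε →
    let n , a , b = ∀∞-some (∀∞-zip (λ _ → _,_) (h (½ ℚ.* ε) (half-pos 0<ε)) (g (½ ℚ.* ε) (half-pos 0<ε)))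
    in ≡.subst (L - M ≼_) (half+half ε)
         (≼-resp (solve 3 (λ s l m → (s :- m) :- (s :- l) := l :- m) refl (s n) L M) (≼-- b a)))

  lim-const : ∀ {L} → (λ _ → L) ⟶ L
  lim-const {L} ε 0<ε = 0 , λ _ _ → ≼-pos (ℚₚ.<⇒≤ 0<ε) (-‿inverseʳ L)

  lim-+ : ∀ {s t L M} → s ⟶ L → t ⟶ M → (λ n → s n + t n) ⟶ L + M
  lim-+ {s} {t} {L} {M} h g ε 0<ε = ∀∞-zip
    (λ n a b → ≡.subst (s n + t n - (L + M) ≼_) (half+half ε)
      (≼-resp (solve 4 (λ s t l m → (s :- l) :+ (t :- m) := s :+ t :- (l :+ m)) refl (s n) (t n) L M) (≼-+ a b)))
    (h (½ ℚ.* ε) (half-pos 0<ε)) (g (½ ℚ.* ε) (half-pos 0<ε))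

  lim-neg : ∀ {s L} → s ⟶ L → (λ n → - s n) ⟶ - L
  lim-neg {s} {L} h ε 0<ε = ∀∞-map
    (λ n a → ≼-resp (solve 2 (λ s l → :- (s :- l) := (:- s) :- (:- l)) refl (s n) L) (≼-neg a)) (h ε 0<ε)

  lim-bounded : ∀ {s L} → s ⟶ L → Σ ℚ λ B → ∀∞ λ n → s n ≼ B
  lim-bounded {s} {L} h =
    let B , b = bounded L
    in 1ℚ ℚ.+ B , ∀∞-map
         (λ n a → ≼-resp (solve 2 (λ s l → (s :- l) :+ l := s) refl (s n) L) (≼-+ a b)) (h 1ℚ 0<1)

  lim-* : ∀ {s t L M} → s ⟶ L → t ⟶ M → (λ n → s n * t n) ⟶ L * M
  lim-* {s} {t} {L} {M} h g ε 0<ε =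
    let B , (N , hB) = lim-bounded h
        C , hC = bounded M
        0≤B = ≼⇒0≤ (hB N ℕₚ.≤-refl)
        δ , 0<δ , lt = shrink {1ℚ ℚ.+ (B ℚ.+ C)}
          (ℚₚ.<-≤-trans 0<1 (≤-by (B ℚ.+ C) (0≤+ 0≤B (≼⇒0≤ hC)) ≡.refl)) 0<ε
        bound : B ℚ.* δ ℚ.+ C ℚ.* δ ℚ.≤ ε
        bound = ℚₚ.≤-trans (≤-by δ (ℚₚ.<⇒≤ 0<δ)
          (solveℚ 3 (λ b c d → (conℚ 1ℚ ⊕ (b ⊕ c)) ⊗ d ⊜ (b ⊗ d ⊕ c ⊗ d) ⊕ d) ≡.refl B C δ)) (ℚₚ.<⇒≤ lt)
    in ∀∞-zip (λ n b (a , c) → ≼-mono bound (≼-resp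
         (solve 4 (λ s t l m → s :* (t :- m) :+ m :* (s :- l) := s :* t :- l :* m) refl (s n) (t n) L M)
         (≼-+ (≼-* b c) (≼-* hC a))))
       (N , hB) (∀∞-zip (λ _ → _,_) (h δ 0<δ) (g δ 0<δ))

  lim-subsequence : ∀ {s L} (g : ℕ → ℕ) → (∀ N → ∀∞ λ n → N ℕ.≤ g n) → s ⟶ L → (λ n → s (g n)) ⟶ L
  lim-subsequence g g→∞ h ε 0<ε =
    let N , hN = h ε 0<ε
    in ∀∞-map (λ n le → hN (g n) le) (g→∞ N)

  lim-double : ∀ {s L} → s ⟶ L → (λ n → s (n ℕ.+ n)) ⟶ L
  lim-double = lim-subsequence (λ n → n ℕ.+ n) λ N → N , λ n le → ℕₚ.≤-trans le (ℕₚ.m≤m+n n n)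

  -- Boundedness of `s` suffices, which suits the reciprocals 1/(q; q)_m: they are bounded before
  -- anything is known about their limit.
  lim-bounded-* : ∀ {s : ℕ → Carrier} {t B} → (∀ n → s n ≼ B) → t ⟶ 0# → (λ n → s n * t n) ⟶ 0#
  lim-bounded-* {s} {t} {B} hB h ε 0<ε =
    let δ , 0<δ , lt = shrink {1ℚ ℚ.+ B} (ℚₚ.<-≤-trans 0<1 (≤-by B (≼⇒0≤ (hB 0)) ≡.refl)) 0<ε
        bound : B ℚ.* δ ℚ.≤ ε
        bound = ℚₚ.≤-trans (≤-by δ (ℚₚ.<⇒≤ 0<δ)
          (solveℚ 2 (λ b d → (conℚ 1ℚ ⊕ b) ⊗ d ⊜ b ⊗ d ⊕ d) ≡.refl B δ)) (ℚₚ.<⇒≤ lt)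
    in ∀∞-map (λ n a → ≼-mono bound (≼-resp (sym (x-0≈x (s n * t n)))
         (≼-* (hB n) (≼-resp (x-0≈x (t n)) a)))) (h δ 0<δ)

  -- Bilateral sums are taken over the windows [−N, N).
  S : (ℤ → Carrier) → ℕ → Carrier
  S t zero    = 0#
  S t (suc N) = S t N + (t (+ N) + t -[1+ N ])

  HasSum : (ℤ → Carrier) → Carrier → Set
  HasSum t L = S t ⟶ L

  S-cong : ∀ {t u} → (∀ j → t j ≈ u j) → ∀ N → S t N ≈ S u N
  S-cong e zero    = refl
  S-cong e (suc N) = +-cong (S-cong e N) (+-cong (e (+ N)) (e -[1+ N ]))

  S-+ : ∀ t u N → S (λ j → t j + u j) N ≈ S t N + S u N
  S-+ t u zero    = sym (+-identityˡ 0#)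
  S-+ t u (suc N) = trans (+-congʳ (S-+ t u N))
    (solve 6 (λ a b c d e f → a :+ b :+ ((c :+ d) :+ (e :+ f)) := a :+ (c :+ e) :+ (b :+ (d :+ f)))
      refl (S t N) (S u N) (t (+ N)) (u (+ N)) (t -[1+ N ]) (u -[1+ N ]))

  S-*ˡ : ∀ c t N → S (λ j → c * t j) N ≈ c * S t N
  S-*ˡ c t zero    = sym (zeroʳ c)
  S-*ˡ c t (suc N) = trans (+-congʳ (S-*ˡ c t N))
    (solve 4 (λ c s a b → c :* s :+ (c :* a :+ c :* b) := c :* (s :+ (a :+ b))) refl c (S t N) (t (+ N)) (t -[1+ N ]))

  HasSum-cong : ∀ {t u L M} → (∀ j → t j ≈ u j) → L ≈ M → HasSum t L → HasSum u M
  HasSum-cong e e′ = lim-cong (S-cong e) e′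

  HasSum-+ : ∀ {t u L M} → HasSum t L → HasSum u M → HasSum (λ j → t j + u j) (L + M)
  HasSum-+ {t} {u} h g = lim-cong (λ n → sym (S-+ t u n)) refl (lim-+ h g)

  HasSum-*ˡ : ∀ c {t L} → HasSum t L → HasSum (λ j → c * t j) (c * L)
  HasSum-*ˡ c {t} h = lim-cong (λ n → sym (S-*ˡ c t n)) refl (lim-* lim-const h)

  -- The window [-N, N) is symmetric about -1/2, so j ↦ -j - 1 permutes it, whereas negation does
  -- not.
  S-reflect : ∀ t N → S (λ j → t (ℤ.pred (ℤ.- j))) N ≈ S t N
  S-reflect t zero    = refl
  S-reflect t (suc N) = +-cong (S-reflect t N) (trans (+-comm _ _) (+-cong
    (reflexive (≡.cong t (ℤₚ.pred-suc (+ N))))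
    (reflexive (≡.cong t (lem N)))))
    where
    lem : ∀ N → ℤ.pred (ℤ.- (+ N)) ≡ -[1+ N ]
    lem zero    = ≡.refl
    lem (suc N) = ≡.refl

  suc-[1+] : ∀ N → ℤ.suc -[1+ N ] ≡ ℤ.- (+ N)
  suc-[1+] zero    = ≡.refl
  suc-[1+] (suc N) = ≡.refl

  -- The moved window gains the index N and loses -N.
  S-suc : ∀ t N → S (λ j → t (ℤ.suc j)) N ≈ S t N + (t (+ N) - t (ℤ.- (+ N)))
  S-suc t zero    = trans (sym (-‿inverseʳ (t (+ 0)))) (sym (+-identityˡ _))
  S-suc t (suc N) = begin
    S (λ j → t (ℤ.suc j)) N + (t (+ suc N) + t (ℤ.suc -[1+ N ]))
      ≈⟨ +-cong (S-suc t N) (+-congˡ (reflexive (≡.cong t (suc-[1+] N)))) ⟩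
    S t N + (t (+ N) - t (ℤ.- (+ N))) + (t (+ suc N) + t (ℤ.- (+ N)))
      ≈⟨ solve 5 (λ s a b c d → s :+ (a :- b) :+ (c :+ b) := s :+ (a :+ d) :+ (c :- d)) refl
           (S t N) (t (+ N)) (t (ℤ.- (+ N))) (t (+ suc N)) (t -[1+ N ]) ⟩
    S t N + (t (+ N) + t -[1+ N ]) + (t (+ suc N) - t -[1+ N ])  ∎

-- Geometric weights on the integers

2ℚ 3ℚ : ℚ
2ℚ = 1ℚ ℚ.+ 1ℚ
3ℚ = 1ℚ ℚ.+ 2ℚ

0≤3 : 0ℚ ℚ.≤ 3ℚ
0≤3 = ℚₚ.nonNegative⁻¹ 3ℚ

ℤ-induction : (P : ℤ → Set) → P (+ 0) → (∀ i → P i → P (ℤ.suc i)) → (∀ i → P (ℤ.suc i) → P i) → ∀ i → P i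
ℤ-induction P base up down (+ zero)       = base
ℤ-induction P base up down (+ suc n)      = up (+ n) (ℤ-induction P base up down (+ n))
ℤ-induction P base up down -[1+ zero ]    = down -[1+ zero ] base
ℤ-induction P base up down -[1+ suc n ]   = down -[1+ suc n ] (ℤ-induction P base up down -[1+ n ])

½^∣suc∣≤ : ∀ j → ½ ^ʳ ℤ.∣ ℤ.suc j ∣ ℚ.≤ 2ℚ ℚ.* ½ ^ʳ ℤ.∣ j ∣
½^∣suc∣≤ (+ n) = ≤-by ((1ℚ ℚ.+ ½) ℚ.* u) (0≤* (ℚₚ.nonNegative⁻¹ _) (0≤^ (ℚₚ.<⇒≤ 0<½) n))
  (solveℚ 1 (λ u → conℚ 2ℚ ⊗ u ⊜ conℚ ½ ⊗ u ⊕ (conℚ 1ℚ ⊕ conℚ ½) ⊗ u) ≡.refl u)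
  where u = ½ ^ʳ n
½^∣suc∣≤ -[1+ zero ]  = ℚₚ.≤-reflexive ≡.refl
½^∣suc∣≤ -[1+ suc n ] = ℚₚ.≤-reflexive
  (solveℚ 1 (λ u → conℚ ½ ⊗ u ⊜ conℚ 2ℚ ⊗ (conℚ ½ ⊗ (conℚ ½ ⊗ u))) ≡.refl (½ ^ʳ n))

½^∣pred∣≤ : ∀ j → ½ ^ʳ ℤ.∣ ℤ.pred j ∣ ℚ.≤ 2ℚ ℚ.* ½ ^ʳ ℤ.∣ j ∣
½^∣pred∣≤ (+ zero)  = ≤-by (1ℚ ℚ.+ ½) (ℚₚ.nonNegative⁻¹ _) ≡.refl
½^∣pred∣≤ (+ suc n) = ℚₚ.≤-reflexive
  (solveℚ 1 (λ u → u ⊜ conℚ 2ℚ ⊗ (conℚ ½ ⊗ u)) ≡.refl (½ ^ʳ n))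
½^∣pred∣≤ -[1+ n ]  = ≤-by ((1ℚ ℚ.+ ½) ℚ.* u) (0≤* (ℚₚ.nonNegative⁻¹ _) (0≤^ (ℚₚ.<⇒≤ 0<½) (suc n)))
  (solveℚ 1 (λ u → conℚ 2ℚ ⊗ u ⊜ conℚ ½ ⊗ u ⊕ (conℚ 1ℚ ⊕ conℚ ½) ⊗ u) ≡.refl u)
  where u = ½ ^ʳ suc n

-- A potential whose increments are the weights ½^∣j∣.
height : ℤ → ℚ
height (+ n)    = 3ℚ ℚ.- 2ℚ ℚ.* ½ ^ʳ n
height -[1+ n ] = ½ ^ʳ suc n

height-suc : ∀ j → height (ℤ.suc j) ≡ height j ℚ.+ ½ ^ʳ ℤ.∣ j ∣
height-suc (+ n)        = solveℚ 1
  (λ u → conℚ 3ℚ ⊖ conℚ 2ℚ ⊗ (conℚ ½ ⊗ u)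
     ⊜ conℚ 3ℚ ⊖ conℚ 2ℚ ⊗ u ⊕ u) ≡.refl (½ ^ʳ n)
height-suc -[1+ zero ]  = ≡.refl
height-suc -[1+ suc n ] =
  solveℚ 1 (λ u → conℚ ½ ⊗ u ⊜ conℚ ½ ⊗ (conℚ ½ ⊗ u) ⊕ conℚ ½ ⊗ (conℚ ½ ⊗ u)) ≡.refl (½ ^ʳ n)

0≤height : ∀ j → 0ℚ ℚ.≤ height j
0≤height (+ n)    = p≤q⇒0≤q-p (ℚₚ.≤-trans
  (*-monoˡ (ℚₚ.nonNegative⁻¹ 2ℚ) (^≤1 (ℚₚ.<⇒≤ 0<½) (ℚₚ.<⇒≤ ½<1) n))
  (≤-by 1ℚ 0≤1 ≡.refl))
0≤height -[1+ n ] = 0≤^ (ℚₚ.<⇒≤ 0<½) (suc n)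

-- The total weight 3 consists of 1 from the negative indices and 2 from the others.
height≤3 : ∀ j → height j ℚ.≤ 3ℚ
height≤3 (+ n)    = ≤-by (2ℚ ℚ.* ½ ^ʳ n) (0≤* (ℚₚ.nonNegative⁻¹ _) (0≤^ (ℚₚ.<⇒≤ 0<½) n))
  (solveℚ 1 (λ u → conℚ 3ℚ
     ⊜ conℚ 3ℚ ⊖ conℚ 2ℚ ⊗ u ⊕ conℚ 2ℚ ⊗ u) ≡.refl (½ ^ʳ n))
height≤3 -[1+ n ] = ℚₚ.≤-trans (^≤1 (ℚₚ.<⇒≤ 0<½) (ℚₚ.<⇒≤ ½<1) (suc n)) (≤-by 2ℚ (ℚₚ.nonNegative⁻¹ _) ≡.refl)

-- Bilateral series with geometric domination

module Summation (A : NormedAlgebra) where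
  open NormedAlgebra A
  open NormedAlgebraProperties A
  open Relation.Binary.Reasoning.Setoid setoid

  -- The ratio can be fixed at ½ because theta terms eventually shrink faster than any geometric
  -- sequence; only the constant depends on the series.
  record Decay (t : ℤ → Carrier) (C : ℚ) : Set where
    constructor decay
    field
      at : ∀ j → t j ≼ C ℚ.* ½ ^ʳ ℤ.∣ j ∣
  open Decay

  Decay-0≤ : ∀ {t C} → Decay t C → 0ℚ ℚ.≤ C
  Decay-0≤ {C = C} h = ≤ʳ (ℚₚ.*-identityʳ C) (≼⇒0≤ (at h (+ 0)))

  Decay-cong : ∀ {t u C} → (∀ j → t j ≈ u j) → Decay t C → Decay u C
  Decay-cong e h = decay λ j → ≼-resp (e j) (at h j)

  Decay-*ˡ : ∀ {c B t C} → c ≼ B → Decay t C → Decay (λ j → c * t j) (B ℚ.* C)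
  Decay-*ˡ {c} {B} {t} {C} b h = decay λ j →
    ≡.subst (c * t j ≼_) (≡.sym (ℚₚ.*-assoc B C _)) (≼-* b (at h j))

  private
    double-weight : ∀ {C} j j′ → 0ℚ ℚ.≤ C → ½ ^ʳ ℤ.∣ j′ ∣ ℚ.≤ 2ℚ ℚ.* ½ ^ʳ ℤ.∣ j ∣ →
      C ℚ.* ½ ^ʳ ℤ.∣ j′ ∣ ℚ.≤ C ℚ.* 2ℚ ℚ.* ½ ^ʳ ℤ.∣ j ∣
    double-weight {C} j j′ 0≤C le = ≤ʳ (≡.sym (ℚₚ.*-assoc C _ _)) (*-monoˡ 0≤C le)

  Decay-suc : ∀ {t C} → Decay t C → Decay (λ j → t (ℤ.suc j)) (C ℚ.* 2ℚ)
  Decay-suc h = decay λ j → ≼-mono (double-weight j (ℤ.suc j) (Decay-0≤ h) (½^∣suc∣≤ j)) (at h (ℤ.suc j))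

  Decay-pred : ∀ {t C} → Decay t C → Decay (λ j → t (ℤ.pred j)) (C ℚ.* 2ℚ)
  Decay-pred h = decay λ j → ≼-mono (double-weight j (ℤ.pred j) (Decay-0≤ h) (½^∣pred∣≤ j)) (at h (ℤ.pred j))

  -- The two terms added at stage N weigh ½^N + ½^(N+1) = 3 (½^N - ½^(N+1)), so their bounds
  -- telescope.
  S-tail : ∀ {t C} → Decay t C → ∀ d J →
    S t (d ℕ.+ J) - S t J ≼ (C ℚ.* 3ℚ) ℚ.* (½ ^ʳ J ℚ.- ½ ^ʳ (d ℕ.+ J))
  S-tail {t} {C} h zero J = ≡.subst (S t J - S t J ≼_)
    (solveℚ 2 (λ c u → conℚ 0ℚ ⊜ c ⊗ (u ⊖ u)) ≡.refl (C ℚ.* 3ℚ) (½ ^ʳ J))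
    (≼-resp (sym (-‿inverseʳ (S t J))) 0≼0)
  S-tail {t} {C} h (suc d) J = ≡.subst (S t (suc d ℕ.+ J) - S t J ≼_)
    (solveℚ 3 (λ c u v → c ⊗ conℚ 3ℚ ⊗ (v ⊖ u) ⊕ (c ⊗ u ⊕ c ⊗ (conℚ ½ ⊗ u))
       ⊜ c ⊗ conℚ 3ℚ ⊗ (v ⊖ conℚ ½ ⊗ u)) ≡.refl C (½ ^ʳ (d ℕ.+ J)) (½ ^ʳ J))
    (≼-resp (solve 3 (λ s r x → (s :- r) :+ x := (s :+ x) :- r) refl _ _ _)
      (≼-+ (S-tail h d J) (≼-+ (at h (+ (d ℕ.+ J))) (at h -[1+ d ℕ.+ J ]))))

  S-tail-lim : ∀ {t C L} → Decay t C → HasSum t L → ∀ J δ → 0ℚ ℚ.< δ →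
    S t J - L ≼ (C ℚ.* 3ℚ) ℚ.* ½ ^ʳ J ℚ.+ δ
  S-tail-lim {t} {C} {L} h s J δ 0<δ =
    let N , hN = s δ 0<δ
        le = hN (N ℕ.+ J) (ℕₚ.m≤m+n N J)
    in ≼-resp (solve 3 (λ a b l → :- (b :- a) :+ (b :- l) := a :- l) refl (S t J) (S t (N ℕ.+ J)) L)
         (≼-+ (≼-neg (≼-mono (*-monoˡ {r = C ℚ.* 3ℚ} (0≤* (Decay-0≤ h) 0≤3)
             (≤-by {½ ^ʳ J ℚ.- ½ ^ʳ (N ℕ.+ J)} (½ ^ʳ (N ℕ.+ J)) (0≤^ (ℚₚ.<⇒≤ 0<½) (N ℕ.+ J))
               (solveℚ 2 (λ u v → u ⊜ (u ⊖ v) ⊕ v) ≡.refl (½ ^ʳ J) (½ ^ʳ (N ℕ.+ J)))))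
           (S-tail h N J))) le)

  S-shifted : ∀ {t C} → Decay t C → ∀ a N →
    S (λ j → t (j ℤ.+ a)) N ≼ C ℚ.* (height (+ N ℤ.+ a) ℚ.- height (ℤ.- (+ N) ℤ.+ a))
  S-shifted {t} {C} h a zero = ≡.subst (0# ≼_)
    (solveℚ 2 (λ c u → conℚ 0ℚ ⊜ c ⊗ (u ⊖ u)) ≡.refl C (height (+ 0 ℤ.+ a))) 0≼0
  S-shifted {t} {C} h a (suc N) = ≡.subst (S (λ j → t (j ℤ.+ a)) (suc N) ≼_)
    (≡.trans (≡.cong (λ x → C ℚ.* (height (+ N ℤ.+ a) ℚ.- x) ℚ.+ (C ℚ.* u ℚ.+ C ℚ.* v)) low)
      (≡.trans (solveℚ 5 (λ c x u y v → c ⊗ (x ⊖ (y ⊕ v)) ⊕ (c ⊗ u ⊕ c ⊗ v) ⊜ c ⊗ ((x ⊕ u) ⊖ y)) ≡.refl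
          C (height (+ N ℤ.+ a)) u (height (-[1+ N ] ℤ.+ a)) v)
        (≡.cong (λ x → C ℚ.* (x ℚ.- height (-[1+ N ] ℤ.+ a))) (≡.sym high))))
    (≼-+ (S-shifted h a N) (≼-+ (at h (+ N ℤ.+ a)) (at h (-[1+ N ] ℤ.+ a))))
    where
    u = ½ ^ʳ ℤ.∣ + N ℤ.+ a ∣
    v = ½ ^ʳ ℤ.∣ -[1+ N ] ℤ.+ a ∣
    high : height (+ suc N ℤ.+ a) ≡ height (+ N ℤ.+ a) ℚ.+ u
    high = ≡.trans (≡.cong height (ℤₚ.+-assoc (+ 1) (+ N) a)) (height-suc (+ N ℤ.+ a))
    low : height (ℤ.- (+ N) ℤ.+ a) ≡ height (-[1+ N ] ℤ.+ a) ℚ.+ v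
    low = ≡.trans (≡.cong height (≡.trans (≡.cong (ℤ._+ a) (≡.sym (suc-[1+] N))) (ℤₚ.+-assoc (+ 1) -[1+ N ] a)))
            (height-suc (-[1+ N ] ℤ.+ a))

  -- The bound does not depend on the shift `a`. This uniformity supplies the dominating constant
  -- for the rows in `parity-product`.
  S-shifted-bounded : ∀ {t C} → Decay t C → ∀ a N → S (λ j → t (j ℤ.+ a)) N ≼ C ℚ.* 3ℚ
  S-shifted-bounded {C = C} h a N = ≼-mono (*-monoˡ {r = C} (Decay-0≤ h) (ℚₚ.≤-trans
      (≤-by {x ℚ.- y} y (0≤height (ℤ.- (+ N) ℤ.+ a)) (solveℚ 2 (λ x y → x ⊜ x ⊖ y ⊕ y) ≡.refl x y))
      (height≤3 (+ N ℤ.+ a)))) (S-shifted h a N)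
    where x = height (+ N ℤ.+ a)
          y = height (ℤ.- (+ N) ℤ.+ a)

  Decay⇒0⁺ : ∀ {t C} → Decay t C → (λ N → t (+ N) - t (ℤ.- (+ N))) ⟶ 0#
  Decay⇒0⁺ {t} {C} h ε 0<ε = ∀∞-map (λ N le → ≼-resp (sym (x-0≈x _))
      (≼-mono (≤ˡ (solveℚ 2 (λ c u → (c ⊕ c) ⊗ u ⊜ c ⊗ u ⊕ c ⊗ u) ≡.refl C (½ ^ʳ N)) le)
        (≼-- (at h (+ N)) (≡.subst (λ m → t (ℤ.- (+ N)) ≼ C ℚ.* ½ ^ʳ m) (ℤₚ.∣-i∣≡∣i∣ (+ N)) (at h (ℤ.- (+ N)))))))
    (eventually-small {C ℚ.+ C} (0≤+ {C} {C} (Decay-0≤ h) (Decay-0≤ h)) (ℚₚ.<⇒≤ 0<½) ½<1 0<ε)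

  HasSum-suc : ∀ {t C L} → Decay t C → HasSum t L → HasSum (λ j → t (ℤ.suc j)) L
  HasSum-suc {t} h s = lim-cong (λ N → sym (S-suc t N)) (+-identityʳ _) (lim-+ s (Decay⇒0⁺ h))

  HasSum-pred : ∀ {t C L} → Decay t C → HasSum t L → HasSum (λ j → t (ℤ.pred j)) L
  HasSum-pred {t} {L = L} h s = lim-cong
    (λ N → trans (+-congʳ (trans (S-cong (λ j → reflexive (≡.cong t (≡.sym (ℤₚ.pred-suc j)))) N) (S-suc u N)))
      (solve 2 (λ s d → (s :+ d) :- d := s) refl (S u N) (u (+ N) - u (ℤ.- (+ N)))))
    (x-0≈x L) (lim-+ s (lim-neg (Decay⇒0⁺ (Decay-pred h))))
    where u : ℤ → Carrier
          u j = t (ℤ.pred j)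

  HasSum-shift : ∀ {t C L} → Decay t C → HasSum t L → ∀ a → HasSum (λ j → t (j ℤ.+ a)) L
  HasSum-shift {t} {C} {L} h s a = proj₂ (shift a)
    where
    P : ℤ → Set
    -- The decay constant is existential because it doubles with every unit of shift.
    P a = (Σ ℚ λ C → Decay (λ j → t (j ℤ.+ a)) C) × HasSum (λ j → t (j ℤ.+ a)) L
    up : ∀ a → P a → P (ℤ.suc a)
    up a ((C , h) , s) = (_ , Decay-cong e (Decay-suc h)) , HasSum-cong e refl (HasSum-suc h s)
      where
      e : ∀ j → t (ℤ.suc j ℤ.+ a) ≈ t (j ℤ.+ ℤ.suc a)
      e j = reflexive (≡.cong t (solveℤ 2 (λ j a → (conℤ (+ 1) ⊞ j) ⊞ a ≜ j ⊞ (conℤ (+ 1) ⊞ a)) ≡.refl j a))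
    down : ∀ a → P (ℤ.suc a) → P a
    down a ((C , h) , s) = (_ , Decay-cong e (Decay-pred h)) , HasSum-cong e refl (HasSum-pred h s)
      where
      e : ∀ j → t (ℤ.pred j ℤ.+ ℤ.suc a) ≈ t (j ℤ.+ a)
      e j = reflexive (≡.cong t (solveℤ 2 (λ j a → (conℤ (ℤ.- (+ 1)) ⊞ j) ⊞ (conℤ (+ 1) ⊞ a) ≜ j ⊞ a) ≡.refl j a))
    base : P (+ 0)
    base = (C , Decay-cong e h) , HasSum-cong e refl s
      where
      e : ∀ j → t j ≈ t (j ℤ.+ + 0)
      e j = reflexive (≡.cong t (≡.sym (ℤₚ.+-identityʳ j)))
    shift : ∀ a → P a
    shift = ℤ-induction P base up down

  -- Write -j as the successor of -j - 1: the inner map preserves the windows and the outer one is a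
  -- shift.
  HasSum-reflect : ∀ {t C L} → Decay t C → HasSum t L → HasSum (λ j → t (ℤ.- j)) L
  HasSum-reflect {t} h s = HasSum-cong (λ j → reflexive (≡.cong t (ℤₚ.suc-pred (ℤ.- j)))) refl
    (lim-cong (λ N → sym (S-reflect (λ j → t (ℤ.suc j)) N)) refl (HasSum-suc h s))

  Decay-reflect : ∀ {t C} → Decay t C → Decay (λ j → t (ℤ.- j)) C
  Decay-reflect {t} {C} h = decay λ j → ≡.subst (λ m → t (ℤ.- j) ≼ C ℚ.* ½ ^ʳ m) (ℤₚ.∣-i∣≡∣i∣ j) (at h (ℤ.- j))

  S-lim : ∀ {T : ℕ → ℤ → Carrier} {T∞} → (∀ j → (λ N → T N j) ⟶ T∞ j) → ∀ n → (λ N → S (T N) n) ⟶ S T∞ n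
  S-lim h zero    = lim-const
  S-lim h (suc n) = lim-+ (S-lim h n) (lim-+ (h (+ n)) (h -[1+ n ]))

  -- The window `n` is fixed so that every tail is small uniformly in N; a single N, chosen
  -- afterwards, then compares the finite sums and the totals. The four quarters of ε pay for the
  -- finite sums, the tail, the slack in the tail bound, and L N → L∞.
  tannery : ∀ {T : ℕ → ℤ → Carrier} {T∞ L L∞ C} → (∀ N → Decay (T N) C) →
    (∀ j → (λ N → T N j) ⟶ T∞ j) → (∀ N → HasSum (T N) (L N)) → L ⟶ L∞ → HasSum T∞ L∞
  tannery {T} {T∞} {L} {L∞} {C} dec conv sums L→ ε 0<ε =
    ∀∞-map (λ n small →
        let N , a , b = ∀∞-some (∀∞-zip (λ _ → _,_) (S-lim conv n ε/4 0<ε/4) (L→ ε/4 0<ε/4))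
        in ≡.subst (S T∞ n - L∞ ≼_)
             (solveℚ 1 (λ e → let q = conℚ ½ ⊗ (conℚ ½ ⊗ e) in q ⊕ ((q ⊕ q) ⊕ q) ⊜ e) ≡.refl ε)
             (≼-resp (solve 4 (λ s t l m → (:- (t :- s)) :+ ((t :- l) :+ (l :- m)) := s :- m) refl
                 (S T∞ n) (S (T N) n) (L N) L∞)
               (≼-+ (≼-neg a) (≼-+ (≼-mono (ℚₚ.+-monoˡ-≤ ε/4 small) (S-tail-lim (dec N) (sums N) n ε/4 0<ε/4)) b))))
      (eventually-small {C ℚ.* 3ℚ} (0≤* {C} {3ℚ} (Decay-0≤ (dec 0)) 0≤3) (ℚₚ.<⇒≤ 0<½) ½<1 0<ε/4)
    where
    ε/4 = ½ ℚ.* (½ ℚ.* ε)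
    0<ε/4 = half-pos (half-pos 0<ε)

  HasSum-S : ∀ {F : ℤ → ℤ → Carrier} {L} → (∀ s → HasSum (F s) (L s)) → ∀ N →
    HasSum (λ t → S (λ s → F s t) N) (S L N)
  HasSum-S h zero    = lim-cong (λ n → sym (S-0 n)) refl lim-const
    where
    S-0 : ∀ n → S (λ _ → 0#) n ≈ 0#
    S-0 zero    = refl
    S-0 (suc n) = trans (+-cong (S-0 n) (+-identityˡ 0#)) (+-identityˡ 0#)
  HasSum-S h (suc N) = HasSum-+ (HasSum-S h N) (HasSum-+ (h (+ N)) (h -[1+ N ]))

  -- For s in [-N, N) the numbers 2s and 2s + 1 fill [-2N, 2N) exactly once.
  S-parity : ∀ t N → S (λ s → t (s ℤ.+ s)) N + S (λ s → t (ℤ.suc (s ℤ.+ s))) N ≈ S t (N ℕ.+ N)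
  S-parity t zero    = +-identityˡ 0#
  S-parity t (suc N) = begin
    S (λ s → t (s ℤ.+ s)) (suc N) + S (λ s → t (ℤ.suc (s ℤ.+ s))) (suc N)
      ≈⟨ solve 6 (λ a b c d e f → (a :+ (b :+ c)) :+ (d :+ (e :+ f)) := ((a :+ d) :+ (b :+ f)) :+ (e :+ c)) refl
           _ (t (+ (N ℕ.+ N))) (t -[1+ suc (N ℕ.+ N) ]) _ (t (+ suc (N ℕ.+ N))) (t -[1+ N ℕ.+ N ]) ⟩
    S (λ s → t (s ℤ.+ s)) N + S (λ s → t (ℤ.suc (s ℤ.+ s))) N + _ + _
      ≈⟨ +-congʳ (+-congʳ (S-parity t N)) ⟩
    S t (suc (suc (N ℕ.+ N)))
      ≡⟨ ≡.cong (S t) (≡.sym (≡.cong suc (ℕₚ.+-suc N N))) ⟩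
    S t (suc N ℕ.+ suc N) ∎

  -- Sum over (s, t) of the products α s α t and y δ s δ t: the two families cover the pairs
  -- (n, m) = (s + t, s − t) with n − m even and (s + t + 1, s − t) with n − m odd.
  parity-product : ∀ {α β γ δ : ℤ → Carrier} {y A B g p Cα Cβ Cγ Cδ} →
    Decay α Cα → Decay β Cβ → Decay γ Cγ → Decay δ Cδ →
    (∀ s t → α s * α t ≈ β (s ℤ.+ t) * γ (s ℤ.- t)) →
    (∀ s t → y * (δ s * δ t) ≈ β (ℤ.suc (s ℤ.+ t)) * γ (s ℤ.- t)) →
    HasSum α A → HasSum β g → HasSum γ p → HasSum δ B →
    A * A + y * (B * B) ≈ g * p
  parity-product {α} {β} {γ} {δ} {y} {A} {B} {g} {p} {Cα} {Cβ} {Cγ} {Cδ} dα dβ dγ dδ αα δδ sα sβ sγ sδ =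
    -- Cut s to the window N but sum over the other index in full. Reindexing each row by n = s + t,
    -- or s + t + 1, turns the cut double series into the sum of β n · G N n over n, where G N n →
    -- p. Tannery's theorem then evaluates the sum of β n · p as the left side, while summing it
    -- directly gives g · p.
    lim-unique
      (tannery {T = λ N t → β t * G N t} {L = λ N → S (λ s → α s * A) N + S (λ s → y * δ s * B) N} {C = Cγ ℚ.* 3ℚ ℚ.* Cβ}
        (λ N → decay λ t → ≼-resp (*-comm _ _) (≡.subst (G N t * β t ≼_) (≡.sym (ℚₚ.*-assoc (Cγ ℚ.* 3ℚ) Cβ _))
          (≼-* (S-shifted-bounded dγ (ℤ.- t) (N ℕ.+ N)) (at dβ t))))
        (λ t → lim-* lim-const (lim-double (HasSum-shift dγ sγ (ℤ.- t))))
        (λ N → HasSum-cong (λ t → rows N t) refl (HasSum-+ (HasSum-S even N) (HasSum-S odd N)))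
        (lim-+ (lim-cong (λ N → sym (S-*ʳ α A N)) refl (lim-* sα lim-const))
          (lim-cong (λ N → trans (sym (S-*ˡ y (λ s → δ s * B) N)) (S-cong (λ s → sym (*-assoc y (δ s) B)) N)) refl
             (lim-* lim-const (lim-cong (λ N → sym (S-*ʳ δ B N)) refl (lim-* sδ lim-const))))))
      (HasSum-cong (λ t → *-comm p (β t)) (*-comm p g) (HasSum-*ˡ p sβ))
    where
    G : ℕ → ℤ → Carrier
    G N t = S (λ m → γ (m ℤ.- t)) (N ℕ.+ N)
    S-*ʳ : ∀ u c N → S (λ s → u s * c) N ≈ S u N * c
    S-*ʳ u c N = trans (S-cong (λ s → *-comm (u s) c) N) (trans (S-*ˡ c u N) (*-comm c (S u N)))
    even : ∀ s → HasSum (λ t → β t * γ (s ℤ.+ s ℤ.- t)) (α s * A)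
    even s = HasSum-cong
      (λ t → trans (αα s (t ℤ.+ ℤ.- s)) (*-cong
        (reflexive (≡.cong β (solveℤ 2 (λ s t → s ⊞ (t ⊞ ⊟′ s) ≜ t) ≡.refl s t)))
        (reflexive (≡.cong γ (solveℤ 2 (λ s t → s ⊟ (t ⊞ ⊟′ s) ≜ s ⊞ s ⊟ t) ≡.refl s t)))))
      refl (HasSum-shift (Decay-*ˡ (proj₂ (bounded (α s))) dα) (HasSum-*ˡ (α s) sα) (ℤ.- s))
    odd : ∀ s → HasSum (λ t → β t * γ (ℤ.suc (s ℤ.+ s) ℤ.- t)) (y * δ s * B)
    odd s = HasSum-cong
      (λ t → trans (*-assoc y (δ s) _) (trans (δδ s (t ℤ.+ ℤ.- (ℤ.suc s))) (*-cong
        (reflexive (≡.cong β (solveℤ 2 (λ s t → conℤ (+ 1) ⊞ (s ⊞ (t ⊞ ⊟′ (conℤ (+ 1) ⊞ s))) ≜ t) ≡.refl s t)))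
        (reflexive (≡.cong γ (solveℤ 2 (λ s t → s ⊟ (t ⊞ ⊟′ (conℤ (+ 1) ⊞ s)) ≜ (conℤ (+ 1) ⊞ (s ⊞ s)) ⊟ t) ≡.refl s t))))))
      refl (HasSum-shift (Decay-*ˡ (proj₂ (bounded (y * δ s))) dδ) (HasSum-*ˡ (y * δ s) sδ) (ℤ.- (ℤ.suc s)))
    rows : ∀ N t → S (λ s → β t * γ (s ℤ.+ s ℤ.- t)) N + S (λ s → β t * γ (ℤ.suc (s ℤ.+ s) ℤ.- t)) N ≈ β t * G N t
    rows N t = begin
      S (λ s → β t * γ (s ℤ.+ s ℤ.- t)) N + S (λ s → β t * γ (ℤ.suc (s ℤ.+ s) ℤ.- t)) N
        ≈⟨ +-cong (S-*ˡ (β t) (λ s → γ (s ℤ.+ s ℤ.- t)) N) (S-*ˡ (β t) (λ s → γ (ℤ.suc (s ℤ.+ s) ℤ.- t)) N) ⟩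
      β t * S (λ s → γ (s ℤ.+ s ℤ.- t)) N + β t * S (λ s → γ (ℤ.suc (s ℤ.+ s) ℤ.- t)) N
        ≈⟨ sym (distribˡ (β t) _ _) ⟩
      β t * (S (λ s → γ (s ℤ.+ s ℤ.- t)) N + S (λ s → γ (ℤ.suc (s ℤ.+ s) ℤ.- t)) N)
        ≈⟨ *-congˡ (S-parity (λ m → γ (m ℤ.- t)) N) ⟩
      β t * G N t ∎

-- Boundedness of the products of 1 + C ρⁿ

growth : ℚ → ℚ → ℕ → ℚ
growth C ρ zero    = 1ℚ
growth C ρ (suc n) = growth C ρ n ℚ.* (1ℚ ℚ.+ C ℚ.* ρ ^ʳ n)

module _ {C ρ} (0≤C : 0ℚ ℚ.≤ C) (0≤ρ : 0ℚ ℚ.≤ ρ) (ρ<1 : ρ ℚ.< 1ℚ) where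
  private
    g = growth C ρ

    0≤x : ∀ n → 0ℚ ℚ.≤ C ℚ.* ρ ^ʳ n
    0≤x n = 0≤* 0≤C (0≤^ 0≤ρ n)

    κ = C ℚ.* recip (1ℚ ℚ.- ρ)

    0<1-ρ = p<q⇒0<q-p ρ<1

    0≤κ : 0ℚ ℚ.≤ κ
    0≤κ = 0≤* 0≤C (ℚₚ.<⇒≤ (0<recip 0<1-ρ))

  0≤growth : ∀ n → 0ℚ ℚ.≤ g n
  0≤growth zero    = 0≤1
  0≤growth (suc n) = 0≤* (0≤growth n) (0≤+ 0≤1 (0≤x n))

  growth-mono : ∀ d n → g n ℚ.≤ g (d ℕ.+ n)
  growth-mono zero    n = ℚₚ.≤-refl
  growth-mono (suc d) n = ℚₚ.≤-trans (growth-mono d n) (≤-by (g (d ℕ.+ n) ℚ.* (C ℚ.* ρ ^ʳ (d ℕ.+ n)))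
    (0≤* (0≤growth (d ℕ.+ n)) (0≤x (d ℕ.+ n)))
    (solveℚ 2 (λ g x → g ⊗ (conℚ 1ℚ ⊕ x) ⊜ g ⊕ g ⊗ x) ≡.refl (g (d ℕ.+ n)) (C ℚ.* ρ ^ʳ (d ℕ.+ n))))

  -- With κ = C / (1 − ρ) the weights 1 − κ ρⁿ absorb the factors: (1 − κ ρⁿ)(1 + C ρⁿ) ≤ 1 − κ ρⁿ⁺¹.
  growth-bounded : Σ ℚ λ D → ∀ n → g n ℚ.≤ D
  growth-bounded = 2ℚ ℚ.* g N , bound
    where
    -- From this N on every weight is at least ½, which accounts for the factor 2 in the bound.
    -- Monotonicity carries the bound back to the indices below N.
    small : ∀∞ λ n → κ ℚ.* ρ ^ʳ n ℚ.≤ ½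
    small = eventually-small 0≤κ 0≤ρ ρ<1 0<½
    N = proj₁ small
    weight : ℕ → ℚ
    weight n = 1ℚ ℚ.- κ ℚ.* ρ ^ʳ n
    1-ρ*κ : (1ℚ ℚ.- ρ) ℚ.* κ ≡ C
    1-ρ*κ = ≡.trans (solveℚ 3 (λ a c r → a ⊗ (c ⊗ r) ⊜ c ⊗ (a ⊗ r)) ≡.refl (1ℚ ℚ.- ρ) C (recip (1ℚ ℚ.- ρ)))
      (≡.trans (≡.cong (C ℚ.*_) (recip-inv 0<1-ρ)) (ℚₚ.*-identityʳ C))
    absorb : ∀ n → weight n ℚ.* (1ℚ ℚ.+ C ℚ.* ρ ^ʳ n) ℚ.≤ weight (suc n)
    absorb n = ≤-by (κ ℚ.* u ℚ.* (C ℚ.* u)) (0≤* (0≤* 0≤κ (0≤^ 0≤ρ n)) (0≤x n))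
      (≡.trans (solveℚ 3 (λ k r u → conℚ 1ℚ ⊖ k ⊗ (r ⊗ u)
           ⊜ ((conℚ 1ℚ ⊖ k ⊗ u) ⊗ (conℚ 1ℚ ⊕ ((conℚ 1ℚ ⊖ r) ⊗ k) ⊗ u)) ⊕ k ⊗ u ⊗ (((conℚ 1ℚ ⊖ r) ⊗ k) ⊗ u)) ≡.refl κ ρ u)
        (≡.cong (λ c → weight n ℚ.* (1ℚ ℚ.+ c ℚ.* u) ℚ.+ κ ℚ.* u ℚ.* (c ℚ.* u)) 1-ρ*κ))
      where u = ρ ^ʳ n
    tail : ∀ d → g (d ℕ.+ N) ℚ.≤ 2ℚ ℚ.* g N ℚ.* weight (d ℕ.+ N)
    tail zero    = ≤-by (2ℚ ℚ.* g N ℚ.* (½ ℚ.- x))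
      (0≤* (0≤* (ℚₚ.nonNegative⁻¹ 2ℚ) (0≤growth N)) (p≤q⇒0≤q-p (proj₂ small N ℕₚ.≤-refl)))
      (solveℚ 2 (λ g x → conℚ 2ℚ ⊗ g ⊗ (conℚ 1ℚ ⊖ x) ⊜ g ⊕ conℚ 2ℚ ⊗ g ⊗ (conℚ ½ ⊖ x)) ≡.refl (g N) x)
      where x = κ ℚ.* ρ ^ʳ N
    tail (suc d) = ℚₚ.≤-trans (*-monoʳ (0≤+ 0≤1 (0≤x (d ℕ.+ N))) (tail d))
      (≤ˡ (≡.sym (ℚₚ.*-assoc (2ℚ ℚ.* g N) _ _)) (*-monoˡ (0≤* (ℚₚ.nonNegative⁻¹ 2ℚ) (0≤growth N)) (absorb (d ℕ.+ N))))
    weight≤1 : ∀ n → weight n ℚ.≤ 1ℚ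
    weight≤1 n = ≤-by x (0≤* 0≤κ (0≤^ 0≤ρ n)) (solveℚ 1 (λ x → conℚ 1ℚ ⊜ (conℚ 1ℚ ⊖ x) ⊕ x) ≡.refl x)
      where x = κ ℚ.* ρ ^ʳ n
    bound : ∀ n → g n ℚ.≤ 2ℚ ℚ.* g N
    bound n = ℚₚ.≤-trans
      (≡.subst (λ m → g n ℚ.≤ g m) (ℕₚ.+-comm N n) (growth-mono N n))
      (ℚₚ.≤-trans (tail n) (≤ʳ (ℚₚ.*-identityʳ (2ℚ ℚ.* g N))
        (*-monoˡ (0≤* (ℚₚ.nonNegative⁻¹ 2ℚ) (0≤growth N)) (weight≤1 (n ℕ.+ N)))))

-- Integer powers, q-products and their reciprocals

module Products (A : NormedAlgebra) where
  open NormedAlgebra A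
  open NormedAlgebraProperties A
  open Summation A
  open Relation.Binary.Reasoning.Setoid setoid

  infixr 8 _^_
  _^_ : Carrier → ℕ → Carrier
  x ^ zero  = 1#
  x ^ suc n = x * x ^ n

  ^-cong : ∀ {x y} → x ≈ y → ∀ n → x ^ n ≈ y ^ n
  ^-cong e zero    = refl
  ^-cong e (suc n) = *-cong e (^-cong e n)

  ^-+-* : ∀ x m n → x ^ (m ℕ.+ n) ≈ x ^ m * x ^ n
  ^-+-* x zero    n = sym (*-identityˡ _)
  ^-+-* x (suc m) n = trans (*-congˡ (^-+-* x m n)) (sym (*-assoc x _ _))

  ^-square : ∀ x n → (x * x) ^ n ≈ x ^ n * x ^ n
  ^-square x zero    = sym (*-identityˡ 1#)
  ^-square x (suc n) = trans (*-congˡ (^-square x n))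
    (solve 2 (λ x y → x :* x :* (y :* y) := x :* y :* (x :* y)) refl x (x ^ n))

  ≼-^ : ∀ {x c} → x ≼ c → ∀ n → x ^ n ≼ c ^ʳ n
  ≼-^ h zero    = 1≼1
  ≼-^ h (suc n) = ≼-* h (≼-^ h n)

  -- The inverse is an argument of its own. A sign σ can then serve as its own inverse, and a power
  -- x^m can be paired with x^(-m).
  zpow : Carrier → Carrier → ℤ → Carrier
  zpow x x′ (+ n)    = x ^ n
  zpow x x′ -[1+ n ] = x′ ^ suc n

  module _ {x x′} (x*x′ : x * x′ ≈ 1#) where
    zpow-suc : ∀ i → zpow x x′ (ℤ.suc i) ≈ x * zpow x x′ i
    zpow-suc (+ n)        = refl
    zpow-suc -[1+ zero ]  = trans (sym x*x′) (*-congˡ (sym (*-identityʳ x′)))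
    zpow-suc -[1+ suc n ] = begin
      x′ ^ suc n                ≈⟨ sym (*-identityˡ _) ⟩
      1# * x′ ^ suc n           ≈⟨ *-congʳ (sym x*x′) ⟩
      (x * x′) * x′ ^ suc n     ≈⟨ *-assoc x x′ _ ⟩
      x * (x′ * x′ ^ suc n)     ∎

    unit-cancel : ∀ {y z} → x * y ≈ x * z → y ≈ z
    unit-cancel {y} {z} e = begin
      y             ≈⟨ lem y ⟩
      x′ * (x * y)  ≈⟨ *-congˡ e ⟩
      x′ * (x * z)  ≈⟨ sym (lem z) ⟩
      z             ∎
      where
      lem : ∀ w → w ≈ x′ * (x * w)
      lem w = trans (sym (*-identityˡ w)) (trans (*-congʳ (sym x*x′))
        (solve 3 (λ x y w → x :* y :* w := y :* (x :* w)) refl x x′ w))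

  -- Invertible ratios propagate agreement at 0 in both directions. The exponent laws and the closed
  -- form of the theta terms are proved this way, without separate cases for negative indices.
  recurrence-unique : ∀ {g h ρ ρ′ : ℤ → Carrier} → (∀ i → ρ i * ρ′ i ≈ 1#) →
    (∀ i → g (ℤ.suc i) ≈ ρ i * g i) → (∀ i → h (ℤ.suc i) ≈ ρ i * h i) →
    g (+ 0) ≈ h (+ 0) → ∀ i → g i ≈ h i
  recurrence-unique {g} {h} unit gs hs e = ℤ-induction (λ i → g i ≈ h i) e
    (λ i e → trans (gs i) (trans (*-congˡ e) (sym (hs i))))
    (λ i e → unit-cancel (unit i) (trans (sym (gs i)) (trans e (hs i))))

  zpow-+ : ∀ {x x′} → x * x′ ≈ 1# → ∀ i j → zpow x x′ (i ℤ.+ j) ≈ zpow x x′ i * zpow x x′ j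
  zpow-+ {x} {x′} u i j = recurrence-unique {ρ = λ _ → x} (λ _ → u)
    (λ i → trans (reflexive (≡.cong (zpow x x′) (ℤₚ.+-assoc (+ 1) i j))) (zpow-suc u (i ℤ.+ j)))
    (λ i → trans (*-congʳ (zpow-suc u i)) (*-assoc x _ _))
    (trans (reflexive (≡.cong (zpow x x′) (ℤₚ.+-identityˡ j))) (sym (*-identityˡ _)))
    i

  zpow-inverse : ∀ {x x′} → x * x′ ≈ 1# → ∀ i → zpow x x′ i * zpow x x′ (ℤ.- i) ≈ 1#
  zpow-inverse {x} {x′} u i = trans (sym (zpow-+ u i (ℤ.- i))) (reflexive (≡.cong (zpow x x′) (ℤₚ.+-inverseʳ i)))

  zpow-zpow : ∀ {x x′} → x * x′ ≈ 1# → ∀ m n →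
    zpow (zpow x x′ m) (zpow x x′ (ℤ.- m)) n ≈ zpow x x′ (m ℤ.* n)
  zpow-zpow {x} {x′} u m = recurrence-unique {ρ = λ _ → zpow x x′ m} (λ _ → zpow-inverse u m)
    (zpow-suc (zpow-inverse u m))
    (λ n → trans (reflexive (≡.cong (zpow x x′) (ℤₚ.*-suc m n))) (zpow-+ u m (m ℤ.* n)))
    (reflexive (≡.cong (zpow x x′) (≡.sym (ℤₚ.*-zeroʳ m))))

  qProduct : Carrier → Carrier → ℕ → Carrier
  qProduct l q zero    = 1#
  qProduct l q (suc n) = qProduct l q n * (1# - l * q ^ n)

  qProduct-cong : ∀ {l l′ q q′} → l ≈ l′ → q ≈ q′ → ∀ n → qProduct l q n ≈ qProduct l′ q′ n
  qProduct-cong e e′ zero    = refl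
  qProduct-cong e e′ (suc n) = *-cong (qProduct-cong e e′ n) (+-congˡ (-‿cong (*-cong e (^-cong e′ n))))

  qProduct-double : ∀ l q n → qProduct l q (n ℕ.+ n) ≈ qProduct l (q * q) n * qProduct (l * q) (q * q) n
  qProduct-double l q zero    = sym (*-identityˡ 1#)
  qProduct-double l q (suc n) = begin
    qProduct l q (suc n ℕ.+ suc n)
      ≡⟨ ≡.cong (λ m → qProduct l q (suc m)) (ℕₚ.+-suc n n) ⟩
    qProduct l q (n ℕ.+ n) * (1# - l * q ^ (n ℕ.+ n)) * (1# - l * (q * q ^ (n ℕ.+ n)))
      ≈⟨ *-cong (*-cong (qProduct-double l q n) (+-congˡ (-‿cong (*-congˡ w))))
                (+-congˡ (-‿cong (trans (*-congˡ (*-congˡ w)) (sym (*-assoc l q _))))) ⟩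
    qProduct l (q * q) n * qProduct (l * q) (q * q) n * (1# - l * (q * q) ^ n) * (1# - l * q * (q * q) ^ n)
      ≈⟨ solve 4 (λ a b c d → a :* b :* c :* d := a :* c :* (b :* d)) refl _ _ _ _ ⟩
    qProduct l (q * q) (suc n) * qProduct (l * q) (q * q) (suc n) ∎
    where
    w : q ^ (n ℕ.+ n) ≈ (q * q) ^ n
    w = trans (^-+-* q n n) (sym (^-square q n))

  qProduct-± : ∀ l q n → qProduct l q n * qProduct (- l) q n ≈ qProduct (l * l) (q * q) n
  qProduct-± l q zero    = *-identityˡ 1#
  qProduct-± l q (suc n) = begin
    qProduct l q n * (1# - l * q ^ n) * (qProduct (- l) q n * (1# - - l * q ^ n))
      ≈⟨ solve 4 (λ a b l w → a :* (one :- l :* w) :* (b :* (one :- (:- l) :* w)) := a :* b :* (one :- l :* l :* (w :* w)))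
           refl (qProduct l q n) (qProduct (- l) q n) l (q ^ n) ⟩
    qProduct l q n * qProduct (- l) q n * (1# - l * l * (q ^ n * q ^ n))
      ≈⟨ *-cong (qProduct-± l q n) (+-congˡ (-‿cong (*-congˡ (sym (^-square q n))))) ⟩
    qProduct (l * l) (q * q) (suc n) ∎

  -- `r m` is 1/(q; q)_m, determined by a recurrence without division. The bounds `D` and `G`,
  -- uniform in m, dominate the Gaussian binomials.
  record BoundedInverse (q : Carrier) : Set where
    field
      r     : ℕ → Carrier
      r-0   : r 0 ≈ 1#
      r-suc : ∀ m → r m ≈ (1# - q * q ^ m) * r (suc m)
      D     : ℚ
      r≼D   : ∀ m → r m ≼ D
      G     : ℚ
      p≼G   : ∀ m → qProduct q q m ≼ G

    r*p : ∀ m → r m * qProduct q q m ≈ 1#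
    r*p zero    = trans (*-identityʳ _) r-0
    r*p (suc m) = trans (solve 3 (λ r p x → r :* (p :* x) := x :* r :* p) refl (r (suc m)) _ _)
      (trans (*-congʳ (sym (r-suc m))) (r*p m))

  boundedInverse : ∀ {q ρ} → q ≼ ρ → ρ ℚ.< 1ℚ → BoundedInverse q
  boundedInverse {q} {ρ} q≼ρ ρ<1 = record
    { r     = r
    ; r-0   = refl
    ; r-suc = λ m → trans (sym (*-identityʳ (r m))) (trans (*-congˡ (sym (proj₁ (proj₂ (inv m)))))
        (solve 3 (λ r x i → r :* (x :* i) := x :* (r :* i)) refl (r m) (1# - q * q ^ m) (proj₁ (inv m))))
    ; D     = proj₁ (growth-bounded 0≤K 0≤ρ ρ<1)
    ; r≼D   = λ m → ≼-mono (proj₂ (growth-bounded 0≤K 0≤ρ ρ<1) m) (r≼ m)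
    ; G     = proj₁ (growth-bounded 0≤1 0≤ρ ρ<1)
    ; p≼G   = λ m → ≼-mono (proj₂ (growth-bounded 0≤1 0≤ρ ρ<1) m) (p≼ m)
    }
    where
    0≤ρ = ≼⇒0≤ q≼ρ
    x : ℕ → ℚ
    x m = ρ ℚ.* ρ ^ʳ m
    0≤x : ∀ m → 0ℚ ℚ.≤ x m
    0≤x m = 0≤* 0≤ρ (0≤^ 0≤ρ m)
    x≤ρ : ∀ m → x m ℚ.≤ ρ
    x≤ρ m = ≤ʳ (ℚₚ.*-identityʳ ρ) (*-monoˡ 0≤ρ (^≤1 0≤ρ (ℚₚ.<⇒≤ ρ<1) m))
    x≤ : ∀ m → x m ℚ.≤ ρ ^ʳ m
    x≤ m = ≤ʳ (ℚₚ.*-identityˡ (ρ ^ʳ m)) (*-monoʳ (0≤^ 0≤ρ m) (ℚₚ.<⇒≤ ρ<1))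
    x<1 : ∀ m → x m ℚ.< 1ℚ
    x<1 m = ℚₚ.≤-<-trans (x≤ρ m) ρ<1
    inv : ∀ m → Σ Carrier λ w → ((1# - q * q ^ m) * w ≈ 1#) × w ≼ recip (1ℚ ℚ.- x m)
    inv m = 1-z-inverse (≼-* q≼ρ (≼-^ q≼ρ m)) (x<1 m)
    r : ℕ → Carrier
    r zero    = 1#
    r (suc m) = r m * proj₁ (inv m)
    K = recip (1ℚ ℚ.- ρ)
    0≤K : 0ℚ ℚ.≤ K
    0≤K = ℚₚ.<⇒≤ (0<recip (p<q⇒0<q-p ρ<1))
    -- 1/(1 - x) = 1 + x/(1 - x) with x = ρ^(m+1) ≤ ρ^m and 1/(1 - x) ≤ K, so the reciprocals obey a
    -- `growth` bound with constant K.
    recip≤ : ∀ m → recip (1ℚ ℚ.- x m) ℚ.≤ 1ℚ ℚ.+ K ℚ.* ρ ^ʳ m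
    recip≤ m = ≤ˡ expand (ℚₚ.+-monoʳ-≤ 1ℚ (*-mono
        (ℚₚ.<⇒≤ (0<recip (p<q⇒0<q-p (x<1 m))))
        (recip-anti (p<q⇒0<q-p ρ<1) (ℚₚ.+-monoʳ-≤ 1ℚ (ℚₚ.neg-antimono-≤ (x≤ρ m))))
        (0≤x m) (x≤ m)))
      where
      y = recip (1ℚ ℚ.- x m)
      expand : 1ℚ ℚ.+ y ℚ.* x m ≡ y
      expand = ≡.trans (≡.cong (ℚ._+ y ℚ.* x m) (≡.sym (recip-inv (p<q⇒0<q-p (x<1 m)))))
        (solveℚ 2 (λ x y → (conℚ 1ℚ ⊖ x) ⊗ y ⊕ y ⊗ x ⊜ y) ≡.refl (x m) y)
    r≼ : ∀ m → r m ≼ growth K ρ m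
    r≼ zero    = 1≼1
    r≼ (suc m) = ≼-* (r≼ m) (≼-mono (recip≤ m) (proj₂ (proj₂ (inv m))))
    p≼ : ∀ m → qProduct q q m ≼ growth 1ℚ ρ m
    p≼ zero    = 1≼1
    p≼ (suc m) = ≼-* (p≼ m) (≼-mono (ℚₚ.+-monoʳ-≤ 1ℚ (≤ʳ (≡.sym (ℚₚ.*-identityˡ (ρ ^ʳ m))) (x≤ m)))
      (≼-- 1≼1 (≼-* q≼ρ (≼-^ q≼ρ m))))

  lim-unsuc : ∀ {s L} → (λ n → s (suc n)) ⟶ L → s ⟶ L
  lim-unsuc {s} {L} h ε 0<ε =
    let N , hN = h ε 0<ε
    in suc N , λ { (suc n) (s≤s le) → hN n le }

  module _ {q E} (inverse : BoundedInverse q) (p→E : qProduct q q ⟶ E) where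
    open BoundedInverse inverse

    -- E · r m - 1 = r m · (E - (q; q)_m) is a bounded factor times a null sequence, so neither
    -- invertibility of E nor convergence of r is presupposed.
    E*r→1 : (λ m → E * r m) ⟶ 1#
    E*r→1 = lim-cong
      (λ m → trans (+-congˡ (sym (r*p m)))
        (solve 3 (λ r e p → r :* (e :- p) :+ r :* p := e :* r) refl (r m) E (qProduct q q m)))
      (+-identityˡ 1#)
      (lim-+ (lim-bounded-* r≼D (lim-cong (λ m → refl) (-‿inverseʳ E) (lim-+ lim-const (lim-neg p→E)))) lim-const)

    -- Multiply by `r m` and let m grow: the factor E · r m tends to 1.
    qProduct-limit-cancel : ∀ {x y} → E * x ≈ E * y → x ≈ y
    qProduct-limit-cancel {x} {y} e = begin
      x       ≈⟨ sym (*-identityˡ x) ⟩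
      1# * x  ≈⟨ lim-unique (lim-* E*r→1 lim-const) (lim-cong swap refl (lim-* E*r→1 lim-const)) ⟩
      1# * y  ≈⟨ *-identityˡ y ⟩
      y       ∎
      where
      rotate : ∀ m z → E * r m * z ≈ r m * (E * z)
      rotate m z = solve 3 (λ e r z → e :* r :* z := r :* (e :* z)) refl E (r m) z
      swap : ∀ m → E * r m * y ≈ E * r m * x
      swap m = trans (rotate m y) (trans (*-congˡ (sym e)) (sym (rotate m x)))

    -- An approximate inverse of E. Any error bound below 1 would do, because 1 - z is then bounded
    -- away from 0 and so is its divisor E.
    qProduct-limit-near-unit : Σ Carrier λ r → Σ Carrier λ z → z ≼ ½ × E * r ≈ 1# - z
    qProduct-limit-near-unit =
      let m , close = ∀∞-some (E*r→1 ½ 0<½)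
      in r m , - (E * r m - 1#) , ≼-neg close , 1+[x-1]≈x (E * r m)

-- Jacobi's triple product from a finite identity

module ThetaIdentities (A : NormedAlgebra) where
  open NormedAlgebra A
  open NormedAlgebraProperties A
  open Summation A
  open Products A
  open Relation.Binary.Reasoning.Setoid setoid

  -- The theta terms enter the finite identity only through their value at 0 and a first-order
  -- recurrence, which expresses t (k - 1) and t (k + 1) through t k.
  module TripleProduct
    {a b q q′ : Carrier} (q≈ab : q ≈ a * b) (q*q′ : q * q′ ≈ 1#) (inverse : BoundedInverse q)
    {t : ℤ → Carrier} (t-0 : t (+ 0) ≈ 1#)
    (t-suc : ∀ k → t (ℤ.suc k) ≈ a * zpow q q′ k * t k)
    {C} (dt : Decay t C)
    where
    open BoundedInverse inverse

    private
      Q : ℤ → Carrier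
      Q = zpow q q′

      p : ℕ → Carrier
      p = qProduct q q

    -- 1 / (q; q)_m, which vanishes for negative m.
    R : ℤ → Carrier
    R (+ m)    = r m
    R -[1+ m ] = 0#

    R-suc : ∀ i → R i ≈ (1# - Q (ℤ.suc i)) * R (ℤ.suc i)
    R-suc (+ m)        = r-suc m
    -- At -1 the factor 1 - q⁰ vanishes, so extending 1/(q; q)_m by zero respects the recurrence.
    R-suc -[1+ zero ]  = sym (trans (*-congʳ (-‿inverseʳ 1#)) (zeroˡ (r 0)))
    R-suc -[1+ suc m ] = sym (zeroʳ _)

    R-step : ∀ i → R i ≈ (1# - q * Q i) * R (ℤ.suc i)
    R-step i = trans (R-suc i) (*-congʳ (+-congˡ (-‿cong (zpow-suc q*q′ i))))

    R≼D : ∀ i → R i ≼ D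
    R≼D (+ m)    = r≼D m
    R≼D -[1+ m ] = ≼-pos (≼⇒0≤ (r≼D 0)) refl

    -- The Gaussian binomial coefficient [2n; n + k].
    coeff : ℕ → ℤ → Carrier
    coeff n k = p (n ℕ.+ n) * R (+ n ℤ.+ k) * R (+ n ℤ.- k)

    term : ℕ → ℤ → Carrier
    term n k = coeff n k * t k

    term-decay : ∀ n → Decay (term n) (G ℚ.* D ℚ.* D ℚ.* C)
    term-decay n = decay λ k → ≡.subst (term n k ≼_) (≡.sym (ℚₚ.*-assoc (G ℚ.* D ℚ.* D) C _))
      (≼-* (≼-* (≼-* (p≼G (n ℕ.+ n)) (R≼D (+ n ℤ.+ k))) (R≼D (+ n ℤ.- k))) (Decay.at dt k))

    private
      q²ⁿ : ∀ n k → Q (+ n ℤ.+ k) * Q (+ n ℤ.- k) ≈ q ^ (n ℕ.+ n)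
      q²ⁿ n k = trans (sym (zpow-+ q*q′ (+ n ℤ.+ k) (+ n ℤ.- k)))
        (reflexive (≡.cong Q (solveℤ 2 (λ n k → (n ⊞ k) ⊞ (n ⊟ k) ≜ n ⊞ n) ≡.refl (+ n) k)))

      -- Two steps of the q-Pascal rule at once, with denominators cleared: P = (q; q)_2n, x =
      -- q^(n+k), y = q^(n-k), w is the theta term, and u, v are the values of `R` at n + k + 1 and
      -- n - k + 1.
      pascal : ∀ P q x y u v w →
        P * (1# - q * (x * y)) * (1# - q * (q * (x * y))) * u * v * w ≈
        (1# + q * (x * y)) * (P * ((1# - q * x) * u) * ((1# - q * y) * v) * w)
          + (P * ((1# - x) * ((1# - q * x) * u)) * v * (q * y * w)
             + P * u * ((1# - y) * ((1# - q * y) * v)) * (q * x * w))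
      pascal = solve 7 (λ P q x y u v w →
        P :* (one :- q :* (x :* y)) :* (one :- q :* (q :* (x :* y))) :* u :* v :* w :=
        (one :+ q :* (x :* y)) :* (P :* ((one :- q :* x) :* u) :* ((one :- q :* y) :* v) :* w)
          :+ (P :* ((one :- x) :* ((one :- q :* x) :* u)) :* v :* (q :* y :* w)
             :+ P :* u :* ((one :- y) :* ((one :- q :* y) :* v)) :* (q :* x :* w))) refl

    -- Mirrors the next two factors of the finite product: since q = ab, (1 + a qⁿ)(1 + b qⁿ) = 1 +
    -- q^(2n+1) + a qⁿ + b qⁿ, and the last two summands move k by one.
    term-suc : ∀ n k → term (suc n) k ≈
      (1# + q * q ^ (n ℕ.+ n)) * term n k + (a * q ^ n * term n (ℤ.pred k) + b * q ^ n * term n (ℤ.suc k))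
    term-suc n k = begin
      term (suc n) k
        ≈⟨ *-congʳ (*-cong (*-cong (trans (reflexive (≡.cong (λ m → p (suc m)) (ℕₚ.+-suc n n)))
             (*-cong (*-congˡ (+-congˡ (-‿cong (*-congˡ (sym z))))) (+-congˡ (-‿cong (*-congˡ (*-congˡ (sym z)))))))
             (reflexive (≡.cong R (ℤₚ.+-assoc (+ 1) (+ n) k)))) (reflexive (≡.cong R (ℤₚ.+-assoc (+ 1) (+ n) (ℤ.- k))))) ⟩
      p (n ℕ.+ n) * (1# - q * (x * y)) * (1# - q * (q * (x * y))) * u * v * t k
        ≈⟨ pascal (p (n ℕ.+ n)) q x y u v (t k) ⟩
      (1# + q * (x * y)) * (P * ((1# - q * x) * u) * ((1# - q * y) * v) * t k)
        + (P * ((1# - x) * ((1# - q * x) * u)) * v * (q * y * t k)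
           + P * u * ((1# - y) * ((1# - q * y) * v)) * (q * x * t k))
        ≈⟨ +-cong (*-cong (+-congˡ (*-congˡ z)) (*-congʳ (*-cong (*-congˡ (sym Rx)) (sym Ry))))
             (+-cong (*-cong (*-cong (*-congˡ (sym Rx⁻)) (sym Ry⁺)) t⁻) (*-cong (*-cong (*-congˡ (sym Rx⁺)) (sym Ry⁻)) t⁺)) ⟩
      (1# + q * q ^ (n ℕ.+ n)) * term n k
        + (coeff n (ℤ.pred k) * (a * q ^ n * t (ℤ.pred k)) + coeff n (ℤ.suc k) * (b * q ^ n * t (ℤ.suc k)))
        ≈⟨ +-congˡ (+-cong (swap _ _ _) (swap _ _ _)) ⟩
      (1# + q * q ^ (n ℕ.+ n)) * term n k + (a * q ^ n * term n (ℤ.pred k) + b * q ^ n * term n (ℤ.suc k)) ∎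
      where
      P = p (n ℕ.+ n)
      x = Q (+ n ℤ.+ k)
      y = Q (+ n ℤ.- k)
      u = R (ℤ.suc (+ n ℤ.+ k))
      v = R (ℤ.suc (+ n ℤ.- k))
      z : x * y ≈ q ^ (n ℕ.+ n)
      z = q²ⁿ n k
      swap : ∀ c e t → c * (e * t) ≈ e * (c * t)
      swap = solve 3 (λ c e t → c :* (e :* t) := e :* (c :* t)) refl
      Rx : R (+ n ℤ.+ k) ≈ (1# - q * x) * u
      Rx = R-step (+ n ℤ.+ k)
      Ry : R (+ n ℤ.- k) ≈ (1# - q * y) * v
      Ry = R-step (+ n ℤ.- k)
      Rx⁻ : R (+ n ℤ.+ ℤ.pred k) ≈ (1# - x) * ((1# - q * x) * u)
      Rx⁻ = trans (R-suc (+ n ℤ.+ ℤ.pred k)) (*-cong (+-congˡ (-‿cong (reflexive (≡.cong Q e))))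
        (trans (reflexive (≡.cong R e)) Rx))
        where
        e : ℤ.suc (+ n ℤ.+ ℤ.pred k) ≡ + n ℤ.+ k
        e = solveℤ 2 (λ n k → conℤ (+ 1) ⊞ (n ⊞ (conℤ (ℤ.- (+ 1)) ⊞ k)) ≜ n ⊞ k) ≡.refl (+ n) k
      Ry⁻ : R (+ n ℤ.- ℤ.suc k) ≈ (1# - y) * ((1# - q * y) * v)
      Ry⁻ = trans (R-suc (+ n ℤ.- ℤ.suc k)) (*-cong (+-congˡ (-‿cong (reflexive (≡.cong Q e))))
        (trans (reflexive (≡.cong R e)) Ry))
        where
        e : ℤ.suc (+ n ℤ.- ℤ.suc k) ≡ + n ℤ.- k
        e = solveℤ 2 (λ n k → conℤ (+ 1) ⊞ (n ⊟ (conℤ (+ 1) ⊞ k)) ≜ n ⊟ k) ≡.refl (+ n) k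
      Rx⁺ : R (+ n ℤ.+ ℤ.suc k) ≈ u
      Rx⁺ = reflexive (≡.cong R (solveℤ 2 (λ n k → n ⊞ (conℤ (+ 1) ⊞ k) ≜ conℤ (+ 1) ⊞ (n ⊞ k)) ≡.refl (+ n) k))
      Ry⁺ : R (+ n ℤ.- ℤ.pred k) ≈ v
      Ry⁺ = reflexive (≡.cong R (solveℤ 2 (λ n k → n ⊟ (conℤ (ℤ.- (+ 1)) ⊞ k) ≜ conℤ (+ 1) ⊞ (n ⊟ k)) ≡.refl (+ n) k))
      t⁻ : q * y * t k ≈ a * q ^ n * t (ℤ.pred k)
      t⁻ = begin
        q * y * t k
          ≈⟨ *-cong (sym (zpow-suc q*q′ (+ n ℤ.- k)))
               (trans (reflexive (≡.cong t (≡.sym (ℤₚ.suc-pred k)))) (t-suc (ℤ.pred k))) ⟩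
        Q (ℤ.suc (+ n ℤ.- k)) * (a * Q (ℤ.pred k) * t (ℤ.pred k))
          ≈⟨ solve 4 (λ y a x t → y :* (a :* x :* t) := a :* (y :* x) :* t) refl _ a _ _ ⟩
        a * (Q (ℤ.suc (+ n ℤ.- k)) * Q (ℤ.pred k)) * t (ℤ.pred k)
          ≈⟨ *-congʳ (*-congˡ (trans (sym (zpow-+ q*q′ (ℤ.suc (+ n ℤ.- k)) (ℤ.pred k))) (reflexive (≡.cong Q
               (solveℤ 2 (λ n k → (conℤ (+ 1) ⊞ (n ⊟ k)) ⊞ (conℤ (ℤ.- (+ 1)) ⊞ k) ≜ n) ≡.refl (+ n) k))))) ⟩
        a * q ^ n * t (ℤ.pred k) ∎
      t⁺ : q * x * t k ≈ b * q ^ n * t (ℤ.suc k)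
      t⁺ = begin
        q * x * t k
          ≈⟨ *-congʳ (*-cong q≈ab (zpow-+ q*q′ (+ n) k)) ⟩
        a * b * (q ^ n * Q k) * t k
          ≈⟨ solve 5 (λ a b w x t → a :* b :* (w :* x) :* t := b :* w :* (a :* x :* t)) refl a b (q ^ n) (Q k) (t k) ⟩
        b * q ^ n * (a * Q k * t k)
          ≈⟨ *-congˡ (sym (t-suc k)) ⟩
        b * q ^ n * t (ℤ.suc k) ∎

    HasSum-term : ∀ n → HasSum (term n) (qProduct (- a) q n * qProduct (- b) q n)
    -- The empty window gives 0; from N = 1 on the sum is constantly 1, because `R` kills every term
    -- except k = 0.
    HasSum-term zero = lim-unsuc (lim-cong (λ N → sym (S-0 N)) (sym (*-identityˡ 1#)) lim-const)
      where
      term⁺ : ∀ m → term 0 (+ suc m) ≈ 0#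
      term⁺ m = trans (*-congʳ (zeroʳ _)) (zeroˡ _)
      term⁻ : ∀ m → term 0 -[1+ m ] ≈ 0#
      term⁻ m = trans (*-congʳ (trans (*-congʳ (zeroʳ _)) (zeroˡ _))) (zeroˡ _)
      term⁰ : term 0 (+ 0) ≈ 1#
      term⁰ = trans (*-cong (trans (*-cong (trans (*-identityˡ _) r-0) r-0) (*-identityˡ 1#)) t-0) (*-identityˡ 1#)
      S-0 : ∀ N → S (term 0) (suc N) ≈ 1#
      S-0 zero    = trans (+-identityˡ _) (trans (+-cong term⁰ (term⁻ 0)) (+-identityʳ 1#))
      S-0 (suc N) = trans (+-cong (S-0 N) (trans (+-cong (term⁺ N) (term⁻ (suc N))) (+-identityˡ 0#))) (+-identityʳ 1#)
    HasSum-term (suc n) = HasSum-cong (λ k → sym (term-suc n k)) total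
      (HasSum-+ (HasSum-*ˡ (1# + q * q ^ (n ℕ.+ n)) IH)
        (HasSum-+ (HasSum-*ˡ (a * q ^ n) (HasSum-pred (term-decay n) IH))
          (HasSum-*ˡ (b * q ^ n) (HasSum-suc (term-decay n) IH))))
      where
      IH = HasSum-term n
      α = qProduct (- a) q n
      β = qProduct (- b) q n
      total : (1# + q * q ^ (n ℕ.+ n)) * (α * β) + (a * q ^ n * (α * β) + b * q ^ n * (α * β))
            ≈ α * (1# - - a * q ^ n) * (β * (1# - - b * q ^ n))
      total = trans (+-congʳ (*-congʳ (+-congˡ (*-cong q≈ab (^-+-* q n n)))))
        (solve 5 (λ α β a b w →
          (one :+ a :* b :* (w :* w)) :* (α :* β) :+ (a :* w :* (α :* β) :+ b :* w :* (α :* β))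
          := α :* (one :- (:- a) :* w) :* (β :* (one :- (:- b) :* w))) refl α β a b (q ^ n))

    module _ {E} (p→E : p ⟶ E) where
      E*R→1 : ∀ k → (λ n → E * R (+ n ℤ.+ k)) ⟶ 1#
      E*R→1 = ℤ-induction (λ k → (λ n → E * R (+ n ℤ.+ k)) ⟶ 1#)
        (lim-cong (λ n → *-congˡ (reflexive (≡.cong R (≡.sym (ℤₚ.+-identityʳ (+ n)))))) refl (E*r→1 inverse p→E))
        (λ k h → lim-cong (λ n → shift k n) refl
          (lim-subsequence {s = λ n → E * R (+ n ℤ.+ k)} suc (λ N → N , λ n le → ℕₚ.m≤n⇒m≤1+n le) h))
        (λ k h → lim-unsuc (lim-cong (λ n → sym (shift k n)) refl h))
        where
        shift : ∀ k n → E * R (+ suc n ℤ.+ k) ≈ E * R (+ n ℤ.+ ℤ.suc k)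
        shift k n = *-congˡ (reflexive (≡.cong R
          (solveℤ 2 (λ n k → (conℤ (+ 1) ⊞ n) ⊞ k ≜ n ⊞ (conℤ (+ 1) ⊞ k)) ≡.refl (+ n) k)))

      -- The factor E² makes the coefficients converge without division: one E goes to each
      -- reciprocal, and E² · `term n k` → E · t k. The limit is E · F = E² · PA · PB, from which
      -- one E is cancelled.
      triple-product : ∀ {PA PB F} → qProduct (- a) q ⟶ PA → qProduct (- b) q ⟶ PB → HasSum t F →
        F ≈ PA * PB * E
      triple-product {PA} {PB} {F} A→ B→ sum = qProduct-limit-cancel inverse p→E (trans
        (lim-unique (HasSum-*ˡ E sum)
          (tannery {T = λ n k → E * E * term n k}
            (λ n → Decay-*ˡ (≼-* (proj₂ (bounded E)) (proj₂ (bounded E))) (term-decay n))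
            (λ k → lim-cong (λ n → regroup n k) (*-congʳ (trans (*-identityʳ _) (*-identityʳ E)))
              (lim-* (lim-* (lim-* (lim-double p→E) (E*R→1 k)) (E*R→1 (ℤ.- k))) lim-const))
            (λ n → HasSum-*ˡ (E * E) (HasSum-term n))
            (lim-* lim-const (lim-* A→ B→))))
        (solve 3 (λ e a b → e :* e :* (a :* b) := e :* (a :* b :* e)) refl E PA PB))
        where
        regroup : ∀ n k → p (n ℕ.+ n) * (E * R (+ n ℤ.+ k)) * (E * R (+ n ℤ.- k)) * t k ≈ E * E * term n k
        regroup n k = solve 5 (λ e p u v t → p :* (e :* u) :* (e :* v) :* t := e :* e :* (p :* u :* v :* t)) refl
          E (p (n ℕ.+ n)) (R (+ n ℤ.+ k)) (R (+ n ℤ.- k)) (t k)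

-- Theta terms with quadratic exponents and the square identity

quadratic : ℤ → ℤ → ℤ → ℤ
quadratic h g k = h ℤ.* (k ℤ.* k) ℤ.+ g ℤ.* k

module GaussianForms (A : NormedAlgebra) where
  open NormedAlgebra A
  open NormedAlgebraProperties A
  open Summation A
  open Products A
  open ThetaIdentities A
  open Relation.Binary.Reasoning.Setoid setoid

  ^-inverse : ∀ {x y} → x * y ≈ 1# → ∀ n → x ^ n * y ^ n ≈ 1#
  ^-inverse e zero    = *-identityˡ 1#
  ^-inverse {x} {y} e (suc n) = trans
    (solve 4 (λ x a y b → x :* a :* (y :* b) := x :* y :* (a :* b)) refl x (x ^ n) y (y ^ n))
    (trans (*-cong e (^-inverse e n)) (*-identityˡ 1#))

  -- The two directions have separate recurrences, so no inverse of ab is involved and the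
  -- triangular exponents disappear. `theta-suc` merges them once an inverse is available.
  record IsTheta (a b : Carrier) (t : ℤ → Carrier) : Set where
    field
      at-0   : t (+ 0) ≈ 1#
      at-suc : ∀ n → t (+ suc n) ≈ a * (a * b) ^ n * t (+ n)
      at-neg : ∀ n → t -[1+ n ] ≈ b * (a * b) ^ n * t (ℤ.- (+ n))

  theta-from-terms : ∀ {a b t} → (∀ n → t (+ n) ≈ a ^ T (suc n) * b ^ T n) →
    (∀ n → t (ℤ.- (+ n)) ≈ a ^ T n * b ^ T (suc n)) → IsTheta a b t
  theta-from-terms {a} {b} {t} pos neg = record
    { at-0   = trans (pos 0) (*-identityˡ 1#)
    ; at-suc = λ n → trans (pos (suc n)) (trans (*-cong (*-congˡ (^-+-* a n (T (suc n)))) (^-+-* b n (T n)))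
        (trans (solve 5 (λ a x p y r → a :* (x :* p) :* (y :* r) := a :* (x :* y) :* (p :* r)) refl
            a (a ^ n) (a ^ T (suc n)) (b ^ n) (b ^ T n))
          (*-cong (*-congˡ (sym (^-distrib n))) (sym (pos n)))))
    ; at-neg = λ n → trans (neg (suc n)) (trans (*-cong (^-+-* a n (T n)) (*-congˡ (^-+-* b n (T (suc n)))))
        (trans (solve 5 (λ b x p y r → x :* p :* (b :* (y :* r)) := b :* (x :* y) :* (p :* r)) refl
            b (a ^ n) (a ^ T n) (b ^ n) (b ^ T (suc n)))
          (*-cong (*-congˡ (sym (^-distrib n))) (sym (neg n)))))
    }
    where
    ^-distrib : ∀ n → (a * b) ^ n ≈ a ^ n * b ^ n
    ^-distrib zero    = sym (*-identityˡ 1#)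
    ^-distrib (suc n) = trans (*-congˡ (^-distrib n))
      (solve 4 (λ a b x y → a :* b :* (x :* y) := a :* x :* (b :* y)) refl a b (a ^ n) (b ^ n))

  module _ {a b t} (θ : IsTheta a b t) {q q′} (q≈ab : q ≈ a * b) (q*q′ : q * q′ ≈ 1#) where
    open IsTheta θ

    theta-suc : ∀ k → t (ℤ.suc k) ≈ a * zpow q q′ k * t k
    theta-suc (+ n)    = trans (at-suc n) (*-congʳ (*-congˡ (^-cong (sym q≈ab) n)))
    theta-suc -[1+ n ] = sym (begin
      a * q′ ^ suc n * t -[1+ n ]
        ≈⟨ *-congˡ (trans (at-neg n) (*-congʳ (*-congˡ (^-cong (sym q≈ab) n)))) ⟩
      a * (q′ * q′ ^ n) * (b * q ^ n * t (ℤ.- (+ n)))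
        ≈⟨ solve 6 (λ a b q′ x y t → a :* (q′ :* x) :* (b :* y :* t) := a :* b :* q′ :* (y :* x) :* t) refl
             a b q′ (q′ ^ n) (q ^ n) _ ⟩
      a * b * q′ * (q ^ n * q′ ^ n) * t (ℤ.- (+ n))
        ≈⟨ *-congʳ (*-cong (trans (*-congʳ (sym q≈ab)) q*q′) (^-inverse q*q′ n)) ⟩
      1# * 1# * t (ℤ.- (+ n))
        ≈⟨ trans (*-congʳ (*-identityˡ 1#)) (*-identityˡ _) ⟩
      t (ℤ.- (+ n))
        ≡⟨ ≡.cong t (≡.sym (suc-[1+] n)) ⟩
      t (ℤ.suc -[1+ n ]) ∎)

  sign : Carrier → ℤ → Carrier
  sign σ = zpow σ σ

  sign-neg : ∀ σ i → sign σ (ℤ.- i) ≈ sign σ i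
  sign-neg σ (+ zero)  = refl
  sign-neg σ (+ suc n) = refl
  sign-neg σ -[1+ n ]  = refl

  sign-* : ∀ {σ τ υ} → σ * τ ≈ υ → ∀ i → sign σ i * sign τ i ≈ sign υ i
  sign-* {σ} {τ} {υ} e = λ { (+ n) → pow n ; -[1+ n ] → pow (suc n) }
    where
    pow : ∀ n → σ ^ n * τ ^ n ≈ υ ^ n
    pow zero    = *-identityˡ 1#
    pow (suc n) = trans
      (solve 4 (λ x a y b → x :* a :* (y :* b) := x :* y :* (a :* b)) refl σ (σ ^ n) τ (τ ^ n))
      (*-cong e (pow n))

  -1*-1≈1 : - 1# * - 1# ≈ 1#
  -1*-1≈1 = solve 0 ((:- one) :* (:- one) := one) refl

  module _ {σ} (σ²≈1 : σ * σ ≈ 1#) where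
    private
      -σ*-σ : - σ * - σ ≈ 1#
      -σ*-σ = trans (solve 1 (λ s → (:- s) :* (:- s) := s :* s) refl σ) σ²≈1

      σ*-σ : σ * - σ ≈ - 1#
      σ*-σ = trans (solve 1 (λ s → s :* (:- s) := :- (s :* s)) refl σ) (-‿cong σ²≈1)

    -- σ · (-σ) = -1 gives (-1)^(s+t) = σ^(s+t) (-σ)^(s+t), and (-σ)^t = (-σ)^(-t) because (-σ)² =
    -- 1.
    sign-even : ∀ s t → sign (- 1#) s * sign (- 1#) t ≈ sign σ (s ℤ.+ t) * sign (- σ) (s ℤ.- t)
    sign-even s t = begin
      sign (- 1#) s * sign (- 1#) t
        ≈⟨ sym (zpow-+ -1*-1≈1 s t) ⟩
      sign (- 1#) (s ℤ.+ t)
        ≈⟨ sym (sign-* σ*-σ (s ℤ.+ t)) ⟩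
      sign σ (s ℤ.+ t) * sign (- σ) (s ℤ.+ t)
        ≈⟨ *-congˡ (trans (zpow-+ -σ*-σ s t) (trans (*-congˡ (sym (sign-neg (- σ) t))) (sym (zpow-+ -σ*-σ s (ℤ.- t))))) ⟩
      sign σ (s ℤ.+ t) * sign (- σ) (s ℤ.- t) ∎

    sign-odd : ∀ s t → σ * (sign (- 1#) s * sign (- 1#) t) ≈ sign σ (ℤ.suc (s ℤ.+ t)) * sign (- σ) (s ℤ.- t)
    sign-odd s t = trans (*-congˡ (sign-even s t))
      (trans (sym (*-assoc σ _ _)) (*-congʳ (sym (zpow-suc σ²≈1 (s ℤ.+ t)))))

  module _ {x x′} (x*x′ : x * x′ ≈ 1#) where
    private
      u : ℤ → Carrier
      u = zpow x x′

    -- The general term of f(σ x^(h+g), σ x^(h−g)).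
    gauss : Carrier → ℤ → ℤ → ℤ → Carrier
    gauss σ h g k = sign σ k * u (quadratic h g k)

    module _ {σ h g a b} (σ²≈1 : σ * σ ≈ 1#) (a≈ : a ≈ σ * u (h ℤ.+ g)) (b≈ : b ≈ σ * u (h ℤ.- g)) where
      base : u (+ 2 ℤ.* h) ≈ a * b
      base = sym (begin
        a * b
          ≈⟨ *-cong a≈ b≈ ⟩
        σ * u (h ℤ.+ g) * (σ * u (h ℤ.- g))
          ≈⟨ solve 3 (λ s a b → s :* a :* (s :* b) := s :* s :* (a :* b)) refl σ _ _ ⟩
        σ * σ * (u (h ℤ.+ g) * u (h ℤ.- g))
          ≈⟨ trans (*-cong σ²≈1 (sym (zpow-+ x*x′ (h ℤ.+ g) (h ℤ.- g)))) (*-identityˡ _) ⟩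
        u ((h ℤ.+ g) ℤ.+ (h ℤ.- g))
          ≡⟨ ≡.cong u (solveℤ 2 (λ h g → (h ⊞ g) ⊞ (h ⊟ g) ≜ conℤ (+ 2) ⊠ h) ≡.refl h g) ⟩
        u (+ 2 ℤ.* h) ∎)

      unit : a * (σ * u (ℤ.- (h ℤ.+ g))) ≈ 1#
      unit = trans (*-congʳ a≈) (trans
        (solve 3 (λ s a b → s :* a :* (s :* b) := s :* s :* (a :* b)) refl σ (u (h ℤ.+ g)) (u (ℤ.- (h ℤ.+ g))))
        (trans (*-cong σ²≈1 (zpow-inverse x*x′ (h ℤ.+ g))) (*-identityˡ 1#)))

      -- Both sequences start at 1 and have the ratio σ x^(h+g+2hk) at k.
      theta≈gauss : ∀ {t} → IsTheta a b t → ∀ k → t k ≈ gauss σ h g k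
      theta≈gauss {t} θ = recurrence-unique
        {ρ = λ k → σ * u (h ℤ.+ g ℤ.+ + 2 ℤ.* h ℤ.* k)} {ρ′ = λ k → σ * u (ℤ.- (h ℤ.+ g ℤ.+ + 2 ℤ.* h ℤ.* k))}
        (λ k → trans (solve 3 (λ s a b → s :* a :* (s :* b) := s :* s :* (a :* b)) refl σ _ _)
          (trans (*-cong σ²≈1 (zpow-inverse x*x′ (h ℤ.+ g ℤ.+ + 2 ℤ.* h ℤ.* k))) (*-identityˡ 1#)))
        (λ k → trans (theta-suc θ base (zpow-inverse x*x′ (+ 2 ℤ.* h)) k) (*-congʳ (step k)))
        (λ k → trans
          (*-cong (zpow-suc σ²≈1 k) (trans (reflexive (≡.cong u
            (solveℤ 3 (λ h g k → h ⊠ ((conℤ (+ 1) ⊞ k) ⊠ (conℤ (+ 1) ⊞ k)) ⊞ g ⊠ (conℤ (+ 1) ⊞ k)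
               ≜ (h ⊞ g ⊞ conℤ (+ 2) ⊠ h ⊠ k) ⊞ (h ⊠ (k ⊠ k) ⊞ g ⊠ k)) ≡.refl h g k)))
            (zpow-+ x*x′ (h ℤ.+ g ℤ.+ + 2 ℤ.* h ℤ.* k) (quadratic h g k))))
          (solve 4 (λ s a v w → s :* a :* (v :* w) := s :* v :* (a :* w)) refl σ (sign σ k) _ _))
        (trans (IsTheta.at-0 θ) (sym (trans (*-identityˡ _) (reflexive (≡.cong u
          (solveℤ 2 (λ h g → h ⊠ (conℤ (+ 0) ⊠ conℤ (+ 0)) ⊞ g ⊠ conℤ (+ 0) ≜ conℤ (+ 0)) ≡.refl h g))))))
        where
        step : ∀ k → a * zpow (u (+ 2 ℤ.* h)) (u (ℤ.- (+ 2 ℤ.* h))) k ≈ σ * u (h ℤ.+ g ℤ.+ + 2 ℤ.* h ℤ.* k)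
        step k = trans (*-cong a≈ (zpow-zpow x*x′ (+ 2 ℤ.* h) k))
          (trans (*-assoc σ _ _) (*-congˡ (sym (zpow-+ x*x′ (h ℤ.+ g) (+ 2 ℤ.* h ℤ.* k)))))

    u-* : ∀ i j k l → i ℤ.+ j ≡ k ℤ.+ l → u i * u j ≈ u k * u l
    u-* i j k l e = trans (sym (zpow-+ x*x′ i j)) (trans (reflexive (≡.cong u e)) (zpow-+ x*x′ k l))

    -- Rests on 2(s² + t²) = (s + t)² + (s - t)²: the quadratic part splits between β and γ, and the
    -- linear part depends on s + t alone.
    square-identity : ∀ {σ K c α β γ δ A B g p Cα Cβ Cγ Cδ} → σ * σ ≈ 1# →
      Decay α Cα → Decay β Cβ → Decay γ Cγ → Decay δ Cδ →
      (∀ k → α k ≈ gauss (- 1#) (+ 2 ℤ.* K) (+ 2 ℤ.* c ℤ.- K) k) →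
      (∀ k → β k ≈ gauss σ K (+ 2 ℤ.* c ℤ.- K) k) →
      (∀ k → γ k ≈ gauss (- σ) K (+ 0) k) →
      (∀ k → δ k ≈ gauss (- 1#) (+ 2 ℤ.* K) (ℤ.- (+ 2 ℤ.* c) ℤ.- K) k) →
      HasSum α A → HasSum β g → HasSum γ p → HasSum δ B →
      A * A + σ * u (+ 2 ℤ.* c) * (B * B) ≈ g * p
    square-identity {σ} {K} {c} {α} {β} {γ} {δ} σ²≈1 dα dβ dγ dδ α≈ β≈ γ≈ δ≈ sα sβ sγ sδ =
      -- Reflection turns the exponent of δ into 2K s² + (2c + K) s. With the prefactor x^(2c), two
      -- such exponents complete to K n² + (2c - K) n + K (s - t)² at n = s + t + 1.
      parity-product {δ = λ k → δ (ℤ.- k)} dα dβ dγ (Decay-reflect dδ) even odd sα sβ sγ (HasSum-reflect dδ sδ)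
      where
      K₂ = + 2 ℤ.* K
      d = + 2 ℤ.* c ℤ.- K
      interchange : ∀ a b c d → a * b * (c * d) ≈ a * c * (b * d)
      interchange = solve 4 (λ a b c d → a :* b :* (c :* d) := a :* c :* (b :* d)) refl
      even : ∀ s t → α s * α t ≈ β (s ℤ.+ t) * γ (s ℤ.- t)
      even s t = begin
        α s * α t
          ≈⟨ trans (*-cong (α≈ s) (α≈ t)) (interchange _ _ _ _) ⟩
        sign (- 1#) s * sign (- 1#) t * (u (quadratic K₂ d s) * u (quadratic K₂ d t))
          ≈⟨ *-cong (sign-even σ²≈1 s t) (u-* (quadratic K₂ d s) (quadratic K₂ d t)
               (quadratic K d (s ℤ.+ t)) (quadratic K (+ 0) (s ℤ.- t)) (solveℤ 4 (λ K c s t →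
               let d = conℤ (+ 2) ⊠ c ⊟ K; K₂ = conℤ (+ 2) ⊠ K in
               (K₂ ⊠ (s ⊠ s) ⊞ d ⊠ s) ⊞ (K₂ ⊠ (t ⊠ t) ⊞ d ⊠ t)
               ≜ (K ⊠ ((s ⊞ t) ⊠ (s ⊞ t)) ⊞ d ⊠ (s ⊞ t))
                     ⊞ (K ⊠ ((s ⊟ t) ⊠ (s ⊟ t)) ⊞ conℤ (+ 0) ⊠ (s ⊟ t))) ≡.refl K c s t)) ⟩
        sign σ (s ℤ.+ t) * sign (- σ) (s ℤ.- t) * (u (quadratic K d (s ℤ.+ t)) * u (quadratic K (+ 0) (s ℤ.- t)))
          ≈⟨ trans (interchange _ _ _ _) (sym (*-cong (β≈ (s ℤ.+ t)) (γ≈ (s ℤ.- t)))) ⟩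
        β (s ℤ.+ t) * γ (s ℤ.- t) ∎
      exponent : ℤ → ℤ
      exponent s = quadratic K₂ (ℤ.- (+ 2 ℤ.* c) ℤ.- K) (ℤ.- s)
      δ⁻ : ∀ s → δ (ℤ.- s) ≈ sign (- 1#) s * u (exponent s)
      δ⁻ s = trans (δ≈ (ℤ.- s)) (*-congʳ (sign-neg (- 1#) s))
      odd : ∀ s t → σ * u (+ 2 ℤ.* c) * (δ (ℤ.- s) * δ (ℤ.- t)) ≈ β (ℤ.suc (s ℤ.+ t)) * γ (s ℤ.- t)
      odd s t = begin
        σ * u (+ 2 ℤ.* c) * (δ (ℤ.- s) * δ (ℤ.- t))
          ≈⟨ *-congˡ (*-cong (δ⁻ s) (δ⁻ t)) ⟩
        σ * u (+ 2 ℤ.* c) * (sign (- 1#) s * u (exponent s) * (sign (- 1#) t * u (exponent t)))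
          ≈⟨ solve 6 (λ σ y a v b w → σ :* y :* (a :* v :* (b :* w)) := σ :* (a :* b) :* (y :* v :* w)) refl
               σ (u (+ 2 ℤ.* c)) (sign (- 1#) s) (u (exponent s)) (sign (- 1#) t) (u (exponent t)) ⟩
        σ * (sign (- 1#) s * sign (- 1#) t) * (u (+ 2 ℤ.* c) * u (exponent s) * u (exponent t))
          ≈⟨ *-cong (sign-odd σ²≈1 s t) (trans (*-congʳ (sym (zpow-+ x*x′ (+ 2 ℤ.* c) (exponent s))))
               (u-* (+ 2 ℤ.* c ℤ.+ exponent s) (exponent t)
                 (quadratic K d (ℤ.suc (s ℤ.+ t))) (quadratic K (+ 0) (s ℤ.- t)) (solveℤ 4 (λ K c s t →
               let d = conℤ (+ 2) ⊠ c ⊟ K; K₂ = conℤ (+ 2) ⊠ K; c₂ = conℤ (+ 2) ⊠ c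
                   n = conℤ (+ 1) ⊞ (s ⊞ t)
                   e = λ s → K₂ ⊠ ((⊟′ s) ⊠ (⊟′ s)) ⊞ ((⊟′ c₂) ⊟ K) ⊠ (⊟′ s) in
               (c₂ ⊞ e s) ⊞ e t
               ≜ (K ⊠ (n ⊠ n) ⊞ d ⊠ n)
                     ⊞ (K ⊠ ((s ⊟ t) ⊠ (s ⊟ t)) ⊞ conℤ (+ 0) ⊠ (s ⊟ t))) ≡.refl K c s t))) ⟩
        sign σ (ℤ.suc (s ℤ.+ t)) * sign (- σ) (s ℤ.- t)
          * (u (quadratic K d (ℤ.suc (s ℤ.+ t))) * u (quadratic K (+ 0) (s ℤ.- t)))
          ≈⟨ trans (interchange _ _ _ _) (sym (*-cong (β≈ (ℤ.suc (s ℤ.+ t))) (γ≈ (s ℤ.- t)))) ⟩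
        β (ℤ.suc (s ℤ.+ t)) * γ (s ℤ.- t) ∎

  -- Clearing the denominators

  quotient-unique : ∀ {x w w′ z} → w * w′ ≈ 1# → x * w ≈ z → x ≈ z * w′
  quotient-unique {x} {w} {w′} {z} e h = begin
    x             ≈⟨ sym (*-identityʳ x) ⟩
    x * 1#        ≈⟨ *-congˡ (sym e) ⟩
    x * (w * w′)  ≈⟨ sym (*-assoc x w w′) ⟩
    x * w * w′    ≈⟨ *-congʳ h ⟩
    z * w′        ∎

  -- Here ψ f₃ = n d E², so multiplying by s ψ f₃ clears both denominators of 1/U + σ U for U = s n / d.
  quotient-identity : ∀ {s n d d′ U U′ ψ f₃ E E₂ σ x A B g p} →
    d * d′ ≈ 1# → U ≈ s * (n * d′) → U * U′ ≈ 1# → s * s ≈ x → ψ * E₂ ≈ E * E → f₃ ≈ n * d * E₂ →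
    A ≈ d * E → B ≈ n * E → A * A + σ * x * (B * B) ≈ g * p →
    (U′ + σ * U) * (s * ψ * f₃) ≈ p * g
  quotient-identity {s} {n} {d} {d′} {U} {U′} {ψ} {f₃} {E} {E₂} {σ} {x} {A} {B} {g} {p} dd′ U≈ UU′ ss ψE₂ f₃≈ A≈ B≈ key = begin
    (U′ + σ * U) * (s * ψ * f₃)
      ≈⟨ *-congˡ (*-congˡ f₃≈) ⟩
    (U′ + σ * U) * (s * ψ * (n * d * E₂))
      ≈⟨ solve 8 (λ V σ U s ψ n d E₂ → (V :+ σ :* U) :* (s :* ψ :* (n :* d :* E₂))
           := V :* (s :* n) :* d :* (ψ :* E₂) :+ σ :* (U :* d) :* (s :* n) :* (ψ :* E₂)) refl U′ σ U s ψ n d E₂ ⟩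
    U′ * (s * n) * d * (ψ * E₂) + σ * (U * d) * (s * n) * (ψ * E₂)
      ≈⟨ +-cong (*-cong (*-congʳ (trans (*-congˡ (sym Ud)) U′Ud)) ψE₂) (*-cong (*-congʳ (*-congˡ Ud)) ψE₂) ⟩
    d * d * (E * E) + σ * (s * n) * (s * n) * (E * E)
      ≈⟨ solve 5 (λ d E σ s n → d :* d :* (E :* E) :+ σ :* (s :* n) :* (s :* n) :* (E :* E)
           := d :* E :* (d :* E) :+ σ :* (s :* s) :* (n :* E :* (n :* E))) refl d E σ s n ⟩
    d * E * (d * E) + σ * (s * s) * (n * E * (n * E))
      ≈⟨ sym (+-cong (*-cong A≈ A≈) (*-cong (*-congˡ (sym ss)) (*-cong B≈ B≈))) ⟩
    A * A + σ * x * (B * B)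
      ≈⟨ trans key (*-comm g p) ⟩
    p * g ∎
    where
    Ud : U * d ≈ s * n
    Ud = trans (*-congʳ U≈) (trans (solve 4 (λ s n e d → s :* (n :* e) :* d := s :* n :* (d :* e)) refl s n d′ d)
      (trans (*-congˡ dd′) (*-identityʳ _)))
    U′Ud : U′ * (U * d) ≈ d
    U′Ud = trans (sym (*-assoc U′ U d)) (trans (*-congʳ (trans (*-comm U′ U) UU′)) (*-identityˡ d))

  quotient-rescale : ∀ {n d d′ E F G G′} → d * d′ ≈ 1# → G * G′ ≈ 1# → F ≈ n * E → G ≈ d * E → n * d′ ≈ F * G′
  quotient-rescale {n} {d} {d′} {E} {F} {G} dd′ GG′ F≈ G≈ = quotient-unique GG′ (begin
    n * d′ * G        ≈⟨ *-congˡ G≈ ⟩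
    n * d′ * (d * E)  ≈⟨ solve 4 (λ n e d E → n :* e :* (d :* E) := n :* E :* (d :* e)) refl n d′ d E ⟩
    n * E * (d * d′)  ≈⟨ trans (*-congˡ dd′) (*-identityʳ _) ⟩
    n * E             ≈⟨ sym F≈ ⟩
    F                 ∎)

-- Small q stands for the proofs of |q| < 1 on which the infinite products and the theta series depend.
record QSeries (A : NormedAlgebra) : Set₁ where
  open NormedAlgebra A
  open NormedAlgebraProperties A using (_⟶_; HasSum)
  open Summation A using (Decay)
  open Products A using (qProduct; BoundedInverse)
  open GaussianForms A using (IsTheta)
  field
    Small         : Carrier → Set
    small-square  : ∀ {q} → Small q → Small (q * q)
    small-inverse : ∀ {q} → Small q → BoundedInverse q
    qPoch         : ∀ l q → Small q → Carrier
    qPoch-limit   : ∀ l q h → qProduct l q ⟶ qPoch l q h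
    θ-term        : Carrier → Carrier → ℤ → Carrier
    θ-isTheta     : ∀ a b → IsTheta a b (θ-term a b)
    θ-decay       : ∀ a b → Small (a * b) → Σ ℚ (Decay (θ-term a b))
    f             : ∀ a b → Small (a * b) → Carrier
    f-sum         : ∀ a b h → HasSum (θ-term a b) (f a b h)

-- Product formulas for f and ψ

module QSeriesProperties (A : NormedAlgebra) (𝒬 : QSeries A) where
  open NormedAlgebra A
  open NormedAlgebraProperties A
  open Products A
  open ThetaIdentities A
  open GaussianForms A
  open QSeries 𝒬
  open Relation.Binary.Reasoning.Setoid setoid

  qPoch-cong : ∀ {l l′ q q′} h h′ → l ≈ l′ → q ≈ q′ → qPoch l q h ≈ qPoch l′ q′ h′
  qPoch-cong {l} {l′} {q} {q′} h h′ e e′ = lim-unique (qPoch-limit l q h)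
    (lim-cong (λ n → sym (qProduct-cong e e′ n)) refl (qPoch-limit l′ q′ h′))

  qPoch-split : ∀ l q h h′ → qPoch l q h ≈ qPoch l (q * q) h′ * qPoch (l * q) (q * q) h′
  qPoch-split l q h h′ = lim-unique (lim-double (qPoch-limit l q h))
    (lim-cong (λ n → sym (qProduct-double l q n)) refl
      (lim-* (qPoch-limit l (q * q) h′) (qPoch-limit (l * q) (q * q) h′)))

  qPoch-± : ∀ l q h h′ → qPoch l q h * qPoch (- l) q h ≈ qPoch (l * l) (q * q) h′
  qPoch-± l q h h′ = lim-unique (lim-* (qPoch-limit l q h) (qPoch-limit (- l) q h))
    (lim-cong (λ n → sym (qProduct-± l q n)) refl (qPoch-limit (l * l) (q * q) h′))

  jacobi-triple-product : ∀ {a b a′ b′} h → a * a′ ≈ 1# → b * b′ ≈ 1# →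
    f a b h ≈ qPoch (- a) (a * b) h * qPoch (- b) (a * b) h * qPoch (a * b) (a * b) h
  jacobi-triple-product {a} {b} {a′} {b′} h a*a′ b*b′ =
    Triple.triple-product (qPoch-limit (a * b) (a * b) h)
      (qPoch-limit (- a) (a * b) h) (qPoch-limit (- b) (a * b) h) (f-sum a b h)
    where
    ab*a′b′ : a * b * (a′ * b′) ≈ 1#
    ab*a′b′ = trans (*-interchange a b a′ b′) (trans (*-cong a*a′ b*b′) (*-identityˡ 1#))
    module Triple = TripleProduct refl ab*a′b′ (small-inverse h)
      (IsTheta.at-0 (θ-isTheta a b)) (theta-suc (θ-isTheta a b) refl ab*a′b′) (proj₂ (θ-decay a b h))

  jacobi : ∀ {a b a′ b′ l m q} h h′ → a * a′ ≈ 1# → b * b′ ≈ 1# → - a ≈ l → - b ≈ m → a * b ≈ q →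
    f a b h ≈ qPoch l q h′ * qPoch m q h′ * qPoch q q h′
  jacobi h h′ a*a′ b*b′ el em eq = trans (jacobi-triple-product h a*a′ b*b′)
    (*-cong (*-cong (qPoch-cong h h′ el eq) (qPoch-cong h h′ em eq)) (qPoch-cong h h′ eq eq))

  -- The triple product gives ψ(x) = (-x; x²)(x⁴; x⁴), and (x; x) = (x; x²)(x²; x²). Then (-x;
  -- x²)(x; x²) = (x²; x⁴), which together with (x⁴; x⁴) is a second copy of (x²; x²).
  ψ-square : ∀ {x x′ x³} h h₁ h₂ → x * x′ ≈ 1# → x³ ≈ x * (x * x) →
    f x x³ h * qPoch x x h₁ ≈ qPoch (x * x) (x * x) h₂ * qPoch (x * x) (x * x) h₂
  ψ-square {x} {x′} {x³} h h₁ h₂ x*x′ x³≈ = begin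
    f x x³ h * qPoch x x h₁
      ≈⟨ *-cong (jacobi h h₃ x*x′ x³*x′³ refl
           (trans (-‿cong x³≈) (solve 1 (λ x → :- (x :* (x :* x)) := (:- x) :* (x :* x)) refl x))
           (trans (*-congˡ x³≈) (sym (*-assoc x x y)))) (qPoch-split x x h₁ h₂) ⟩
    qPoch (- x) (y * y) h₃ * qPoch (- x * y) (y * y) h₃ * qPoch (y * y) (y * y) h₃ * (qPoch x y h₂ * E)
      ≈⟨ *-congʳ (*-congʳ (sym (qPoch-split (- x) y h₂ h₃))) ⟩
    qPoch (- x) y h₂ * qPoch (y * y) (y * y) h₃ * (qPoch x y h₂ * E)
      ≈⟨ *-interchange _ _ _ _ ⟩
    qPoch (- x) y h₂ * qPoch x y h₂ * (qPoch (y * y) (y * y) h₃ * E)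
      ≈⟨ *-congʳ (trans (*-comm _ _) (qPoch-± x y h₂ h₃)) ⟩
    qPoch y (y * y) h₃ * (qPoch (y * y) (y * y) h₃ * E)
      ≈⟨ trans (sym (*-assoc _ _ E)) (*-congʳ (sym (qPoch-split y y h₂ h₃))) ⟩
    E * E ∎
    where
    y = x * x
    E = qPoch y y h₂
    h₃ = small-square h₂
    x³*x′³ : x³ * (x′ * (x′ * x′)) ≈ 1#
    x³*x′³ = trans (*-congʳ x³≈) (trans
      (solve 2 (λ x z → x :* (x :* x) :* (z :* (z :* z)) := x :* z :* (x :* z :* (x :* z))) refl x x′)
      (trans (*-cong x*x′ (trans (*-cong x*x′ x*x′) (*-identityˡ 1#))) (*-identityˡ 1#)))

  module Powers {p p′} (p*p′ : p * p′ ≈ 1#) (u : ℤ → Carrier) (u≈ : ∀ i → u i ≈ zpow p p′ i) where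

    u≡ : ∀ {i j} → i ≡ j → u i ≈ zpow p p′ j
    u≡ {i} ≡.refl = u≈ i

    u-+ : ∀ {i j n} → i ℤ.+ j ≡ n → u i * u j ≈ u n
    u-+ {i} {j} ≡.refl = trans (*-cong (u≈ i) (u≈ j)) (trans (sym (zpow-+ p*p′ i j)) (sym (u≈ (i ℤ.+ j))))

    u-inverse : ∀ i → u i * zpow p p′ (ℤ.- i) ≈ 1#
    u-inverse i = trans (*-congʳ (u≈ i)) (zpow-inverse p*p′ i)

    -u-inverse : ∀ i → - u i * - zpow p p′ (ℤ.- i) ≈ 1#
    -u-inverse i = trans (-x*-y≈x*y _ _) (u-inverse i)

    jacobi-powers : ∀ i j {n a b q} h h′ → a ≈ - u i → b ≈ - u j → i ℤ.+ j ≡ n → u n ≈ q →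
      f a b h ≈ qPoch (u i) q h′ * qPoch (u j) q h′ * qPoch q q h′
    jacobi-powers i j h h′ a≈ b≈ e n≈ = jacobi h h′
      (trans (*-congʳ a≈) (-u-inverse i)) (trans (*-congʳ b≈) (-u-inverse j))
      (trans (-‿cong a≈) (-‿involutive (u i))) (trans (-‿cong b≈) (-‿involutive (u j)))
      (trans (*-cong a≈ b≈) (trans (-x*-y≈x*y (u i) (u j)) (trans (u-+ e) n≈)))

    qPoch-split-powers : ∀ i r {j n q} h h′ → i ℤ.+ r ≡ j → r ℤ.+ r ≡ n → u n ≈ q →
      qPoch (u i) (u r) h ≈ qPoch (u i) q h′ * qPoch (u j) q h′
    qPoch-split-powers i r h h′ e e′ n≈ = trans (qPoch-split (u i) (u r) h (small-square h))
      (*-cong (qPoch-cong _ h′ refl r*r) (qPoch-cong _ h′ (u-+ e) r*r))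
      where r*r = trans (u-+ e′) n≈

    module _ (K d : ℤ) where
      f-numerator : ∀ {a b q} h h′ → a ≈ - u (K ℤ.- d) → b ≈ - u (+ 3 ℤ.* K ℤ.+ d) → u (+ 4 ℤ.* K) ≈ q → f a b h ≈
        qPoch (u (K ℤ.- d)) q h′ * qPoch (u (+ 3 ℤ.* K ℤ.+ d)) q h′ * qPoch q q h′
      f-numerator h h′ a≈ b≈ = jacobi-powers (K ℤ.- d) (+ 3 ℤ.* K ℤ.+ d) h h′ a≈ b≈
        (solveℤ 2 (λ K d → (K ⊟ d) ⊞ (conℤ (+ 3) ⊠ K ⊞ d) ≜ conℤ (+ 4) ⊠ K) ≡.refl K d)

      f-denominator : ∀ {a b q} h h′ → a ≈ - u (K ℤ.+ d) → b ≈ - u (+ 3 ℤ.* K ℤ.- d) → u (+ 4 ℤ.* K) ≈ q → f a b h ≈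
        qPoch (u (K ℤ.+ d)) q h′ * qPoch (u (+ 3 ℤ.* K ℤ.- d)) q h′ * qPoch q q h′
      f-denominator h h′ a≈ b≈ = jacobi-powers (K ℤ.+ d) (+ 3 ℤ.* K ℤ.- d) h h′ a≈ b≈
        (solveℤ 2 (λ K d → (K ⊞ d) ⊞ (conℤ (+ 3) ⊠ K ⊟ d) ≜ conℤ (+ 4) ⊠ K) ≡.refl K d)

      -- Each of the two factors in base u (2K) splits into two in base u (4K). Exchanging the
      -- second halves regroups the four into N and D.
      f-product : ∀ {a b q N D} h h₂ h′ → a ≈ - u (K ℤ.- d) → b ≈ - u (K ℤ.+ d) → u (+ 4 ℤ.* K) ≈ q →
        N ≈ qPoch (u (K ℤ.- d)) q h′ * qPoch (u (+ 3 ℤ.* K ℤ.+ d)) q h′ →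
        D ≈ qPoch (u (K ℤ.+ d)) q h′ * qPoch (u (+ 3 ℤ.* K ℤ.- d)) q h′ →
        f a b h ≈ N * D * qPoch (u (+ 2 ℤ.* K)) (u (+ 2 ℤ.* K)) h₂
      f-product h h₂ h′ a≈ b≈ 4K≈ N≈ D≈ = trans
        (jacobi-powers (K ℤ.- d) (K ℤ.+ d) h h₂ a≈ b≈
          (solveℤ 2 (λ K d → (K ⊟ d) ⊞ (K ⊞ d) ≜ conℤ (+ 2) ⊠ K) ≡.refl K d) refl)
        (*-congʳ (trans
          (*-cong
            (qPoch-split-powers (K ℤ.- d) (+ 2 ℤ.* K) h₂ h′
              (solveℤ 2 (λ K d → (K ⊟ d) ⊞ conℤ (+ 2) ⊠ K ≜ conℤ (+ 3) ⊠ K ⊟ d) ≡.refl K d) double 4K≈)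
            (qPoch-split-powers (K ℤ.+ d) (+ 2 ℤ.* K) h₂ h′
              (solveℤ 2 (λ K d → (K ⊞ d) ⊞ conℤ (+ 2) ⊠ K ≜ conℤ (+ 3) ⊠ K ⊞ d) ≡.refl K d) double 4K≈))
          (trans (solve 4 (λ a b c d → a :* b :* (c :* d) := a :* d :* (c :* b)) refl _ _ _ _) (sym (*-cong N≈ D≈)))))
        where
        double : + 2 ℤ.* K ℤ.+ + 2 ℤ.* K ≡ + 4 ℤ.* K
        double = solveℤ 1 (λ K → conℤ (+ 2) ⊠ K ⊞ conℤ (+ 2) ⊠ K ≜ conℤ (+ 4) ⊠ K) ≡.refl K

    ψ-powers : ∀ K {x³ q} h h₂ h′ → x³ ≈ u (+ 2 ℤ.* K) * (u (+ 2 ℤ.* K) * u (+ 2 ℤ.* K)) → u (+ 4 ℤ.* K) ≈ q →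
      f (u (+ 2 ℤ.* K)) x³ h * qPoch (u (+ 2 ℤ.* K)) (u (+ 2 ℤ.* K)) h₂ ≈ qPoch q q h′ * qPoch q q h′
    ψ-powers K h h₂ h′ x³≈ 4K≈ = trans (ψ-square h h₂ (small-square h₂) (u-inverse (+ 2 ℤ.* K)) x³≈)
      (*-cong (qPoch-cong _ h′ x²≈q x²≈q) (qPoch-cong _ h′ x²≈q x²≈q))
      where
      x²≈q = trans (u-+ (solveℤ 1 (λ K → conℤ (+ 2) ⊠ K ⊞ conℤ (+ 2) ⊠ K ≜ conℤ (+ 4) ⊠ K) ≡.refl K)) 4K≈

    module _ (K c d : ℤ) (d≡2c : d ≡ + 2 ℤ.* c) where
      f-squares : ∀ σ → σ * σ ≈ 1# → ∀ {a₁ b₁ a₂ b₂ a₃ b₃ a₄ b₄} h₁ h₂ h₃ h₄ →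
        a₁ ≈ - u (K ℤ.+ d) → b₁ ≈ - u (+ 3 ℤ.* K ℤ.- d) → a₂ ≈ - u (K ℤ.- d) → b₂ ≈ - u (+ 3 ℤ.* K ℤ.+ d) →
        a₃ ≈ σ * u (+ 2 ℤ.* c) → b₃ ≈ σ * u (+ 2 ℤ.* (K ℤ.- c)) → a₄ ≈ - σ * u K → b₄ ≈ - σ * u K →
        f a₁ b₁ h₁ * f a₁ b₁ h₁ + σ * u (+ 2 ℤ.* c) * (f a₂ b₂ h₂ * f a₂ b₂ h₂) ≈ f a₃ b₃ h₃ * f a₄ b₄ h₄
      f-squares σ σ² h₁ h₂ h₃ h₄ a₁≈ b₁≈ a₂≈ b₂≈ a₃≈ b₃≈ a₄≈ b₄≈ =
        trans (+-congˡ (*-congʳ (*-congˡ (u≈ (+ 2 ℤ.* c))))) (square-identity p*p′ {σ} {K} {c} σ²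
          (proj₂ (θ-decay _ _ h₁)) (proj₂ (θ-decay _ _ h₃)) (proj₂ (θ-decay _ _ h₄)) (proj₂ (θ-decay _ _ h₂))
          (theta≈gauss p*p′ {h = + 2 ℤ.* K} {g = g₁} -1*-1≈1
            (negative a₁≈ (sub (λ d → K ℤ.+ d) (solveℤ 2 (λ K c → K ⊞ conℤ (+ 2) ⊠ c
              ≜ conℤ (+ 2) ⊠ K ⊞ (conℤ (+ 2) ⊠ c ⊟ K)) ≡.refl K c)))
            (negative b₁≈ (sub (λ d → + 3 ℤ.* K ℤ.- d) (solveℤ 2 (λ K c → conℤ (+ 3) ⊠ K ⊟ conℤ (+ 2) ⊠ c
              ≜ conℤ (+ 2) ⊠ K ⊟ (conℤ (+ 2) ⊠ c ⊟ K)) ≡.refl K c)))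
            (θ-isTheta _ _))
          (theta≈gauss p*p′ {h = K} {g = g₁} σ²
            (trans a₃≈ (*-congˡ (u≡ (solveℤ 2 (λ K c → conℤ (+ 2) ⊠ c
              ≜ K ⊞ (conℤ (+ 2) ⊠ c ⊟ K)) ≡.refl K c))))
            (trans b₃≈ (*-congˡ (u≡ (solveℤ 2 (λ K c → conℤ (+ 2) ⊠ (K ⊟ c)
              ≜ K ⊟ (conℤ (+ 2) ⊠ c ⊟ K)) ≡.refl K c))))
            (θ-isTheta _ _))
          (theta≈gauss p*p′ {h = K} {g = + 0} (trans (-x*-y≈x*y σ σ) σ²)
            (trans a₄≈ (*-congˡ (u≡ (≡.sym (ℤₚ.+-identityʳ K))))) (trans b₄≈ (*-congˡ (u≡ (≡.sym (ℤₚ.+-identityʳ K)))))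
            (θ-isTheta _ _))
          (theta≈gauss p*p′ {h = + 2 ℤ.* K} {g = ℤ.- (+ 2 ℤ.* c) ℤ.- K} -1*-1≈1
            (negative a₂≈ (sub (λ d → K ℤ.- d) (solveℤ 2 (λ K c → K ⊟ conℤ (+ 2) ⊠ c
              ≜ conℤ (+ 2) ⊠ K ⊞ (⊟′ (conℤ (+ 2) ⊠ c) ⊟ K)) ≡.refl K c)))
            (negative b₂≈ (sub (λ d → + 3 ℤ.* K ℤ.+ d) (solveℤ 2 (λ K c → conℤ (+ 3) ⊠ K ⊞ conℤ (+ 2) ⊠ c
              ≜ conℤ (+ 2) ⊠ K ⊟ (⊟′ (conℤ (+ 2) ⊠ c) ⊟ K)) ≡.refl K c)))
            (θ-isTheta _ _))
          (f-sum _ _ h₁) (f-sum _ _ h₃) (f-sum _ _ h₄) (f-sum _ _ h₂))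
        where
        g₁ = + 2 ℤ.* c ℤ.- K
        sub : ∀ {i} (F : ℤ → ℤ) → F (+ 2 ℤ.* c) ≡ i → F d ≡ i
        sub F e = ≡.trans (≡.cong F d≡2c) e
        negative : ∀ {a i j} → a ≈ - u i → i ≡ j → a ≈ - 1# * zpow p p′ j
        negative {j = j} a≈ e = trans a≈ (trans (-‿cong (u≡ e)) (-x≈-1*x (zpow p p′ j)))

      -- Compound expressions enter as variables: over ℂ, comparing nested operations unfolds Cauchy sequences.
      reciprocal : ∀ σ → σ * σ ≈ 1# → ∀ {a₁ b₁ a₂ b₂ a₃ b₃ a₄ b₄} h₁ h₂ h₃ h₄ →
        a₁ ≈ - u (K ℤ.+ d) → b₁ ≈ - u (+ 3 ℤ.* K ℤ.- d) → a₂ ≈ - u (K ℤ.- d) → b₂ ≈ - u (+ 3 ℤ.* K ℤ.+ d) →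
        a₃ ≈ σ * u (+ 2 ℤ.* c) → b₃ ≈ σ * u (+ 2 ℤ.* (K ℤ.- c)) → a₄ ≈ - σ * u K → b₄ ≈ - σ * u K →
        ∀ {s n m m′ M U U′ ψ f₃ Y W w E E₂ F₁ F₂ F₃ F₄ R X} →
        F₁ ≈ f a₁ b₁ h₁ → F₂ ≈ f a₂ b₂ h₂ → F₃ ≈ f a₃ b₃ h₃ → F₄ ≈ f a₄ b₄ h₄ →
        m * m′ ≈ 1# → M ≈ n * m′ → U ≈ s * M → U * U′ ≈ 1# → s * s ≈ u (+ 2 ℤ.* c) →
        ψ * E₂ ≈ E * E → f₃ ≈ n * m * E₂ → F₁ ≈ m * E → F₂ ≈ n * E →
        Y ≈ s * ψ → W ≈ Y * f₃ → W * w ≈ 1# → X ≈ U′ + σ * U → R ≈ F₄ * F₃ → X ≈ R * w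
      reciprocal σ σ² h₁ h₂ h₃ h₄ a₁≈ b₁≈ a₂≈ b₂≈ a₃≈ b₃≈ a₄≈ b₄≈
        F₁≈ F₂≈ F₃≈ F₄≈ mm′ M≈ U≈ UU′ ss ψE₂ f₃≈ F₁≈mE F₂≈nE Y≈ W≈ Ww X≈ R≈ =
        quotient-unique Ww (trans (*-cong X≈ (trans W≈ (*-congʳ Y≈))) (trans
          (quotient-identity mm′ (trans U≈ (*-congˡ M≈)) UU′ ss ψE₂ f₃≈
            (trans (sym F₁≈) F₁≈mE) (trans (sym F₂≈) F₂≈nE)
            (f-squares σ σ² h₁ h₂ h₃ h₄ a₁≈ b₁≈ a₂≈ b₂≈ a₃≈ b₃≈ a₄≈ b₄≈))
          (sym (trans R≈ (*-cong F₄≈ F₃≈)))))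

open import Defs

-- ℂ as a normed algebra

≈ᴿ-refl : ∀ {x} → x ≈ᴿ x
≈ᴿ-refl {x} ε 0<ε = 0 , λ j _ → ≡.subst (ℚ._< ε) (≡.sym (≡.cong ℚ.∣_∣ (ℚₚ.+-inverseʳ (seq x j)))) 0<ε

≈ᴿ-eventually : ∀ {x y} → (∀∞ λ j → seq x j ≡ seq y j) → x ≈ᴿ y
≈ᴿ-eventually {x} {y} h ε 0<ε = ∀∞-map (λ j e → ≡.subst (ℚ._< ε)
  (≡.sym (≡.cong ℚ.∣_∣ (≡.trans (≡.cong (ℚ._- seq y j) e) (ℚₚ.+-inverseʳ (seq y j))))) 0<ε) h

≈-eventually : ∀ {z w} → (∀∞ λ j → seq (re z) j ≡ seq (re w) j × seq (im z) j ≡ seq (im w) j) → z ≈ w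
≈-eventually {z} {w} h = mk≈
  (≈ᴿ-eventually {re z} {re w} (∀∞-map (λ _ → proj₁) h)) (≈ᴿ-eventually {im z} {im w} (∀∞-map (λ _ → proj₂) h))

≈-pointwise : ∀ {z w} → (∀ j → seq (re z) j ≡ seq (re w) j) → (∀ j → seq (im z) j ≡ seq (im w) j) → z ≈ w
≈-pointwise h g = ≈-eventually (0 , λ j _ → h j , g j)

≈ᴿ-sym : ∀ {x y} → x ≈ᴿ y → y ≈ᴿ x
≈ᴿ-sym {x} {y} h ε 0<ε = ∀∞-map (λ j → ≡.subst (ℚ._< ε) (∣-∣-sym (seq x j) (seq y j))) (h ε 0<ε)

≈ᴿ-trans : ∀ {x y z} → x ≈ᴿ y → y ≈ᴿ z → x ≈ᴿ z
≈ᴿ-trans {x} {y} {z} h g ε 0<ε = ∀∞-zip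
  (λ j a b → ℚₚ.≤-<-trans (∣-∣-tri (seq x j) (seq y j) (seq z j))
    (≡.subst (_ ℚ.<_) (half+half ε) (ℚₚ.+-mono-< a b)))
  (h (½ ℚ.* ε) (half-pos 0<ε)) (g (½ ℚ.* ε) (half-pos 0<ε))

-ᴿ-cong : ∀ {x y} → x ≈ᴿ y → -ᴿ x ≈ᴿ -ᴿ y
-ᴿ-cong {x} {y} h ε 0<ε = ∀∞-map
  (λ j → ≡.subst (ℚ._< ε) (≡.trans (∣-∣-sym (seq x j) (seq y j))
    (≡.cong ℚ.∣_∣ (solveℚ 2 (λ x y → y ⊖ x ⊜ (⊝ x) ⊖ (⊝ y)) ≡.refl (seq x j) (seq y j)))))
  (h ε 0<ε)

module _ where
  private
    r i : ℂ → ℕ → ℚ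
    r z = seq (re z)
    i z = seq (im z)

  abstract
    ℂ-refl : ∀ {z} → z ≈ z
    ℂ-refl {z} = mk≈ (≈ᴿ-refl {re z}) (≈ᴿ-refl {im z})

    ℂ-sym : ∀ {z w} → z ≈ w → w ≈ z
    ℂ-sym {z} {w} (mk≈ h g) = mk≈ (≈ᴿ-sym {re z} {re w} h) (≈ᴿ-sym {im z} {im w} g)

    ℂ-trans : ∀ {z w v} → z ≈ w → w ≈ v → z ≈ v
    ℂ-trans {z} {w} {v} (mk≈ h g) (mk≈ h′ g′) =
      mk≈ (≈ᴿ-trans {re z} {re w} {re v} h h′) (≈ᴿ-trans {im z} {im w} {im v} g g′)

    ℂ-+-cong : ∀ {z z′ w w′} → z ≈ z′ → w ≈ w′ → z + w ≈ z′ + w′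
    ℂ-+-cong {z} {z′} {w} {w′} (mk≈ h g) (mk≈ h′ g′) =
      mk≈ (+ᴿ-cong (re z) (re z′) (re w) (re w′) h h′) (+ᴿ-cong (im z) (im z′) (im w) (im w′) g g′)

    ℂ-*-cong : ∀ {z z′ w w′} → z ≈ z′ → w ≈ w′ → z * w ≈ z′ * w′
    ℂ-*-cong {z} {z′} {w} {w′} (mk≈ h g) (mk≈ h′ g′) = mk≈
      (+ᴿ-cong (re z *ᴿ re w) (re z′ *ᴿ re w′) (-ᴿ (im z *ᴿ im w)) (-ᴿ (im z′ *ᴿ im w′))
        (*ᴿ-cong (re z) (re z′) (re w) (re w′) h h′)
        (-ᴿ-cong {im z *ᴿ im w} {im z′ *ᴿ im w′} (*ᴿ-cong (im z) (im z′) (im w) (im w′) g g′)))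
      (+ᴿ-cong (re z *ᴿ im w) (re z′ *ᴿ im w′) (im z *ᴿ re w) (im z′ *ᴿ re w′)
        (*ᴿ-cong (re z) (re z′) (im w) (im w′) h g′) (*ᴿ-cong (im z) (im z′) (re w) (re w′) g h′))

    ℂ-neg-cong : ∀ {z w} → z ≈ w → - z ≈ - w
    ℂ-neg-cong {z} {w} (mk≈ h g) = mk≈ (-ᴿ-cong {re z} {re w} h) (-ᴿ-cong {im z} {im w} g)

    ℂ-+-assoc : ∀ z w v → (z + w) + v ≈ z + (w + v)
    ℂ-+-assoc z w v = ≈-pointwise (λ j → ℚₚ.+-assoc (r z j) (r w j) (r v j)) (λ j → ℚₚ.+-assoc (i z j) (i w j) (i v j))

    ℂ-+-comm : ∀ z w → z + w ≈ w + z
    ℂ-+-comm z w = ≈-pointwise (λ j → ℚₚ.+-comm (r z j) (r w j)) (λ j → ℚₚ.+-comm (i z j) (i w j))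

    ℂ-+-identityˡ : ∀ z → 0ℂ + z ≈ z
    ℂ-+-identityˡ z = ≈-pointwise (λ j → ℚₚ.+-identityˡ (r z j)) (λ j → ℚₚ.+-identityˡ (i z j))

    ℂ-+-identityʳ : ∀ z → z + 0ℂ ≈ z
    ℂ-+-identityʳ z = ≈-pointwise (λ j → ℚₚ.+-identityʳ (r z j)) (λ j → ℚₚ.+-identityʳ (i z j))

    ℂ-+-inverseˡ : ∀ z → - z + z ≈ 0ℂ
    ℂ-+-inverseˡ z = ≈-pointwise (λ j → ℚₚ.+-inverseˡ (r z j)) (λ j → ℚₚ.+-inverseˡ (i z j))

    ℂ-+-inverseʳ : ∀ z → z + - z ≈ 0ℂ
    ℂ-+-inverseʳ z = ≈-pointwise (λ j → ℚₚ.+-inverseʳ (r z j)) (λ j → ℚₚ.+-inverseʳ (i z j))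

    ℂ-*-assoc : ∀ z w v → (z * w) * v ≈ z * (w * v)
    ℂ-*-assoc z w v = ≈-pointwise
      (λ j → solveℚ 6 (λ a b c d e f → (a ⊗ c ⊕ ⊝ (b ⊗ d)) ⊗ e ⊕ ⊝ ((a ⊗ d ⊕ b ⊗ c) ⊗ f)
         ⊜ a ⊗ (c ⊗ e ⊕ ⊝ (d ⊗ f)) ⊕ ⊝ (b ⊗ (c ⊗ f ⊕ d ⊗ e))) ≡.refl (r z j) (i z j) (r w j) (i w j) (r v j) (i v j))
      (λ j → solveℚ 6 (λ a b c d e f → (a ⊗ c ⊕ ⊝ (b ⊗ d)) ⊗ f ⊕ (a ⊗ d ⊕ b ⊗ c) ⊗ e
         ⊜ a ⊗ (c ⊗ f ⊕ d ⊗ e) ⊕ b ⊗ (c ⊗ e ⊕ ⊝ (d ⊗ f))) ≡.refl (r z j) (i z j) (r w j) (i w j) (r v j) (i v j))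

    ℂ-*-comm : ∀ z w → z * w ≈ w * z
    ℂ-*-comm z w = ≈-pointwise
      (λ j → solveℚ 4 (λ a b c d → a ⊗ c ⊕ ⊝ (b ⊗ d) ⊜ c ⊗ a ⊕ ⊝ (d ⊗ b)) ≡.refl (r z j) (i z j) (r w j) (i w j))
      (λ j → solveℚ 4 (λ a b c d → a ⊗ d ⊕ b ⊗ c ⊜ c ⊗ b ⊕ d ⊗ a) ≡.refl (r z j) (i z j) (r w j) (i w j))

    ℂ-*-identityˡ : ∀ z → 1ℂ * z ≈ z
    ℂ-*-identityˡ z = ≈-pointwise
      (λ j → solveℚ 2 (λ a b → conℚ 1ℚ ⊗ a ⊕ ⊝ (conℚ 0ℚ ⊗ b) ⊜ a) ≡.refl (r z j) (i z j))
      (λ j → solveℚ 2 (λ a b → conℚ 1ℚ ⊗ b ⊕ conℚ 0ℚ ⊗ a ⊜ b) ≡.refl (r z j) (i z j))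

    ℂ-*-identityʳ : ∀ z → z * 1ℂ ≈ z
    ℂ-*-identityʳ z = ℂ-trans (ℂ-*-comm z 1ℂ) (ℂ-*-identityˡ z)

    ℂ-distribˡ : ∀ z w v → z * (w + v) ≈ z * w + z * v
    ℂ-distribˡ z w v = ≈-pointwise
      (λ j → solveℚ 6 (λ a b c d e f → a ⊗ (c ⊕ e) ⊕ ⊝ (b ⊗ (d ⊕ f)) ⊜ (a ⊗ c ⊕ ⊝ (b ⊗ d)) ⊕ (a ⊗ e ⊕ ⊝ (b ⊗ f)))
         ≡.refl (r z j) (i z j) (r w j) (i w j) (r v j) (i v j))
      (λ j → solveℚ 6 (λ a b c d e f → a ⊗ (d ⊕ f) ⊕ b ⊗ (c ⊕ e) ⊜ (a ⊗ d ⊕ b ⊗ c) ⊕ (a ⊗ f ⊕ b ⊗ e))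
         ≡.refl (r z j) (i z j) (r w j) (i w j) (r v j) (i v j))

    ℂ-distribʳ : ∀ z w v → (w + v) * z ≈ w * z + v * z
    ℂ-distribʳ z w v = ℂ-trans (ℂ-*-comm (w + v) z)
      (ℂ-trans (ℂ-distribˡ z w v) (ℂ-+-cong (ℂ-*-comm z w) (ℂ-*-comm z v)))

ℂ-commutativeRing : CommutativeRing 0ℓ 0ℓ
ℂ-commutativeRing = record
  { Carrier = ℂ ; _≈_ = _≈_ ; _+_ = _+_ ; _*_ = _*_ ; -_ = -_ ; 0# = 0ℂ ; 1# = 1ℂ
  ; isCommutativeRing = record
    { isRing = record
      { +-isAbelianGroup = record
        { isGroup = record
          { isMonoid = record
            { isSemigroup = record
              { isMagma = record
                { isEquivalence = record { refl = ℂ-refl ; sym = ℂ-sym ; trans = ℂ-trans }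
                ; ∙-cong = ℂ-+-cong }
              ; assoc = ℂ-+-assoc }
            ; identity = ℂ-+-identityˡ , ℂ-+-identityʳ }
          ; inverse = ℂ-+-inverseˡ , ℂ-+-inverseʳ
          ; ⁻¹-cong = ℂ-neg-cong }
        ; comm = ℂ-+-comm }
      ; *-cong = ℂ-*-cong
      ; *-assoc = ℂ-*-assoc
      ; *-identity = ℂ-*-identityˡ , ℂ-*-identityʳ
      ; distrib = ℂ-distribˡ , ℂ-distribʳ }
    ; *-comm = ℂ-*-comm } }

ℚ→ℂ : ℚₚ.+-*-rawRing -Raw-AlmostCommutative⟶ fromCommutativeRing ℂ-commutativeRing
ℚ→ℂ = record
  { ⟦_⟧    = λ p → fromℚ p +i fromℚ 0ℚ
  ; +-homo = λ p q → ≈-pointwise (λ _ → ≡.refl) (λ _ → ≡.refl)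
  ; *-homo = λ p q → ≈-pointwise
      (λ _ → solveℚ 2 (λ p q → p ⊗ q ⊜ p ⊗ q ⊕ ⊝ (conℚ 0ℚ ⊗ conℚ 0ℚ)) ≡.refl p q)
      (λ _ → solveℚ 2 (λ p q → conℚ 0ℚ ⊜ p ⊗ conℚ 0ℚ ⊕ conℚ 0ℚ ⊗ q) ≡.refl p q)
  ; -‿homo = λ p → ≈-pointwise (λ _ → ≡.refl) (λ _ → ≡.refl)
  ; 0-homo = ℂ-refl
  ; 1-homo = ℂ-refl
  }

-- The rationals representing z may exceed the norm they converge to; the slack ε makes ≼ invariant under ≈.
infix 4 _≼_
record _≼_ (z : ℂ) (c : ℚ) : Set where
  constructor mk≼
  field
    nonneg : 0ℚ ℚ.≤ c
    within : ∀ ε → 0ℚ ℚ.< ε → Bd z (c ℚ.+ ε)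
open _≼_

Bd⇒≼ : ∀ {z c} → 0ℚ ℚ.≤ c → Bd z c → z ≼ c
Bd⇒≼ {z} 0≤c h = mk≼ 0≤c λ ε 0<ε → Bd-mono z 0≤c (≤-by ε (ℚₚ.<⇒≤ 0<ε) ≡.refl) h

0≤c+ε : ∀ {c ε} → 0ℚ ℚ.≤ c → 0ℚ ℚ.< ε → 0ℚ ℚ.≤ c ℚ.+ ε
0≤c+ε 0≤c 0<ε = 0≤+ 0≤c (ℚₚ.<⇒≤ 0<ε)

abstract
  ≼-mono : ∀ {z c d} → c ℚ.≤ d → z ≼ c → z ≼ d
  ≼-mono {z} c≤d (mk≼ 0≤c h) = mk≼ (ℚₚ.≤-trans 0≤c c≤d) λ ε 0<ε →
    Bd-mono z (0≤c+ε 0≤c 0<ε) (ℚₚ.+-monoˡ-≤ ε c≤d) (h ε 0<ε)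

  ≈⇒Bd : ∀ {z w} → z ≈ w → ∀ {ε} → 0ℚ ℚ.< ε → Bd (w - z) ε
  ≈⇒Bd {z} {w} (mk≈ h g) {ε} 0<ε = Bd-≡ (w - z) (half+half ε) (bd (∀∞-zip
    (λ j a b → sum-of-squares≤ 0≤ε/2 0≤ε/2
      (≤ˡ (∣-∣-sym (seq (re z) j) (seq (re w) j)) (ℚₚ.<⇒≤ a))
      (≤ˡ (∣-∣-sym (seq (im z) j) (seq (im w) j)) (ℚₚ.<⇒≤ b)))
    (h (½ ℚ.* ε) (half-pos 0<ε)) (g (½ ℚ.* ε) (half-pos 0<ε))))
    where
    0≤ε/2 : 0ℚ ℚ.≤ ½ ℚ.* ε
    0≤ε/2 = ℚₚ.<⇒≤ (half-pos 0<ε)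

  ≼-resp : ∀ {z w c} → z ≈ w → z ≼ c → w ≼ c
  ≼-resp {z} {w} {c} e (mk≼ 0≤c h) = mk≼ 0≤c λ ε 0<ε →
    let δ = ½ ℚ.* ε ; 0<δ = half-pos 0<ε in
    Bd-≡ w (≡.trans (ℚₚ.+-assoc c δ δ) (≡.cong (c ℚ.+_) (half+half ε)))
      (Bd-resp (z + (w - z)) w (λ j → ≡.cong₂ sumsq (lem (seq (re z) j) (seq (re w) j)) (lem (seq (im z) j) (seq (im w) j)))
        (Bd-+ z (w - z) (0≤c+ε 0≤c 0<δ) (ℚₚ.<⇒≤ 0<δ) (h δ 0<δ) (≈⇒Bd e 0<δ)))
    where
    lem : ∀ a b → a ℚ.+ (b ℚ.- a) ≡ b
    lem = solveℚ 2 (λ a b → a ⊕ (b ⊖ a) ⊜ b) ≡.refl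

  ≼-+ : ∀ {z w c d} → z ≼ c → w ≼ d → z + w ≼ c ℚ.+ d
  ≼-+ {z} {w} {c} {d} (mk≼ 0≤c h) (mk≼ 0≤d g) = mk≼ (0≤+ 0≤c 0≤d) λ ε 0<ε →
    let δ = ½ ℚ.* ε ; 0<δ = half-pos 0<ε in
    Bd-≡ (z + w) (≡.trans (solveℚ 3 (λ c d e → (c ⊕ e) ⊕ (d ⊕ e) ⊜ (c ⊕ d) ⊕ (e ⊕ e)) ≡.refl c d δ)
        (≡.cong (c ℚ.+ d ℚ.+_) (half+half ε)))
      (Bd-+ z w (0≤c+ε 0≤c 0<δ) (0≤c+ε 0≤d 0<δ) (h δ 0<δ) (g δ 0<δ))

  -- For `≼-*`: (c + δ)(d + δ) exceeds cd by (c + d) δ + δ², which is at most (1 + c + d) δ when δ ≤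
  -- 1.
  shrink≤1 : ∀ {K ε} → 0ℚ ℚ.< K → 0ℚ ℚ.< ε → Σ ℚ λ δ → 0ℚ ℚ.< δ × δ ℚ.≤ 1ℚ × K ℚ.* δ ℚ.≤ ε
  shrink≤1 {K} {ε} 0<K 0<ε = clip (shrink 0<K 0<ε)
    where
    clip : (Σ ℚ λ δ → 0ℚ ℚ.< δ × K ℚ.* δ ℚ.< ε) → Σ ℚ λ δ → 0ℚ ℚ.< δ × δ ℚ.≤ 1ℚ × K ℚ.* δ ℚ.≤ ε
    clip (δ , 0<δ , lt) = choose (ℚₚ.≤-total δ 1ℚ)
      where
      choose : δ ℚ.≤ 1ℚ ⊎ 1ℚ ℚ.≤ δ → Σ ℚ λ δ → 0ℚ ℚ.< δ × δ ℚ.≤ 1ℚ × K ℚ.* δ ℚ.≤ ε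
      choose (inj₁ δ≤1) = δ , 0<δ , δ≤1 , ℚₚ.<⇒≤ lt
      choose (inj₂ 1≤δ) = 1ℚ , 0<1 , ℚₚ.≤-refl , ℚₚ.≤-trans (*-monoˡ (ℚₚ.<⇒≤ 0<K) 1≤δ) (ℚₚ.<⇒≤ lt)

  ≼-* : ∀ {z w c d} → z ≼ c → w ≼ d → z * w ≼ c ℚ.* d
  ≼-* {z} {w} {c} {d} (mk≼ 0≤c h) (mk≼ 0≤d g) = mk≼ (0≤* 0≤c 0≤d) λ ε 0<ε →
    let δ , 0<δ , δ≤1 , le = shrink≤1 {1ℚ ℚ.+ (c ℚ.+ d)} (ℚₚ.<-≤-trans 0<1 (≤-by (c ℚ.+ d) (0≤+ 0≤c 0≤d) ≡.refl)) 0<ε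
        0≤δ = ℚₚ.<⇒≤ 0<δ
    in Bd-mono (z * w) (0≤* (0≤c+ε 0≤c 0<δ) (0≤c+ε 0≤d 0<δ))
         (≤-by (δ ℚ.* (1ℚ ℚ.- δ) ℚ.+ (ε ℚ.- (1ℚ ℚ.+ (c ℚ.+ d)) ℚ.* δ)) (0≤+ (0≤* 0≤δ (p≤q⇒0≤q-p δ≤1)) (p≤q⇒0≤q-p le))
           (solveℚ 4 (λ c d δ ε → c ⊗ d ⊕ ε ⊜ (c ⊕ δ) ⊗ (d ⊕ δ) ⊕ (δ ⊗ (conℚ 1ℚ ⊖ δ) ⊕ (ε ⊖ (conℚ 1ℚ ⊕ (c ⊕ d)) ⊗ δ)))
             ≡.refl c d δ ε))
         (Bd-* z w (h δ 0<δ) (g δ 0<δ))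

  ≼-neg : ∀ {z c} → z ≼ c → - z ≼ c
  ≼-neg {z} (mk≼ 0≤c h) = mk≼ 0≤c λ ε 0<ε → Bd-neg z (h ε 0<ε)

  0≼0 : 0ℂ ≼ 0ℚ
  0≼0 = Bd⇒≼ ℚₚ.≤-refl (bd (0 , λ _ _ → ℚₚ.≤-refl))

  1≼1 : 1ℂ ≼ 1ℚ
  1≼1 = Bd⇒≼ 0≤1 Bd-1

  ≼-small : ∀ {z} → (∀ ε → 0ℚ ℚ.< ε → z ≼ ε) → z ≈ 0ℂ
  ≼-small {z} h = mk≈ (λ ε 0<ε → ∀∞-map (λ j le → part ε 0<ε (seq (re z) j) (seq (im z) j) le) (small ε 0<ε))
                      (λ ε 0<ε → ∀∞-map (λ j le → part ε 0<ε (seq (im z) j) (seq (re z) j)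
                        (≤ˡ (ℚₚ.+-comm (seq (re z) j ℚ.* seq (re z) j) _) le)) (small ε 0<ε))
    where
    -- A quarter of ε for the bound and a quarter for its slack leave ε/2, strictly below ε.
    δ : ℚ → ℚ
    δ ε = ½ ℚ.* (½ ℚ.* ε) ℚ.+ ½ ℚ.* (½ ℚ.* ε)
    0<q : ∀ {ε} → 0ℚ ℚ.< ε → 0ℚ ℚ.< ½ ℚ.* (½ ℚ.* ε)
    0<q 0<ε = half-pos (half-pos 0<ε)
    small : ∀ ε → 0ℚ ℚ.< ε → ∀∞ λ j → normℚ z j ℚ.≤ δ ε ℚ.* δ ε
    small ε 0<ε = Bd.eventually (within (h (½ ℚ.* (½ ℚ.* ε)) (0<q 0<ε)) (½ ℚ.* (½ ℚ.* ε)) (0<q 0<ε))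
    part : ∀ ε → 0ℚ ℚ.< ε → ∀ a b → sumsq a b ℚ.≤ δ ε ℚ.* δ ε → ℚ.∣ a ℚ.- 0ℚ ∣ ℚ.< ε
    part ε 0<ε a b le = ℚₚ.≤-<-trans
      (≤ˡ (≡.cong ℚ.∣_∣ (≡.sym (ℚₚ.+-identityʳ a))) (sq⇒∣∣≤ (ℚₚ.<⇒≤ (ℚₚ.+-mono-< (0<q 0<ε) (0<q 0<ε)))
        (ℚₚ.≤-trans (≤-by (b ℚ.* b) (0≤sq b) ≡.refl) le)))
      (≡.subst (ℚ._< ε) (≡.sym (half+half (½ ℚ.* ε))) (half< 0<ε))

  ℂ-bounded : ∀ z → Σ ℚ λ B → z ≼ B
  ℂ-bounded z = let B , 0≤B , h = bounded z in B , Bd⇒≼ 0≤B h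

  *-inverse : ∀ z z# → z * inv z z# ≈ 1ℂ
  *-inverse z z# = ≈-eventually (∀∞-map
    (λ j le → parts (seq (re z) j) (seq (im z) j) (recip (normℚ z j))
      (recip-inv (ℚₚ.<-≤-trans (proj₁ (proj₂ (low {∣ z ∣²} z#))) le)))
    (proj₂ (proj₂ (low {∣ z ∣²} z#))))
    where
    parts : ∀ a b s → (a ℚ.* a ℚ.+ b ℚ.* b) ℚ.* s ≡ 1ℚ →
      (a ℚ.* (a ℚ.* s) ℚ.+ ℚ.- (b ℚ.* (ℚ.- (b ℚ.* s))) ≡ 1ℚ) × (a ℚ.* (ℚ.- (b ℚ.* s)) ℚ.+ b ℚ.* (a ℚ.* s) ≡ 0ℚ)
    parts a b s e =
      ≡.trans (solveℚ 3 (λ a b s → a ⊗ (a ⊗ s) ⊕ ⊝ (b ⊗ ⊝ (b ⊗ s)) ⊜ (a ⊗ a ⊕ b ⊗ b) ⊗ s) ≡.refl a b s) e ,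
      solveℚ 3 (λ a b s → a ⊗ ⊝ (b ⊗ s) ⊕ b ⊗ (a ⊗ s) ⊜ conℚ 0ℚ) ≡.refl a b s

  module _ {z ρ} (z≼ρ : z ≼ ρ) (ρ<1 : ρ ℚ.< 1ℚ) where
    private
      s = 1ℚ ℚ.- ρ
      0<s = p<q⇒0<q-p ρ<1

    -- The real part suffices: Re z ≤ ρ + ε gives 1 - Re z ≥ s - ε, and ε is small enough that (s -
    -- ε)(1/s + η) ≥ 1. The square of the imaginary part only adds to the modulus.
    1-z-low : ∀ η → 0ℚ ℚ.< η → ∀∞ λ j →
      1ℚ ℚ.≤ normℚ (1ℂ - z) j ℚ.* ((recip s ℚ.+ η) ℚ.* (recip s ℚ.+ η))
    1-z-low η 0<η =
      let y = recip s ℚ.+ η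
          0<y = ℚₚ.+-mono-< (0<recip 0<s) 0<η
          ε , 0<ε , lt = shrink {y} 0<y (0<* 0<s 0<η)
      in ∀∞-map (λ j le →
           let a = seq (re z) j ; b = seq (im z) j
               0≤y = ℚₚ.<⇒≤ 0<y
               a≤ : a ℚ.≤ ρ ℚ.+ ε
               a≤ = ℚₚ.≤-trans (p≤∣p∣ a) (sq⇒∣∣≤ (0≤c+ε (nonneg z≼ρ) 0<ε)
                      (ℚₚ.≤-trans (≤-by (b ℚ.* b) (0≤sq b) ≡.refl) le))
               1≤ : 1ℚ ℚ.≤ (1ℚ ℚ.+ ℚ.- a) ℚ.* y
               1≤ = ≤-by ((s ℚ.* η ℚ.- y ℚ.* ε) ℚ.+ (ρ ℚ.+ ε ℚ.- a) ℚ.* y)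
                      (0≤+ (p≤q⇒0≤q-p (ℚₚ.<⇒≤ lt)) (0≤* (p≤q⇒0≤q-p a≤) 0≤y))
                      (≡.trans
                        (solveℚ 5 (λ t η ρ ε a → (conℚ 1ℚ ⊕ ⊝ a) ⊗ (t ⊕ η) ⊜ (conℚ 1ℚ ⊖ ρ) ⊗ t
                           ⊕ (((conℚ 1ℚ ⊖ ρ) ⊗ η ⊖ (t ⊕ η) ⊗ ε) ⊕ (ρ ⊕ ε ⊖ a) ⊗ (t ⊕ η))) ≡.refl (recip s) η ρ ε a)
                        (≡.cong (ℚ._+ ((s ℚ.* η ℚ.- y ℚ.* ε) ℚ.+ (ρ ℚ.+ ε ℚ.- a) ℚ.* y)) (recip-inv 0<s)))
           in ℚₚ.≤-trans (≤ˡ (ℚₚ.*-identityˡ 1ℚ) (*-mono 0≤1 1≤ 0≤1 1≤))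
                (≤-by ((0ℚ ℚ.+ ℚ.- b) ℚ.* (0ℚ ℚ.+ ℚ.- b) ℚ.* (y ℚ.* y)) (0≤* (0≤sq (0ℚ ℚ.+ ℚ.- b)) (0≤sq y))
                  (solveℚ 3 (λ p q y → (p ⊗ p ⊕ q ⊗ q) ⊗ (y ⊗ y) ⊜ (p ⊗ y) ⊗ (p ⊗ y) ⊕ q ⊗ q ⊗ (y ⊗ y)) ≡.refl
                    (1ℚ ℚ.+ ℚ.- a) (0ℚ ℚ.+ ℚ.- b) y)))
         (Bd.eventually (within z≼ρ ε 0<ε))

    1-z-#0 : (1ℂ - z) #0
    1-z-#0 = mk#0 (1ℂ - z) (0<recip 0<Y) (∀∞-map (λ j le →
        ≤ˡ (ℚₚ.*-identityˡ (recip Y)) (≤ʳ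
          (≡.trans (ℚₚ.*-assoc (normℚ (1ℂ - z) j) Y (recip Y))
            (≡.trans (≡.cong (normℚ (1ℂ - z) j ℚ.*_) (recip-inv 0<Y)) (ℚₚ.*-identityʳ _)))
          (*-monoʳ (ℚₚ.<⇒≤ (0<recip 0<Y)) le)))
      (1-z-low 1ℚ 0<1))
      where
      y = recip s ℚ.+ 1ℚ
      0<y = ℚₚ.+-mono-< (0<recip 0<s) 0<1
      Y = y ℚ.* y
      0<Y = 0<* 0<y 0<y

    ℂ-1-z-inverse : Σ ℂ λ w → ((1ℂ - z) * w ≈ 1ℂ) × w ≼ recip (1ℚ ℚ.- ρ)
    ℂ-1-z-inverse = inv (1ℂ - z) 1-z-#0 , *-inverse (1ℂ - z) 1-z-#0 ,
      mk≼ (ℚₚ.<⇒≤ (0<recip 0<s)) λ η 0<η →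
        let ε , 0<ε , low′ = low {∣ 1ℂ - z ∣²} 1-z-#0 in
        bd (∀∞-zip (λ j e (a , b) →
            let N = normℚ (1ℂ - z) j
                y² = (recip s ℚ.+ η) ℚ.* (recip s ℚ.+ η)
                0<N = ℚₚ.<-≤-trans 0<ε a
            in ≤ˡ (≡.trans (ℚₚ.*-identityʳ (recip N)) (≡.sym e)) (≤ʳ
                 (≡.trans (≡.sym (ℚₚ.*-assoc (recip N) N y²))
                   (≡.trans (≡.cong (ℚ._* y²) (≡.trans (ℚₚ.*-comm (recip N) N) (recip-inv 0<N))) (ℚₚ.*-identityˡ y²)))
                 (*-monoˡ (ℚₚ.<⇒≤ (0<recip 0<N)) b)))
          (normℚ-inv (1ℂ - z) 1-z-#0) (∀∞-zip (λ _ → _,_) low′ (1-z-low η 0<η)))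

ℂ-normedAlgebra : NormedAlgebra
ℂ-normedAlgebra = record
  { commutativeRing = ℂ-commutativeRing
  ; scalars       = ℚ→ℂ
  ; _≼_           = _≼_
  ; ≼-resp        = ≼-resp
  ; ≼-mono        = ≼-mono
  ; ≼⇒0≤          = nonneg
  ; 0≼0           = 0≼0
  ; 1≼1           = 1≼1
  ; ≼-+           = ≼-+
  ; ≼-*           = ≼-*
  ; ≼-neg         = ≼-neg
  ; ≼-small       = ≼-small
  ; bounded       = ℂ-bounded
  ; 1-z-inverse   = ℂ-1-z-inverse
  }

-- The complex products and theta series as an instance

module ℂR = CommutativeRing ℂ-commutativeRing
module ℂL = NormedAlgebraProperties ℂ-normedAlgebra
module ℂS = Summation ℂ-normedAlgebra
module ℂP = Products ℂ-normedAlgebra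
module ℂG = GaussianForms ℂ-normedAlgebra

⟶⇒lim : ∀ {s L} → s ⟶ L → s ℂL.⟶ L
⟶⇒lim {s} {L} h ε 0<ε = ∀∞-map (λ n (δ , 0<δ , g) → Bd⇒≼ (ℚₚ.<⇒≤ 0<ε)
    (bd (∀∞-map (λ j → ℚₚ.≤-trans (≤-by {normℚ (s n - L) j} δ (ℚₚ.<⇒≤ 0<δ) ≡.refl)) g)))
  (h ε 0<ε)

sq-∣∣<1 : ∀ x → ∣ x ∣< 1ℚ → ∣ x * x ∣< 1ℚ
sq-∣∣<1 x x<1 = ∣∣<1-cong (x ^ 2) (x * x) (ℂR.*-congˡ (ℂR.sym (ℂR.*-identityʳ x))) (^-∣∣<1 x 1 x<1)

^≡^ : ∀ x n → x ^ n ≡ x ℂP.^ n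
^≡^ x zero    = ≡.refl
^≡^ x (suc n) = ≡.cong (x *_) (^≡^ x n)

zpow≡zpow : ∀ x x# i → zpow x x# i ≡ ℂP.zpow x (inv x x#) i
zpow≡zpow x x# (+ n)    = ^≡^ x n
zpow≡zpow x x# -[1+ n ] = ^≡^ (inv x x#) (suc n)

partialProduct≡ : ∀ l q n → partialProduct (qFactor l q) n ≡ ℂP.qProduct l q n
partialProduct≡ l q zero    = ≡.refl
partialProduct≡ l q (suc n) = ≡.cong₂ (λ x y → x * (1ℂ - l * y)) (partialProduct≡ l q n) (^≡^ q n)

qPoch-limit : ∀ l q q<1 → ℂP.qProduct l q ℂL.⟶ qPoch l q q<1
qPoch-limit l q q<1 = ℂL.lim-cong (λ n → ℂR.reflexive (partialProduct≡ l q n)) ℂR.refl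
  (⟶⇒lim (lim-converges (partialProduct (qFactor l q)) (qPoch-multipliable l q q<1)))

∣∣<1⇒inverse : ∀ q → ∣ q ∣< 1ℚ → ℂP.BoundedInverse q
∣∣<1⇒inverse q q<1 =
  let ρ , 0≤ρ , ρ<1 , h = ∣∣<1⇒Bd q q<1
  in ℂP.boundedInverse (Bd⇒≼ 0≤ρ h) ρ<1

-- |w|² is bounded by C, so |z|² is at least the lower bound of |zw|² divided by C; the summand 1
-- keeps C positive.
*-#0ˡ : ∀ z w → (z * w) #0 → z #0
*-#0ˡ z w zw# =
  let ε , 0<ε , h = low {∣ z * w ∣²} zw#
      B , _ , bd g = bounded w
      C = 1ℚ ℚ.+ B ℚ.* B
      0<C = ℚₚ.<-≤-trans 0<1 (≤-by (B ℚ.* B) (0≤sq B) ≡.refl)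
  in mk#0 z (0<* 0<ε (0<recip 0<C)) (∀∞-zip (λ j a b →
       ≤ʳ (≡.trans (ℚₚ.*-assoc (normℚ z j) C (recip C))
         (≡.trans (≡.cong (normℚ z j ℚ.*_) (recip-inv 0<C)) (ℚₚ.*-identityʳ _)))
         (*-monoʳ {r = recip C} (ℚₚ.<⇒≤ (0<recip 0<C)) (ℚₚ.≤-trans (≤ʳ (normℚ-* z w j) a)
           (*-monoˡ (0≤normℚ z j) (ℚₚ.≤-trans b (≤-by 1ℚ 0≤1 (ℚₚ.+-comm 1ℚ (B ℚ.* B))))))))
     h g)

qPoch-#0 : ∀ q q<1 → qPoch q q q<1 #0
qPoch-#0 q q<1 =
  let r , z , z≼½ , e = ℂP.qProduct-limit-near-unit (∣∣<1⇒inverse q q<1) (qPoch-limit q q q<1)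
  in *-#0ˡ (qPoch q q q<1) r (#0-resp (1ℂ - z) (qPoch q q q<1 * r) e (1-z-#0 z≼½ ½<1))

-- The terms before M, where halving may fail, are absorbed one at a time: restoring the first term
-- replaces C by u 0 + 2C.
halving-bound : ∀ (u : ℕ → ℚ) M → (∀ n → M ℕ.≤ n → u (suc n) ℚ.≤ ½ ℚ.* u n) → (∀ n → 0ℚ ℚ.≤ u n) →
  Σ ℚ λ C → ∀ n → u n ℚ.≤ C ℚ.* ½ ^ʳ n
halving-bound u zero step 0≤u = u 0 , bound
  where
  bound : ∀ n → u n ℚ.≤ u 0 ℚ.* ½ ^ʳ n
  bound zero    = ℚₚ.≤-reflexive (≡.sym (ℚₚ.*-identityʳ (u 0)))
  bound (suc n) = ℚₚ.≤-trans (step n z≤n) (≤ʳ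
    (solveℚ 2 (λ u v → conℚ ½ ⊗ (u ⊗ v) ⊜ u ⊗ (conℚ ½ ⊗ v)) ≡.refl (u 0) (½ ^ʳ n))
    (*-monoˡ {r = ½} (ℚₚ.<⇒≤ 0<½) (bound n)))
halving-bound u (suc M) step 0≤u =
  let C , h = halving-bound (λ n → u (suc n)) M (λ n le → step (suc n) (s≤s le)) (λ n → 0≤u (suc n))
      0≤C = ℚₚ.≤-trans (0≤u 1) (≤ʳ (ℚₚ.*-identityʳ C) (h 0))
  in u 0 ℚ.+ 2ℚ ℚ.* C , λ
    { zero    → ≤-by (2ℚ ℚ.* C) (0≤* {2ℚ} (ℚₚ.nonNegative⁻¹ 2ℚ) 0≤C) (ℚₚ.*-identityʳ _)
    ; (suc n) → ℚₚ.≤-trans (h n) (≤-by (u 0 ℚ.* ½ ^ʳ suc n) (0≤* (0≤u 0) (0≤^ (ℚₚ.<⇒≤ 0<½) (suc n)))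
        (solveℚ 3 (λ u c v → (u ⊕ conℚ 2ℚ ⊗ c) ⊗ (conℚ ½ ⊗ v) ⊜ c ⊗ v ⊕ u ⊗ (conℚ ½ ⊗ v)) ≡.refl (u 0) C (½ ^ʳ n)))
    }

θ-term-pos : ∀ a b n → θ-term a b (+ n) ≡ a ^ T (suc n) * b ^ T n
θ-term-pos a b n = ≡.cong₂ (λ x y → a ^ x * b ^ y) (tri⁺-pos n) (tri⁻-pos n)

θ-term-neg : ∀ a b n → θ-term a b (ℤ.- (+ n)) ≡ a ^ T n * b ^ T (suc n)
θ-term-neg a b zero    = ≡.refl
θ-term-neg a b (suc n) = ≡.cong₂ (λ x y → a ^ x * b ^ y) (tri⁺-neg n) (tri⁻-neg n)

abstract
  θ-half-decay : ∀ a b → ∣ a * b ∣< 1ℚ → Σ ℚ λ C → ∀ n → θ-half a b n ≼ C ℚ.* ½ ^ʳ n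
  θ-half-decay a b ab<1 = from-majorant (θ-majorant a b ab<1)
    where
    from-majorant : θ-Majorant a b → Σ ℚ λ C → ∀ n → θ-half a b n ≼ C ℚ.* ½ ^ʳ n
    from-majorant θ =
      let C , h = halving-bound u M step 0≤u
      in C , λ n → ≼-mono (h n) (Bd⇒≼ (0≤u n) (bound n))
      where open θ-Majorant θ

-- Exchanging a and b reflects the series, so the second half is bounded by the one-sided estimate
-- for (b, a). The sum of the two constants serves both halves.
θ-decay : ∀ a b → ∣ a * b ∣< 1ℚ → Σ ℚ (ℂS.Decay (θ-term a b))
θ-decay a b ab<1 = combine (θ-half-decay a b ab<1)
    (θ-half-decay b a (∣∣<1-cong (a * b) (b * a) (ℂR.*-comm b a) ab<1))
  where
  combine : (Σ ℚ λ C → ∀ n → θ-half a b n ≼ C ℚ.* ½ ^ʳ n) → (Σ ℚ λ C → ∀ n → θ-half b a n ≼ C ℚ.* ½ ^ʳ n) →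
    Σ ℚ (ℂS.Decay (θ-term a b))
  combine (C , h) (C′ , h′) = C ℚ.+ C′ , ℂS.decay λ
    { (+ n)    → ≼-resp (ℂR.reflexive (≡.sym (θ-term-pos a b n)))
        (weaken n (≤-by {C} C′ (0≤coefficient h′) ≡.refl) (h n))
    ; -[1+ n ] → ≼-resp (ℂR.trans (ℂR.*-comm _ _) (ℂR.reflexive (≡.sym (θ-term-neg a b (suc n)))))
        (weaken (suc n) (≤-by {C′} C (0≤coefficient h) (ℚₚ.+-comm C C′)) (h′ (suc n)))
    }
    where
    0≤coefficient : ∀ {a b C} → (∀ n → θ-half a b n ≼ C ℚ.* ½ ^ʳ n) → 0ℚ ℚ.≤ C
    0≤coefficient {C = C} h = ≤ʳ (ℚₚ.*-identityʳ C) (_≼_.nonneg (h 0))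
    weaken : ∀ {z C D} n → C ℚ.≤ D → z ≼ C ℚ.* ½ ^ʳ n → z ≼ D ℚ.* ½ ^ʳ n
    weaken n C≤D h = ≼-mono (*-monoʳ (0≤^ (ℚₚ.<⇒≤ 0<½) n) C≤D) h

θ-isTheta : ∀ a b → ℂG.IsTheta a b (θ-term a b)
θ-isTheta a b = ℂG.theta-from-terms
  (λ n → ℂR.reflexive (≡.trans (θ-term-pos a b n) (≡.cong₂ _*_ (^≡^ a (T (suc n))) (^≡^ b (T n)))))
  (λ n → ℂR.reflexive (≡.trans (θ-term-neg a b n) (≡.cong₂ _*_ (^≡^ a (T n)) (^≡^ b (T (suc n))))))

S≈ : ∀ t N → partialSum (λ n → t (+ n)) N + partialSum (λ n → t -[1+ n ]) N ≈ ℂL.S t N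
S≈ t zero    = ℂR.+-identityˡ 0ℂ
S≈ t (suc N) = ℂR.trans (ℂL.+-interchange _ _ _ _) (ℂR.+-congʳ (S≈ t N))

f-sum : ∀ a b ab<1 → ℂL.HasSum (θ-term a b) (f a b ab<1)
f-sum a b ab<1 = ℂL.lim-cong (S≈ (θ-term a b)) ℂR.refl (ℂL.lim-+
  (⟶⇒lim (lim-converges (partialSum (λ n → θ-term a b (+ n))) (θ-summable⁺ a b ab<1)))
  (⟶⇒lim (lim-converges (partialSum (λ n → θ-term a b -[1+ n ])) (θ-summable⁻ a b ab<1))))

ℂ-qSeries : QSeries ℂ-normedAlgebra
ℂ-qSeries = record
  { Small         = λ q → ∣ q ∣< 1ℚ
  ; small-square  = λ {q} → sq-∣∣<1 q
  ; small-inverse = λ {q} → ∣∣<1⇒inverse q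
  ; qPoch         = qPoch
  ; qPoch-limit   = qPoch-limit
  ; θ-term        = θ-term
  ; θ-isTheta     = θ-isTheta
  ; θ-decay       = θ-decay
  ; f             = f
  ; f-sum         = f-sum
  }

module ℂQ = QSeriesProperties ℂ-normedAlgebra ℂ-qSeries

module Root (p : ℂ) (p# : p #0) where
  zpow≈zpow : ∀ i → zpow p p# i ≈ ℂP.zpow p (inv p p#) i
  zpow≈zpow i = ℂR.reflexive (zpow≡zpow p p# i)

  open ℂQ.Powers {p} {inv p p#} (*-inverse p p#) (zpow p p#) zpow≈zpow public

  -- Brings the base q^k of the products into the family of powers of the fixed root.
  zpow-4k : ∀ {q} k → p ^ 4 ≈ q → zpow p p# (+ 4 ℤ.* + k) ≈ q ^ k
  zpow-4k {q} k p⁴≈q = ℂR.trans (zpow≈zpow (+ 4 ℤ.* + k))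
    (ℂR.trans (ℂR.sym (ℂP.zpow-zpow (*-inverse p p#) (+ 4) (+ k)))
      (ℂR.trans (ℂP.^-cong p⁴≈q k) (ℂR.reflexive (≡.sym (^≡^ q k)))))

cube : ∀ x → x ^ 3 ≈ x * (x * x)
cube x = ℂR.*-congˡ {x} (ℂR.*-congˡ {x} (ℂR.*-identityʳ x))

difference-form : ∀ x y → 1ℂ * x - y ≈ x + - 1ℂ * y
difference-form = ℂL.1*x-y≈x+-1*y

sum-form : ∀ x y → 1ℂ * x + y ≈ x + 1ℂ * y
sum-form = ℂL.1*x+y≈x+1*y

f-irrelevant : ∀ a b h h′ → f a b h ≈ f a b h′
f-irrelevant a b h h′ = ℂL.lim-unique {ℂL.S (θ-term a b)} (f-sum a b h) (f-sum a b h′)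

-- The proof of |x²| < 1 is the one in the definition of φ; with the predicate G abstract, it is matched
-- without unfolding the sum of the series.
φ-domain : ∀ x x<1 (G : ∣ x * x ∣< 1ℚ → Set) → (∀ h → G h) →
  G (∣∣<1-resp (x ^ 2) (x * x)
      (λ j → ≡.trans (normℚ-^ x 2 j) (≡.trans (≡.cong (normℚ x j ℚ.*_) (ℚₚ.*-identityʳ (normℚ x j)))
        (≡.sym (normℚ-* x x j))))
      (^-∣∣<1 x 1 x<1))
φ-domain x x<1 G g = g _

φ-elim : ∀ x x<1 (G : ℂ → Set) → (∀ h → G (f x x h)) → G (φ x x<1)
φ-elim x x<1 G g = φ-domain x x<1 (λ h → G (f x x h)) g

φ≈f : ∀ x x<1 h → φ x x<1 ≈ f x x h
φ≈f x x<1 h = φ-elim x x<1 (λ z → z ≈ f x x h) (λ h′ → f-irrelevant x x h′ h)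

-- The two identities

2m-2≡2[m-1] : ∀ m → + 2 ℤ.* m ℤ.- + 2 ≡ + 2 ℤ.* (m ℤ.- + 1)
2m-2≡2[m-1] = solveℤ 1 (λ m → conℤ (+ 2) ⊠ m ⊟ conℤ (+ 2) ≜ conℤ (+ 2) ⊠ (m ⊟ conℤ (+ 1))) ≡.refl

c+c≡2c : ∀ c → c ℤ.+ c ≡ + 2 ℤ.* c
c+c≡2c = solveℤ 1 (λ c → c ⊞ c ≜ conℤ (+ 2) ⊠ c) ≡.refl

theorem1p3 :
    (k m : ℕ) (0<k : 0 ℕ.< k) → 2 ∣ k → 1 ℕ.≤ m →
    (q q¼ : ℂ) (root : q¼ ^ 4 ≈ q) (q≢0 : q #0) (∣q∣<1 : ∣ q ∣< 1ℚ) →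
    let
      K : ℤ
      K = + k

      -- i = m/2 is half an integer, but 2i−1 = m−1 and 4i−2 = 2m−2 are integers
      2i-1 : ℤ
      2i-1 = + m ℤ.- + 1
      4i-2 : ℤ
      4i-2 = + 2 ℤ.* + m ℤ.- + 2

      q¼≢0 = root-#0 root q≢0
      ∣q¼∣<1 = root-∣∣<1 root ∣q∣<1

      q^[_/4] : ℤ → ℂ
      q^[_/4] = zpow q¼ q¼≢0
      q^[_/2] : ℤ → ℂ
      q^[_/2] = λ r → q^[ + 2 ℤ.* r /4]

      -- the arguments of f, φ, ψ and the base q^k lie in the domains of convergence
      dom = zpow-∣∣<1 q¼ q¼≢0 ∣q¼∣<1
      dom₂ = λ r t pos → zpow*zpow-∣∣<1 q¼ q¼≢0 ∣q¼∣<1 r t pos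
      dom₂⁻ = λ r t pos → neg*neg-∣∣<1 q^[ r /4] q^[ t /4] (dom₂ r t pos)
      ∣q^k∣<1 = ^-∣∣<1′ q 0<k ∣q∣<1
      ∣q^k/4∣<1 = dom K (ℤ.+<+ 0<k)
      ∣q^k/2∣<1 = dom (+ 2 ℤ.* K) (0<k⇒0<nk 1 k 0<k)

      num = qPoch₂ q^[ K ℤ.- 4i-2 /4] q^[ + 3 ℤ.* K ℤ.+ 4i-2 /4] (q ^ k) ∣q^k∣<1
      den = qPoch₂ q^[ K ℤ.+ 4i-2 /4] q^[ + 3 ℤ.* K ℤ.- 4i-2 /4] (q ^ k) ∣q^k∣<1

      f-num = f (- q^[ K ℤ.- 4i-2 /4]) (- q^[ + 3 ℤ.* K ℤ.+ 4i-2 /4])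
                (dom₂⁻ (K ℤ.- 4i-2) (+ 3 ℤ.* K ℤ.+ 4i-2) (0<[k-d]+[3k+d] k 4i-2 0<k))
      f-den = f (- q^[ K ℤ.+ 4i-2 /4]) (- q^[ + 3 ℤ.* K ℤ.- 4i-2 /4])
                (dom₂⁻ (K ℤ.+ 4i-2) (+ 3 ℤ.* K ℤ.- 4i-2) (0<[k+d]+[3k-d] k 4i-2 0<k))
    in
    (num≢0 : num #0) (den≢0 : den #0) →
    let
      U = q^[ 2i-1 /4] * (num ÷ den [ den≢0 ])

      U≢0 : U #0
      U≢0 = *-#0 q^[ 2i-1 /4] (num ÷ den [ den≢0 ])
              (zpow-#0 q¼ q¼≢0 2i-1) (÷-#0 num den den≢0 num≢0)

      rhs-den = q^[ 2i-1 /4] * ψ q^[ K /2] ∣q^k/2∣<1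
                * f (- q^[ K ℤ.- 4i-2 /4]) (- q^[ K ℤ.+ 4i-2 /4])
                    (dom₂⁻ (K ℤ.- 4i-2) (K ℤ.+ 4i-2) (0<[k-d]+[k+d] k 4i-2 0<k))

      rhs-num₁ = φ q^[ K /4] ∣q^k/4∣<1
                 * f (- q^[ 2i-1 /2]) (- q^[ K ℤ.- 2i-1 /2])
                     (dom₂⁻ (+ 2 ℤ.* 2i-1) (+ 2 ℤ.* (K ℤ.- 2i-1)) (0<2c+2[k-c] k 2i-1 0<k))
      rhs-num₂ = φ (- q^[ K /4]) (neg-∣∣<1 q^[ K /4] ∣q^k/4∣<1)
                 * f q^[ 2i-1 /2] q^[ K ℤ.- 2i-1 /2]
                     (dom₂ (+ 2 ℤ.* 2i-1) (+ 2 ℤ.* (K ℤ.- 2i-1)) (0<2c+2[k-c] k 2i-1 0<k))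
    in
    (Σ (f-den #0) λ f-den≢0 → U ≈ q^[ 2i-1 /4] * (f-num ÷ f-den [ f-den≢0 ]))
    × (Σ (rhs-den #0) λ rhs-den≢0 →
        (1ℂ ÷ U [ U≢0 ] - U ≈ rhs-num₁ ÷ rhs-den [ rhs-den≢0 ])
        × (1ℂ ÷ U [ U≢0 ] + U ≈ rhs-num₂ ÷ rhs-den [ rhs-den≢0 ]))
theorem1p3 k m 0<k _ _ q q¼ root q≢0 ∣q∣<1 num≢0 den≢0 =
  let
    K : ℤ
    K = + k
    2i-1 : ℤ
    2i-1 = + m ℤ.- + 1
    4i-2 : ℤ
    4i-2 = + 2 ℤ.* + m ℤ.- + 2
    d≡2c : 4i-2 ≡ + 2 ℤ.* 2i-1
    d≡2c = 2m-2≡2[m-1] (+ m)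
    q¼≢0 = root-#0 {q¼} {q} root q≢0
    ∣q¼∣<1 = root-∣∣<1 {q¼} {q} root ∣q∣<1
    u : ℤ → ℂ
    u = zpow q¼ q¼≢0
    dom = zpow-∣∣<1 q¼ q¼≢0 ∣q¼∣<1
    dom₂ = λ r t pos → zpow*zpow-∣∣<1 q¼ q¼≢0 ∣q¼∣<1 r t pos
    dom₂⁻ = λ r t pos → neg*neg-∣∣<1 (u r) (u t) (dom₂ r t pos)
    ∣q^k∣<1 = ^-∣∣<1′ q {k} 0<k ∣q∣<1
    ∣q^k/4∣<1 = dom K (ℤ.+<+ 0<k)
    ∣q^k/2∣<1 = dom (+ 2 ℤ.* K) (0<k⇒0<nk 1 k 0<k)
    hα = dom₂⁻ (K ℤ.+ 4i-2) (+ 3 ℤ.* K ℤ.- 4i-2) (0<[k+d]+[3k-d] k 4i-2 0<k)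
    hδ = dom₂⁻ (K ℤ.- 4i-2) (+ 3 ℤ.* K ℤ.+ 4i-2) (0<[k-d]+[3k+d] k 4i-2 0<k)
    h₃ = dom₂⁻ (K ℤ.- 4i-2) (K ℤ.+ 4i-2) (0<[k-d]+[k+d] k 4i-2 0<k)
    hβ⁻ = dom₂⁻ (+ 2 ℤ.* 2i-1) (+ 2 ℤ.* (K ℤ.- 2i-1)) (0<2c+2[k-c] k 2i-1 0<k)
    hβ⁺ = dom₂ (+ 2 ℤ.* 2i-1) (+ 2 ℤ.* (K ℤ.- 2i-1)) (0<2c+2[k-c] k 2i-1 0<k)
    num = qPoch₂ (u (K ℤ.- 4i-2)) (u (+ 3 ℤ.* K ℤ.+ 4i-2)) (q ^ k) ∣q^k∣<1
    den = qPoch₂ (u (K ℤ.+ 4i-2)) (u (+ 3 ℤ.* K ℤ.- 4i-2)) (q ^ k) ∣q^k∣<1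
    E = qPoch (q ^ k) (q ^ k) ∣q^k∣<1
    E₂ = qPoch (u (+ 2 ℤ.* K)) (u (+ 2 ℤ.* K)) ∣q^k/2∣<1
    f-num = f (- u (K ℤ.- 4i-2)) (- u (+ 3 ℤ.* K ℤ.+ 4i-2)) hδ
    f-den = f (- u (K ℤ.+ 4i-2)) (- u (+ 3 ℤ.* K ℤ.- 4i-2)) hα
    f₃ = f (- u (K ℤ.- 4i-2)) (- u (K ℤ.+ 4i-2)) h₃
    ψ₂ = ψ (u (+ 2 ℤ.* K)) ∣q^k/2∣<1
    φ⁺ = φ (u K) ∣q^k/4∣<1
    φ⁻ = φ (- u K) (neg-∣∣<1 (u K) ∣q^k/4∣<1)
    f⁻ = f (- u (+ 2 ℤ.* 2i-1)) (- u (+ 2 ℤ.* (K ℤ.- 2i-1))) hβ⁻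
    f⁺ = f (u (+ 2 ℤ.* 2i-1)) (u (+ 2 ℤ.* (K ℤ.- 2i-1))) hβ⁺
    s = u 2i-1
    U = s * (num ÷ den [ den≢0 ])
    rhs-den = s * ψ₂ * f₃
    rhs-num₁ = φ⁺ * f⁻
    rhs-num₂ = φ⁻ * f⁺

    u4K≈ : u (+ 4 ℤ.* K) ≈ q ^ k
    u4K≈ = Root.zpow-4k q¼ q¼≢0 k root
    f-num≈ : f-num ≈ num * E
    f-num≈ = Root.f-numerator q¼ q¼≢0 K 4i-2
      {(- u (K ℤ.- 4i-2))} {(- u (+ 3 ℤ.* K ℤ.+ 4i-2))} {q ^ k} hδ ∣q^k∣<1 ℂ-refl ℂ-refl u4K≈
    f-den≈ : f-den ≈ den * E
    f-den≈ = Root.f-denominator q¼ q¼≢0 K 4i-2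
      {(- u (K ℤ.+ 4i-2))} {(- u (+ 3 ℤ.* K ℤ.- 4i-2))} {q ^ k} hα ∣q^k∣<1 ℂ-refl ℂ-refl u4K≈
    f₃≈ : f₃ ≈ num * den * E₂
    f₃≈ = Root.f-product q¼ q¼≢0 K 4i-2
      {(- u (K ℤ.- 4i-2))} {(- u (K ℤ.+ 4i-2))} {q ^ k} {num} {den} h₃ ∣q^k/2∣<1 ∣q^k∣<1 ℂ-refl ℂ-refl u4K≈ ℂ-refl ℂ-refl
    ψE₂≈ : ψ₂ * E₂ ≈ E * E
    ψE₂≈ = Root.ψ-powers q¼ q¼≢0 K {u (+ 2 ℤ.* K) ^ 3} {q ^ k}
      (^-∣∣<1 (u (+ 2 ℤ.* K)) 3 ∣q^k/2∣<1) ∣q^k/2∣<1 ∣q^k∣<1 (cube (u (+ 2 ℤ.* K))) u4K≈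
    s*s≈ : s * s ≈ u (+ 2 ℤ.* 2i-1)
    s*s≈ = Root.u-+ q¼ q¼≢0 {2i-1} {2i-1} (c+c≡2c 2i-1)

    -- All denominators reduce to `num`, `den` and the Euler products: `f-den` is den · E, `f₃` is
    -- num · den · E₂, and `ψ₂` divides E².
    E≢0 : E #0
    E≢0 = qPoch-#0 (q ^ k) ∣q^k∣<1
    f-den≢0 : f-den #0
    f-den≢0 = #0-resp (den * E) f-den f-den≈ (*-#0 den E den≢0 E≢0)
    f₃≢0 : f₃ #0
    f₃≢0 = #0-resp (num * den * E₂) f₃ f₃≈
      (*-#0 (num * den) E₂ (*-#0 num den num≢0 den≢0) (qPoch-#0 (u (+ 2 ℤ.* K)) ∣q^k/2∣<1))
    ψ₂≢0 : ψ₂ #0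
    ψ₂≢0 = *-#0ˡ ψ₂ E₂ (#0-resp (E * E) (ψ₂ * E₂) ψE₂≈ (*-#0 E E E≢0 E≢0))
    s≢0 : s #0
    s≢0 = zpow-#0 q¼ q¼≢0 2i-1
    U≢0 : U #0
    U≢0 = *-#0 s (num ÷ den [ den≢0 ]) s≢0 (÷-#0 num den den≢0 num≢0)
    rhs-den≢0 : rhs-den #0
    rhs-den≢0 = *-#0 (s * ψ₂) f₃ (*-#0 s ψ₂ s≢0 ψ₂≢0) f₃≢0
    U-quotient : U ≈ s * (f-num ÷ f-den [ f-den≢0 ])
    U-quotient = ℂR.*-congˡ {s} (ℂG.quotient-rescale {num} {den} {inv den den≢0} {E} {f-num} {f-den} {inv f-den f-den≢0}
      (*-inverse den den≢0) (*-inverse f-den f-den≢0) f-num≈ f-den≈)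
    -- The case σ = -1, where the argument -σ Q of φ is Q; the sum below is the case σ = 1, with
    -- argument -Q.
    difference : 1ℂ ÷ U [ U≢0 ] - U ≈ rhs-num₁ ÷ rhs-den [ rhs-den≢0 ]
    difference = Root.reciprocal q¼ q¼≢0 K 2i-1 4i-2 d≡2c (- 1ℂ) ℂG.-1*-1≈1
      {(- u (K ℤ.+ 4i-2))} {(- u (+ 3 ℤ.* K ℤ.- 4i-2))} {(- u (K ℤ.- 4i-2))} {(- u (+ 3 ℤ.* K ℤ.+ 4i-2))}
      {(- u (+ 2 ℤ.* 2i-1))} {(- u (+ 2 ℤ.* (K ℤ.- 2i-1)))} {u K} {u K}
      hα hδ hβ⁻ (sq-∣∣<1 (u K) ∣q^k/4∣<1) ℂ-refl ℂ-refl ℂ-refl ℂ-refl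
      (ℂL.-x≈-1*x (u (+ 2 ℤ.* 2i-1))) (ℂL.-x≈-1*x (u (+ 2 ℤ.* (K ℤ.- 2i-1))))
      (ℂL.x≈-[-1]*x (u K)) (ℂL.x≈-[-1]*x (u K))
      {s} {num} {den} {inv den den≢0} {num ÷ den [ den≢0 ]} {U} {inv U U≢0}
      {ψ₂} {f₃} {s * ψ₂} {rhs-den} {inv rhs-den rhs-den≢0}
      {E} {E₂} {f-den} {f-num} {f⁻} {φ⁺} {φ⁺ * f⁻} {1ℂ ÷ U [ U≢0 ] - U}
      ℂ-refl ℂ-refl ℂ-refl (φ≈f (u K) ∣q^k/4∣<1 (sq-∣∣<1 (u K) ∣q^k/4∣<1))
      (*-inverse den den≢0) ℂ-refl ℂ-refl (*-inverse U U≢0) s*s≈ ψE₂≈ f₃≈ f-den≈ f-num≈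
      ℂ-refl ℂ-refl (*-inverse rhs-den rhs-den≢0) (difference-form (inv U U≢0) U) ℂ-refl
    sum : 1ℂ ÷ U [ U≢0 ] + U ≈ rhs-num₂ ÷ rhs-den [ rhs-den≢0 ]
    sum = Root.reciprocal q¼ q¼≢0 K 2i-1 4i-2 d≡2c 1ℂ (ℂ-*-identityˡ 1ℂ)
      {(- u (K ℤ.+ 4i-2))} {(- u (+ 3 ℤ.* K ℤ.- 4i-2))} {(- u (K ℤ.- 4i-2))} {(- u (+ 3 ℤ.* K ℤ.+ 4i-2))}
      {u (+ 2 ℤ.* 2i-1)} {u (+ 2 ℤ.* (K ℤ.- 2i-1))} {(- u K)} {(- u K)}
      hα hδ hβ⁺ (sq-∣∣<1 (- u K) (neg-∣∣<1 (u K) ∣q^k/4∣<1)) ℂ-refl ℂ-refl ℂ-refl ℂ-refl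
      (ℂ-sym (ℂ-*-identityˡ (u (+ 2 ℤ.* 2i-1)))) (ℂ-sym (ℂ-*-identityˡ (u (+ 2 ℤ.* (K ℤ.- 2i-1)))))
      (ℂL.-x≈-1*x (u K)) (ℂL.-x≈-1*x (u K))
      {s} {num} {den} {inv den den≢0} {num ÷ den [ den≢0 ]} {U} {inv U U≢0}
      {ψ₂} {f₃} {s * ψ₂} {rhs-den} {inv rhs-den rhs-den≢0}
      {E} {E₂} {f-den} {f-num} {f⁺} {φ⁻} {φ⁻ * f⁺} {1ℂ ÷ U [ U≢0 ] + U}
      ℂ-refl ℂ-refl ℂ-refl (φ≈f (- u K) (neg-∣∣<1 (u K) ∣q^k/4∣<1) (sq-∣∣<1 (- u K) (neg-∣∣<1 (u K) ∣q^k/4∣<1)))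
      (*-inverse den den≢0) ℂ-refl ℂ-refl (*-inverse U U≢0) s*s≈ ψE₂≈ f₃≈ f-den≈ f-num≈
      ℂ-refl ℂ-refl (*-inverse rhs-den rhs-den≢0) (sum-form (inv U U≢0) U) ℂ-refl
  in (f-den≢0 , U-quotient) , rhs-den≢0 , difference , sum
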